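{- Let $A$ be a set of integers, each at least $3$, let $\mathcal C_A=\{C_a:a\in A\}$ and let $A_e$ be the set of even elements of $A$. Then, as $n\to\infty$: $ex(n,C_6,\mathcal C_A)=0$ if $6\in A$; $ex(n,C_6,\mathcal C_A)=\Theta(n^2)$ if $6\notin A$, $4\in A$ and $|A_e|\ge 2$; $ex(n,C_6,\mathcal C_A)=\Theta(n^3)$ if $4,6\notin A$ and $A_e\neq\emptyset$, or if $A_e=\{4\}$; $ex(n,C_6,\mathcal C_A)=\Theta(n^6)$ if $A_e=\emptyset$.
   Context: $C_k$ denotes the cycle with $k$ vertices. For a graph $H$ and a family of graphs $\mathcal F$, $ex(n,H,\mathcal F)$ is the maximum number of subgraphs isomorphic to $H$ in an $n$-vertex graph containing no member of $\mathcal F$ as a subgraph. -}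

module Defs where

open import Level using (0ℓ)
open import Data.Empty using (⊥)
open import Data.Fin using (Fin; zero; suc; toℕ)
open import Data.Fin.Properties using (any?; all?; suc-injective) renaming (_≟_ to _≟ᶠ_)
open import Data.Fin.Subset using (Subset; Side; inside; outside; _∈_) renaming (⊥ to ∅)
open import Data.Fin.Subset.Properties using (_∈?_; ∉⊥)
open import Data.List using (List; []; _∷_; length; filter; cartesianProductWith)
import Data.List.Membership.Propositional as List
open import Data.List.Membership.Propositional.Properties
  using (∈-cartesianProductWith⁺)
open import Data.List.Relation.Unary.All using ([]; _∷_)
open import Data.List.Relation.Unary.AllPairs using ([]; _∷_)
open import Data.List.Relation.Unary.Any using (here; there)
open import Data.List.Relation.Unary.Unique.Propositional using (Unique)
open import Data.List.Relation.Unary.Unique.Propositional.Properties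
  using (cartesianProductWith⁺)
open import Data.Nat using (ℕ; zero; suc; _*_; _≤_; _>_; z≤n; s≤s)
open import Data.Nat.Divisibility using (_∣_)
open import Data.Nat.Properties using (_≟_; ≤-antisym; ≤-refl; ≤-trans; ≤-total; 1+n≢n)
open import Data.Product using (∃; ∃-syntax; _×_; _,_; proj₁; proj₂; uncurry)
open import Data.Sum using (_⊎_; inj₁; inj₂; [_,_]′; swap)
open import Data.Vec using ([]; _∷_; tabulate)
import Data.Vec.Functional as Fun
open import Data.Vec.Properties using (∷-injective; lookup∘tabulate; lookup⇒[]=; []=⇒lookup)
open import Function using (_∘_; id)
open import Function.Bundles using (_⇔_; mk⇔; module Equivalence)
open import Function.Definitions using (Injective)
open import Relation.Binary using (Rel; Symmetric) renaming (Decidable to Decidable₂)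
open import Relation.Binary.PropositionalEquality
  using (_≡_; _≢_; _≗_; refl; sym; trans; cong; subst; subst₂)
open import Relation.Nullary using (¬_; Dec; yes; no; does; contradiction)
open import Relation.Nullary.Decidable using (map′; _×-dec_; _⊎-dec_; _→-dec_; dec-true)
open import Relation.Unary using (Pred; Decidable; _∩_)

private
  variable
    k n : ℕ

-- A simple graph on Fin n, built one vertex at a time: G ▷ N shifts the
-- vertices of G up by one and adds the new vertex zero, joined to the
-- (shifted) members of N.  Every simple graph on Fin n arises in exactly one
-- way, so _≡_ is equality of graphs.
infixl 5 _▷_

data Graph : ℕ → Set where
  []  : Graph zero
  _▷_ : Graph n → Subset n → Graph (suc n)

Adj : Graph n → Rel (Fin n) 0ℓ
Adj (G ▷ N) zero    zero    = ⊥
Adj (G ▷ N) zero    (suc j) = j ∈ N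
Adj (G ▷ N) (suc i) zero    = i ∈ N
Adj (G ▷ N) (suc i) (suc j) = Adj G i j

Adj? : (G : Graph n) → Decidable₂ (Adj G)
Adj? (G ▷ N) zero    zero    = no λ ()
Adj? (G ▷ N) zero    (suc j) = j ∈? N
Adj? (G ▷ N) (suc i) zero    = i ∈? N
Adj? (G ▷ N) (suc i) (suc j) = Adj? G i j

-- The graph whose edges are the pairs i < j with R i j; for symmetric R these
-- are all pairs i ≢ j with R i j (see Adj-fromRel).
fromRel : {R : Rel (Fin n) 0ℓ} → Decidable₂ R → Graph n
fromRel {n = zero}  R? = []
fromRel {n = suc n} R? =
  fromRel (λ i j → R? (suc i) (suc j)) ▷ tabulate (λ j → does (R? zero (suc j)))

private
  ∈-tabulate : {P : Pred (Fin n) 0ℓ} (P? : Decidable P) (j : Fin n) →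
               j ∈ tabulate (does ∘ P?) ⇔ P j
  ∈-tabulate {P = P} P? j = mk⇔ to from
    where
    to : j ∈ tabulate (does ∘ P?) → P j
    to j∈ with P? j | trans (sym (lookup∘tabulate (does ∘ P?) j)) ([]=⇒lookup j∈)
    ... | yes p | _ = p
    from : P j → j ∈ tabulate (does ∘ P?)
    from p = lookup⇒[]= j _ (trans (lookup∘tabulate (does ∘ P?) j) (dec-true (P? j) p))

Adj-fromRel : {R : Rel (Fin n) 0ℓ} (R? : Decidable₂ R) → Symmetric R →
              ∀ i j → Adj (fromRel R?) i j ⇔ (i ≢ j × R i j)
Adj-fromRel R? R-sym zero    zero    = mk⇔ (λ ()) (λ (i≢i , _) → contradiction refl i≢i)
Adj-fromRel R? R-sym zero    (suc j) =
  mk⇔ (λ a → (λ ()) , to a) (λ (_ , r) → from r)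
  where open Equivalence (∈-tabulate (λ j → R? zero (suc j)) j)
Adj-fromRel R? R-sym (suc i) zero    =
  mk⇔ (λ a → (λ ()) , R-sym (to a)) (λ (_ , r) → from (R-sym r))
  where open Equivalence (∈-tabulate (λ j → R? zero (suc j)) i)
Adj-fromRel R? R-sym (suc i) (suc j) =
  mk⇔ (λ a → (proj₁ (to a) ∘ suc-injective) , proj₂ (to a))
      (λ (i≢j , r) → from ((i≢j ∘ cong suc) , r))
  where open Equivalence (Adj-fromRel (λ i j → R? (suc i) (suc j)) R-sym i j)

edgeless : ∀ n → Graph n
edgeless zero    = []
edgeless (suc n) = edgeless n ▷ ∅

¬Adj-edgeless : ∀ {n} (i j : Fin n) → ¬ Adj (edgeless n) i j
¬Adj-edgeless zero    zero    = id
¬Adj-edgeless zero    (suc j) = ∉⊥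
¬Adj-edgeless (suc i) zero    = ∉⊥
¬Adj-edgeless (suc i) (suc j) = ¬Adj-edgeless i j

Next : Rel (Fin k) 0ℓ
Next {k} i j = toℕ j ≡ suc (toℕ i) ⊎ (toℕ j ≡ 0 × suc (toℕ i) ≡ k)

Next? : Decidable₂ (Next {k})
Next? {k} i j = (toℕ j ≟ suc (toℕ i)) ⊎-dec ((toℕ j ≟ 0) ×-dec (suc (toℕ i) ≟ k))

-- The cycle on k vertices when k ≥ 3, the only case in use.
C : ∀ k → Graph k
C k = fromRel (λ i j → Next? i j ⊎-dec Next? j i)

Adj-C : 2 ≤ k → ∀ i j → Adj (C k) i j ⇔ (Next i j ⊎ Next j i)
Adj-C {k} 2≤k i j = mk⇔ (proj₂ ∘ to) (λ r → from (irrefl r , r))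
  where
  open Equivalence (Adj-fromRel (λ i j → Next? i j ⊎-dec Next? j i) swap i j)

  ¬loop : (v : Fin k) → ¬ Next v v
  ¬loop v (inj₁ v≡1+v)       = 1+n≢n (sym v≡1+v)
  ¬loop v (inj₂ (v≡0 , v+1≡k)) with subst (2 ≤_) (trans (sym v+1≡k) (cong suc v≡0)) 2≤k
  ... | s≤s ()

  irrefl : Next i j ⊎ Next j i → i ≢ j
  irrefl r refl = [ ¬loop i , ¬loop i ]′ r

record Subgraph (n : ℕ) : Set where
  constructor subgraph
  field
    verts : Subset n
    edges : Graph n

open Subgraph public

record _IsSubgraphOf_ (K : Subgraph n) (G : Graph n) : Set where
  field
    edge  : ∀ i j → Adj (edges K) i j → Adj G i j
    ends  : ∀ i j → Adj (edges K) i j → i ∈ verts K × j ∈ verts K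

record IsIsomorphism (H : Graph k) (K : Subgraph n) (f : Fin k → Fin n) : Set where
  field
    injective : ∀ i j → f i ≡ f j → i ≡ j
    image     : ∀ v → v ∈ verts K ⇔ (∃[ i ] f i ≡ v)
    adjacency : ∀ i j → Adj H i j ⇔ Adj (edges K) (f i) (f j)

record IsCopyOf (H : Graph k) (G : Graph n) (K : Subgraph n) : Set where
  field
    isSubgraph : K IsSubgraphOf G
    isomorphic : ∃[ f ] IsIsomorphism H K f

Contains : Graph n → Graph k → Set
Contains G H = ∃[ K ] IsCopyOf H G K

private
  _⇔-dec_ : {P Q : Set} → Dec P → Dec Q → Dec (P ⇔ Q)
  P? ⇔-dec Q? = map′ (uncurry mk⇔) (λ e → Equivalence.to e , Equivalence.from e)
                     ((P? →-dec Q?) ×-dec (Q? →-dec P?))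

  anyFunction? : {P : Pred (Fin k → Fin n) 0ℓ} →
                 (∀ {f g} → f ≗ g → P f → P g) → Decidable P → Dec (∃ P)
  anyFunction? {k = zero} resp P? =
    map′ (λ p → _ , p) (λ (f , p) → resp (λ ()) p) (P? Fun.[])
  anyFunction? {k = suc k} {P = P} resp P? =
    map′ (λ (x , f , p) → x Fun.∷ f , p)
         (λ (f , p) → f zero , f ∘ suc , resp (λ { zero → refl ; (suc i) → refl }) p)
         (any? λ x → anyFunction? {P = λ f → P (x Fun.∷ f)}
           (λ f≗g → resp (λ { zero → refl ; (suc i) → f≗g i }))
           (λ f → P? (x Fun.∷ f)))

isSubgraphOf? : (K : Subgraph n) (G : Graph n) → Dec (K IsSubgraphOf G)
isSubgraphOf? K G =
  map′ (λ (e , v) → record { edge = e ; ends = v }) (λ s → let open _IsSubgraphOf_ s in edge , ends)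
    ((all? λ i → all? λ j → Adj? (edges K) i j →-dec Adj? G i j) ×-dec
     (all? λ i → all? λ j → Adj? (edges K) i j →-dec ((i ∈? verts K) ×-dec (j ∈? verts K))))

isIsomorphism? : (H : Graph k) (K : Subgraph n) → Decidable (IsIsomorphism H K)
isIsomorphism? H K f =
  map′ (λ (a , b , c) → record { injective = a ; image = b ; adjacency = c })
       (λ s → let open IsIsomorphism s in injective , image , adjacency)
    ((all? λ i → all? λ j → (f i ≟ᶠ f j) →-dec (i ≟ᶠ j)) ×-dec
     (all? λ v → (v ∈? verts K) ⇔-dec (any? λ i → f i ≟ᶠ v)) ×-dec
     (all? λ i → all? λ j → Adj? H i j ⇔-dec Adj? (edges K) (f i) (f j)))

private
  isIsomorphism-resp : (H : Graph k) (K : Subgraph n) {f g : Fin k → Fin n} →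
                       f ≗ g → IsIsomorphism H K f → IsIsomorphism H K g
  isIsomorphism-resp H K {f} {g} f≗g iso = record
    { injective = λ i j e → injective i j (trans (f≗g i) (trans e (sym (f≗g j))))
    ; image     = λ v → mk⇔
        (λ v∈ → let (i , e) = Equivalence.to (image v) v∈ in i , trans (sym (f≗g i)) e)
        (λ (i , e) → Equivalence.from (image v) (i , trans (f≗g i) e))
    ; adjacency = λ i j → mk⇔
        (λ a → subst₂ (Adj (edges K)) (f≗g i) (f≗g j) (Equivalence.to (adjacency i j) a))
        (λ a → Equivalence.from (adjacency i j)
                 (subst₂ (Adj (edges K)) (sym (f≗g i)) (sym (f≗g j)) a))
    }
    where open IsIsomorphism iso

isCopyOf? : (H : Graph k) (G : Graph n) → Decidable (IsCopyOf H G)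
isCopyOf? H G K =
  map′ (λ (s , i) → record { isSubgraph = s ; isomorphic = i })
       (λ c → let open IsCopyOf c in isSubgraph , isomorphic)
    (isSubgraphOf? K G ×-dec anyFunction? (isIsomorphism-resp H K) (isIsomorphism? H K))

sides : List Side
sides = inside ∷ outside ∷ []

subsets : ∀ n → List (Subset n)
subsets zero    = [] ∷ []
subsets (suc n) = cartesianProductWith _∷_ sides (subsets n)

graphs : ∀ n → List (Graph n)
graphs zero    = [] ∷ []
graphs (suc n) = cartesianProductWith _▷_ (graphs n) (subsets n)

subgraphs : ∀ n → List (Subgraph n)
subgraphs n = cartesianProductWith subgraph (subsets n) (graphs n)

subsets-complete : (S : Subset n) → S List.∈ subsets n
subsets-complete []            = here refl
subsets-complete (inside ∷ S)  = ∈-cartesianProductWith⁺ _∷_ {xs = sides} (here refl) (subsets-complete S)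
subsets-complete (outside ∷ S) = ∈-cartesianProductWith⁺ _∷_ {xs = sides} (there (here refl)) (subsets-complete S)

graphs-complete : (G : Graph n) → G List.∈ graphs n
graphs-complete []      = here refl
graphs-complete (G ▷ N) = ∈-cartesianProductWith⁺ _▷_ (graphs-complete G) (subsets-complete N)

subgraphs-complete : (K : Subgraph n) → K List.∈ subgraphs n
subgraphs-complete (subgraph S G) =
  ∈-cartesianProductWith⁺ subgraph (subsets-complete S) (graphs-complete G)

subsets-unique : ∀ n → Unique (subsets n)
subsets-unique zero    = [] ∷ []
subsets-unique (suc n) =
  cartesianProductWith⁺ _∷_ ∷-injective (((λ ()) ∷ []) ∷ [] ∷ []) (subsets-unique n)

graphs-unique : ∀ n → Unique (graphs n)
graphs-unique zero    = [] ∷ []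
graphs-unique (suc n) =
  cartesianProductWith⁺ _▷_ (λ { refl → refl , refl }) (graphs-unique n) (subsets-unique n)

subgraphs-unique : ∀ n → Unique (subgraphs n)
subgraphs-unique n =
  cartesianProductWith⁺ subgraph (λ { refl → refl , refl }) (subsets-unique n) (graphs-unique n)

copies : Graph k → Graph n → ℕ
copies {n = n} H G = length (filter (isCopyOf? H G) (subgraphs n))

GraphFamily : Set₁
GraphFamily = ∀ k → Pred (Graph k) 0ℓ

Free : GraphFamily → Graph n → Set
Free 𝓕 G = ∀ k (F : Graph k) → 𝓕 k F → ¬ Contains G F

-- IsEx n H 𝓕 m says ex(n,H,𝓕) = m.  This is a relation and not a function of
-- n, H and 𝓕 because membership in 𝓕 need not be decidable; the value is
-- unique, and it exists in the double-negated sense as soon as some graph on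
-- n vertices is 𝓕-free (IsEx-unique, IsEx-exists).
record IsEx (n : ℕ) (H : Graph k) (𝓕 : GraphFamily) (m : ℕ) : Set where
  field
    attained : ∃[ G ] Free {n} 𝓕 G × copies H G ≡ m
    bound    : (G : Graph n) → Free 𝓕 G → copies H G ≤ m

IsEx-unique : {H : Graph k} {𝓕 : GraphFamily} {m m′ : ℕ} →
              IsEx n H 𝓕 m → IsEx n H 𝓕 m′ → m ≡ m′
IsEx-unique p q = ≤-antisym (below p q) (below q p)
  where
  below : {H : Graph k} {𝓕 : GraphFamily} {m m′ : ℕ} →
          IsEx n H 𝓕 m → IsEx n H 𝓕 m′ → m ≤ m′
  below p q with IsEx.attained p
  ... | G , free , refl = IsEx.bound q G free

IsEx-exists : (H : Graph k) (𝓕 : GraphFamily) → (∃[ G ] Free {n} 𝓕 G) →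
              ¬ ¬ (∃[ m ] IsEx n H 𝓕 m)
IsEx-exists {n = n} H 𝓕 (G₀ , free₀) ¬ex = go (graphs n) λ (G , free , max) →
  ¬ex (copies H G , record
    { attained = G , free , refl
    ; bound    = λ G′ → max G′ (graphs-complete G′) })
  where
  MaxOver : List (Graph n) → Set
  MaxOver Gs = ∃[ G ] Free {n} 𝓕 G × (∀ G′ → G′ List.∈ Gs → Free 𝓕 G′ → copies H G′ ≤ copies H G)

  go : ∀ Gs → ¬ ¬ MaxOver Gs
  go []       ¬max = ¬max (G₀ , free₀ , λ _ ())
  go (G ∷ Gs) ¬max = go Gs λ (M , freeM , max) →
    let ¬free : ¬ Free 𝓕 G
        ¬free free = [ (λ G≤M → ¬max (M , freeM , λ where
                          G′ (here refl) _ → G≤M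
                          G′ (there G′∈) → max G′ G′∈))
                     , (λ M≤G → ¬max (G , free , λ where
                          G′ (here refl) _ → ≤-refl
                          G′ (there G′∈) free′ → ≤-trans (max G′ G′∈ free′) M≤G))
                     ]′ (≤-total (copies H G) (copies H M))
    in ¬max (M , freeM , λ where
         G′ (here refl) free → contradiction free ¬free
         G′ (there G′∈) → max G′ G′∈)

data 𝓒 (A : Pred ℕ 0ℓ) : GraphFamily where
  cycle : ∀ {a} → A a → 𝓒 A a (C a)

edgeless-free : {A : Pred ℕ 0ℓ} → (∀ a → A a → 3 ≤ a) → Free (𝓒 A) (edgeless n)
edgeless-free 3≤A _ _ (cycle {a} a∈A) (K , copy) with 3≤A a a∈A
... | s≤s (s≤s (s≤s _)) =
  ¬Adj-edgeless (f zero) (f (suc zero))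
    (edge _ _ (Equivalence.to (adjacency zero (suc zero))
      (Equivalence.from (Adj-C (s≤s (s≤s z≤n)) zero (suc zero)) (inj₁ (inj₁ refl)))))
  where
  open IsCopyOf copy
  f = proj₁ isomorphic
  open _IsSubgraphOf_ isSubgraph
  open IsIsomorphism (proj₂ isomorphic)

evens : Pred ℕ 0ℓ → Pred ℕ 0ℓ
evens A = A ∩ (2 ∣_)

AtLeastTwo : Pred ℕ 0ℓ → Set
AtLeastTwo P = ∃[ a ] ∃[ b ] a ≢ b × P a × P b

-- R n m is read "the n-th term of the sequence is m".  The constants are 1/c
-- and d with c and d positive integers, which loses nothing against arbitrary
-- positive reals.
_IsΘ_ : (ℕ → ℕ → Set) → (ℕ → ℕ) → Set
R IsΘ g = ∃[ c ] ∃[ d ] ∃[ N ] c > 0 × d > 0 ×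
  (∀ n → N ≤ n → ∀ m → R n m → g n ≤ c * m × m ≤ d * g n)

{-# OPTIONS --safe #-}

-- Upper bounds.  Write a hexagon as u x v y w z.  In a C₂ₖ-free graph the edges
-- from N(v) to the other vertices form a degenerate graph, since a core would
-- close up to a C₂ₖ through v; so there are O(n) paths v x u for each v, and
-- hexagons in which u and w have boundedly many common neighbours number O(n³).
-- Call other pairs heavy.  Heavy pairs inside N(x) also form a degenerate graph,
-- because heavy edges can be subdivided greedily.  Orienting all these graphs with
-- bounded out-degree, the hexagons with only heavy pairs are determined, up to
-- boundedly many choices, by three of their vertices.
--
-- Without C₄ and C₂ₖ, k ≥ 4, the same scheme is applied to opposite vertices: a
-- pair is heavy if it is joined by many paths of length three.  For an edge x u
-- the opposite pairs (v , z) of hexagons u x v y w z with all three pairs heavy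
-- are degenerate; a core yields cycles of length 6j − 4, 6j − 2 and 6j for every
-- j ≥ 2.  Since two vertices have at most one common neighbour, this leaves O(n²)
-- hexagons.
--
-- Lower bounds.  n⁶: a balanced complete bipartite graph.  n³: K₃,ₘ, whose cycles
-- have length 4 or 6, or the point-line incidence graph of the affine plane over
-- ℤ/p, which is bipartite without C₄; a prime p of order √n is found by
-- Chebyshev's method.  n²: two vertices joined by many paths of length three, where
-- all cycles have length 6.

module Submission where

open import Data.Bool using (Bool; true; false; not)
open import Data.Bool.Properties using (not-involutive; not-¬) renaming (_≟_ to _≟ᵇ_)
open import Data.Empty using (⊥)
open import Data.Fin using (Fin; zero; suc; toℕ; fromℕ<)
open import Data.Fin.Base using (splitAt; _↑ˡ_)
open import Data.Fin.Properties
  using (any?; toℕ-injective; toℕ<n; toℕ-fromℕ<; splitAt-↑ˡ; splitAt⁻¹-↑ˡ; ↑ˡ-injective; +↔⊎;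
    *↔×; 2↔Bool; pigeonhole)
  renaming (_≟_ to _≟ᶠ_)
import Data.Fin.Subset as Subset
open import Data.Fin.Subset using (Subset)
open import Data.Fin.Subset.Properties using (⊆-antisym)
open import Data.List
  using (List; []; _∷_; _++_; length; filter; map; concatMap; allFin; lookup;
    cartesianProductWith)
import Data.List.Membership.Propositional as List
open import Data.List.Membership.Propositional.Properties
  using (∈-∃++; ∈-++⁺ˡ; ∈-++⁺ʳ; ∈-++⁻; ∈-map⁺; ∈-map⁻; ∈-filter⁺; ∈-filter⁻; ∈-concatMap⁺;
    ∈-cartesianProductWith⁺; ∈-allFin; ∈-lookup)
open import Data.List.Properties
  using (length-++; length-map; length-filter; length-tabulate; filter-notAll)
open import Data.List.Relation.Unary.All as All using (All; []; _∷_)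
open import Data.List.Relation.Unary.All.Properties using (All¬⇒¬Any)
open import Data.List.Relation.Unary.AllPairs using ([]; _∷_)
open import Data.List.Relation.Unary.Any as Any using (Any; here; there)
open import Data.List.Relation.Unary.Any.Properties using (lookup-index)
open import Data.List.Relation.Unary.Unique.Propositional using (Unique)
import Data.List.Relation.Unary.Unique.Propositional.Properties as Unique
open import Data.Nat
open import Data.Nat.Combinatorics
  using (nCk+nC[k+1]≡[n+1]C[k+1]; k>n⇒nCk≡0; nCn≡1; nCk≡nC[n∸k]; nCk≡n!/k![n-k]!; k![n∸k]!∣n!)
  renaming (_C_ to _choose_)
open import Data.Nat.DivMod
  using (_%_; _/_; _mod_; m%n<n; m<n⇒m%n≡m; n%n≡0; m≡m%n+[m/n]*n; %-distribˡ-+; [m+n]%n≡m%n;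
    m/n*n≡m)
open import Data.Nat.Divisibility
open import Data.Nat.Primality using (Prime; prime?; euclidsLemma; prime⇒nonTrivial; prime⇒nonZero)
open import Data.Nat.Primality.Factorisation using (factorise)
open import Data.Nat.Properties
open import Data.Nat.Solver using (module +-*-Solver)
open import Data.Product using (∃; ∃-syntax; _×_; _,_; proj₁; proj₂; uncurry)
open import Data.Product.Function.NonDependent.Propositional using (_×-↔_)
open import Data.Product.Properties using (≡-dec)
open import Data.Sum using (_⊎_; inj₁; inj₂; [_,_]′)
open import Data.Sum.Function.Propositional using (_⊎-↔_)
open import Data.Sum.Properties using (inj₁-injective; inj₂-injective)
open import Data.Unit using (⊤; tt)
open import Data.Vec using (tabulate)
open import Data.Vec.Properties using (lookup∘tabulate; lookup⇒[]=; []=⇒lookup)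
open import Defs
open import Function using (_∘_; id; case_of_)
open import Function.Bundles using (_⇔_; mk⇔; module Equivalence; _↔_; module Inverse)
open import Function.Construct.Composition using (_↔-∘_)
open import Function.Construct.Identity using (↔-id)
open import Level using (0ℓ)
open import Relation.Binary using (Rel; Symmetric; DecidableEquality) renaming (Decidable to Decidable₂)
open import Relation.Binary.PropositionalEquality
open import Relation.Nullary using (¬_; Dec; yes; no; does; contradiction)
open import Relation.Nullary.Decidable
  using (map′; _×-dec_; dec-true; ¬?; decidable-stable; toWitnessFalse)
open import Relation.Unary
  using (Pred; _∈_; _∉_; _≐_; ｛_｝; Empty; Satisfiable)
  renaming (Decidable to Decidable₁)

-- An edge count would not control the hexagons with only heavy pairs: it limits how many heavy
-- pairs a neighbourhood contains, but not how many of them share a given vertex. An orientation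
-- with bounded out-degree does limit the far end of every arc, at the price that the direction of
-- an arc cannot be chosen; the case analyses look for arcs that can be followed forwards. Without
-- C₄ two vertices have at most one common neighbour, so heaviness at distance two says nothing and
-- opposite vertices take over. Bridging a heavy pair then adds three vertices and changes the side
-- of the core, so the lengths reached are fixed modulo 6 by the initial segment; three initial
-- segments together reach every even length from 8 on. Hexagons of the point-line graph are
-- triangles of the plane: order p² vertices carry order p⁶ of them. Since Θ ignores constants, the
-- prime may be sought in an interval whose ends have ratio 16; powers of 4 make the square root in
-- Chebyshev's argument exact.

private
  variable
    X Y : Set
    A : Pred ℕ 0ℓ
    β γ k n p : ℕ

-- Lists as counting bounds

-- Pigeonhole along a relation, so that the partner of `x` may depend on the proof that `x` is in
-- the list. The partner of the head is removed from `ys`; by injectivity no later element needs it.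
length-≤ : {T : X → Y → Set} → (∀ {x x′ y} → T x y → T x′ y → x ≡ x′) →
           {xs : List X} {ys : List Y} → Unique xs →
           (∀ {x} → x List.∈ xs → ∃[ y ] y List.∈ ys × T x y) → length xs ≤ length ys
length-≤ inj {[]}     _             _ = z≤n
length-≤ {T = T} inj {x ∷ xs} {ys} (x∉xs ∷ xs!) f with f (here refl)
... | y , y∈ys , Txy with ∈-∃++ y∈ys
... | ls , rs , refl = begin
  suc (length xs)               ≤⟨ s≤s (length-≤ inj xs! f′) ⟩
  suc (length (ls ++ rs))       ≡⟨ cong suc (length-++ ls) ⟩
  suc (length ls + length rs)   ≡⟨ +-suc (length ls) (length rs) ⟨
  length ls + suc (length rs)   ≡⟨ length-++ ls ⟨
  length (ls ++ y ∷ rs)         ∎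
  where
  open ≤-Reasoning
  f′ : ∀ {x′} → x′ List.∈ xs → ∃[ y′ ] y′ List.∈ ls ++ rs × T x′ y′
  f′ x′∈xs with f (there x′∈xs)
  ... | y′ , y′∈ , Tx′y′ with ∈-++⁻ ls y′∈
  ... | inj₁ y′∈ls         = y′ , ∈-++⁺ˡ y′∈ls , Tx′y′
  ... | inj₂ (here refl)   = contradiction (inj Txy Tx′y′) (All.lookup x∉xs x′∈xs)
  ... | inj₂ (there y′∈rs) = y′ , ∈-++⁺ʳ ls y′∈rs , Tx′y′

Unique-⊆⇒length-≤ : {xs ys : List X} → Unique xs → (∀ {x} → x List.∈ xs → x List.∈ ys) →
                    length xs ≤ length ys
Unique-⊆⇒length-≤ xs! xs⊆ys =
  length-≤ {T = _≡_} (λ { refl refl → refl }) xs! (λ x∈ → _ , xs⊆ys x∈ , refl)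

pick-∉ : DecidableEquality X → {xs : List X} (S : List X) → Unique xs → length S < length xs →
         ∃[ x ] x List.∈ xs × ¬ (x List.∈ S)
pick-∉ _≟′_ {xs} S xs! S<xs with Any.any? (λ x → ¬? (Any.any? (x ≟′_) S)) xs
... | yes some = let (x , x∈ , x∉S) = List.find some in x , x∈ , x∉S
... | no  none = contradiction (Unique-⊆⇒length-≤ xs! ⊆S) (<⇒≱ S<xs)
  where
  ⊆S : ∀ {x} → x List.∈ xs → x List.∈ S
  ⊆S {x} x∈ = decidable-stable (Any.any? (x ≟′_) S) λ x∉ → none (List.lose x∈ x∉)

infix 4 _≲_

-- A covering list may repeat elements and contain strangers to `P`. Hence upper bounds multiply and
-- add without any injectivity, and `P` need not be decidable.
record _≲_ {X : Set} (P : Pred X 0ℓ) (γ : ℕ) : Set where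
  constructor cover
  field
    list   : List X
    bound  : length list ≤ γ
    covers : ∀ {x} → P x → x List.∈ list

≲-list : (xs : List X) → (λ x → x List.∈ xs) ≲ length xs
≲-list xs = cover xs ≤-refl id

≲-allFin : (λ (_ : Fin n) → ⊤) ≲ n
≲-allFin {n} = cover (allFin n) (≤-reflexive (length-tabulate {n = n} id)) λ _ → ∈-allFin _

≲-empty : {P : Pred X 0ℓ} → (∀ {x} → ¬ P x) → P ≲ γ
≲-empty ¬P = cover [] z≤n λ p → contradiction p ¬P

≲-mono : {P : Pred X 0ℓ} → β ≤ γ → P ≲ β → P ≲ γ
≲-mono β≤γ (cover xs l c) = cover xs (≤-trans l β≤γ) c

≲-map : {P : Pred X 0ℓ} {Q : Pred Y 0ℓ} (f : X → Y) →
        (∀ {y} → Q y → ∃[ x ] P x × f x ≡ y) → P ≲ β → Q ≲ β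
≲-map f g (cover xs l c) =
  cover (map f xs) (≤-trans (≤-reflexive (length-map f xs)) l)
  λ q → let (x , p , e) = g q in subst (List._∈ map f xs) e (∈-map⁺ f (c p))

≲-⊆ : {P Q : Pred X 0ℓ} → (∀ {x} → Q x → P x) → P ≲ β → Q ≲ β
≲-⊆ Q⊆P = ≲-map id λ q → _ , Q⊆P q , refl

≲-∪ : {P Q : Pred X 0ℓ} → P ≲ β → Q ≲ γ → (λ x → P x ⊎ Q x) ≲ β + γ
≲-∪ (cover xs l c) (cover ys l′ c′) =
  cover (xs ++ ys) (≤-trans (≤-reflexive (length-++ xs)) (+-mono-≤ l l′))
  [ ∈-++⁺ˡ ∘ c , ∈-++⁺ʳ xs ∘ c′ ]′

≲-when : {D : Set} {P : Pred X 0ℓ} → Dec D → (D → P ≲ β) → (λ x → D × P x) ≲ β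
≲-when (yes d) f = ≲-⊆ proj₂ (f d)
≲-when (no ¬d) f = ≲-empty (¬d ∘ proj₁)

infixl 5 _⟫_

-- The bound `γ` has to hold for every `x`, also outside `P`. A condition on which it depends is
-- therefore put into `Q` and discharged by `≲-when`.
_⟫_ : {P : Pred X 0ℓ} {Q : X → Pred Y 0ℓ} →
      P ≲ β → (∀ x → Q x ≲ γ) → (λ (x , y) → P x × Q x y) ≲ β * γ
_⟫_ {X = X} {Y = Y} {β = β} {γ = γ} {Q = Q} (cover xs l c) q =
  cover (concatMap ys xs) (≤-trans (bound xs) (*-monoˡ-≤ γ l))
  λ {(x , y)} (p , r) → ∈-concatMap⁺ ys (Any.map (λ { refl → ∈-map⁺ (x ,_) (_≲_.covers (q x) r) }) (c p))
  where
  ys : X → List (X × Y)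
  ys x = map (x ,_) (_≲_.list (q x))
  open ≤-Reasoning
  bound : ∀ xs → length (concatMap ys xs) ≤ length xs * γ
  bound []       = z≤n
  bound (x ∷ xs) = begin
    length (ys x ++ concatMap ys xs)         ≡⟨ length-++ (ys x) ⟩
    length (ys x) + length (concatMap ys xs)
      ≤⟨ +-mono-≤ (≤-trans (≤-reflexive (length-map _ (_≲_.list (q x)))) (_≲_.bound (q x))) (bound xs) ⟩
    γ + length xs * γ                        ∎

≲⇒length-≤ : {P : Pred X 0ℓ} {xs : List X} → Unique xs → (∀ {x} → x List.∈ xs → P x) →
             P ≲ γ → length xs ≤ γ
≲⇒length-≤ xs! all-P (cover ys l c) = ≤-trans (Unique-⊆⇒length-≤ xs! (c ∘ all-P)) l

-- Graphs, paths and hexagons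

Adj-sym : (G : Graph n) → Symmetric (Adj G)
Adj-sym (G ▷ N) {zero}  {suc j} a = a
Adj-sym (G ▷ N) {suc i} {zero}  a = a
Adj-sym (G ▷ N) {suc i} {suc j} a = Adj-sym G a

Adj-irrefl : (G : Graph n) {i j : Fin n} → Adj G i j → i ≢ j
Adj-irrefl (G ▷ N) {suc i} {suc j} a refl = Adj-irrefl G a refl

Subset-ext : {S T : Subset n} → (∀ i → i Subset.∈ S ⇔ i Subset.∈ T) → S ≡ T
Subset-ext e = ⊆-antisym (Equivalence.to (e _)) (Equivalence.from (e _))

Graph-ext : {G G′ : Graph n} → (∀ i j → Adj G i j ⇔ Adj G′ i j) → G ≡ G′
Graph-ext {G = []}    {[]}      e = refl
Graph-ext {G = G ▷ N} {G′ ▷ N′} e =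
  cong₂ _▷_ (Graph-ext λ i j → e (suc i) (suc j)) (Subset-ext λ j → e zero (suc j))

∈-tabulate-does : {P : Pred (Fin n) 0ℓ} (P? : Decidable₁ P) (j : Fin n) →
                  j Subset.∈ tabulate (does ∘ P?) ⇔ P j
∈-tabulate-does {P = P} P? j = mk⇔ to from
  where
  to : j Subset.∈ tabulate (does ∘ P?) → P j
  to j∈ with P? j | trans (sym (lookup∘tabulate (does ∘ P?) j)) ([]=⇒lookup j∈)
  ... | yes p | _ = p
  from : P j → j Subset.∈ tabulate (does ∘ P?)
  from p = lookup⇒[]= j _ (trans (lookup∘tabulate (does ∘ P?) j) (dec-true (P? j) p))

module _ {k n : ℕ} {H : Graph k} {G : Graph n} (f : Fin k → Fin n)
         (f-inj : ∀ i j → f i ≡ f j → i ≡ j)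
         (f-hom : ∀ i j → Adj H i j → Adj G (f i) (f j)) where

  private
    vert? : (v : Fin n) → Dec (∃[ i ] f i ≡ v)
    vert? v = any? λ i → f i ≟ᶠ v

    ImageAdj : Rel (Fin n) 0ℓ
    ImageAdj v w = ∃[ i ] ∃[ j ] f i ≡ v × f j ≡ w × Adj H i j

    imageAdj? : Decidable₂ ImageAdj
    imageAdj? v w = any? λ i → any? λ j → (f i ≟ᶠ v) ×-dec (f j ≟ᶠ w) ×-dec Adj? H i j

    imageAdj-sym : Symmetric ImageAdj
    imageAdj-sym (i , j , p , q , r) = j , i , q , p , Adj-sym H r

    E⇔ = Adj-fromRel imageAdj? imageAdj-sym

    imageSubgraph : Subgraph n
    imageSubgraph = subgraph (tabulate (does ∘ vert?)) (fromRel imageAdj?)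

    adj : ∀ i j → Adj H i j → Adj (edges imageSubgraph) (f i) (f j)
    adj i j r = Equivalence.from (E⇔ _ _) ((λ e → Adj-irrefl H r (f-inj i j e)) , i , j , refl , refl , r)

    adj⁻ : ∀ {i j} → ImageAdj (f i) (f j) → Adj H i j
    adj⁻ {i} {j} (i′ , j′ , p , q , r) = subst₂ (Adj H) (f-inj i′ i p) (f-inj j′ j q) r

  -- The subgraph receives only the image edges, so `adjacency` is an equivalence even if `G` has
  -- further edges between these vertices. Its vertices are reported too, because hexagons will be
  -- labelled by them.
  image-copy : ∃[ K ] IsCopyOf H G K × (∀ i → f i Subset.∈ verts K)
  image-copy = imageSubgraph , record
    { isSubgraph = record
        { edge = λ v w e → case proj₂ (Equivalence.to (E⇔ v w) e) of λ
            { (i , j , refl , refl , r) → f-hom i j r }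
        ; ends = λ v w e → case proj₂ (Equivalence.to (E⇔ v w) e) of λ
            { (i , j , p , q , r) → Equivalence.from (∈-tabulate-does vert? v) (i , p)
                                  , Equivalence.from (∈-tabulate-does vert? w) (j , q) } }
    ; isomorphic = f , record
        { injective = f-inj
        ; image     = ∈-tabulate-does vert?
        ; adjacency = λ i j → mk⇔ (adj i j) (λ e → adj⁻ (proj₂ (Equivalence.to (E⇔ _ _) e))) } }
    , λ i → Equivalence.from (∈-tabulate-does vert? (f i)) (i , refl)

-- `ends` confines the edges of `K` to its vertices, all of which are values of `f`; so nothing of
-- `K` escapes `f`. This makes a labelled hexagon determine its copy.
isomorphism-determines : {H : Graph k} {G : Graph n} {K K′ : Subgraph n} {f g : Fin k → Fin n} →
  K IsSubgraphOf G → K′ IsSubgraphOf G → IsIsomorphism H K f → IsIsomorphism H K′ g →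
  (∀ i → f i ≡ g i) → K ≡ K′
isomorphism-determines {n = n} {H = H} {G = G} s s′ φ ψ f≗g = cong₂ subgraph
  (Subset-ext λ v → mk⇔ (verts-⊆ φ ψ f≗g v) (verts-⊆ ψ φ (sym ∘ f≗g) v))
  (Graph-ext λ v w → mk⇔ (edges-⊆ s φ ψ f≗g v w) (edges-⊆ s′ ψ φ (sym ∘ f≗g) v w))
  where
  verts-⊆ : ∀ {K K′ f g} → IsIsomorphism H K f → IsIsomorphism H K′ g → (∀ i → f i ≡ g i) →
            ∀ v → v Subset.∈ verts K → v Subset.∈ verts K′
  verts-⊆ φ ψ f≗g v v∈ with Equivalence.to (IsIsomorphism.image φ v) v∈
  ... | i , refl = Equivalence.from (IsIsomorphism.image ψ v) (i , sym (f≗g i))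

  edges-⊆ : ∀ {K K′ f g} → K IsSubgraphOf G → IsIsomorphism H K f → IsIsomorphism H K′ g →
            (∀ i → f i ≡ g i) → ∀ v w → Adj (edges K) v w → Adj (edges K′) v w
  edges-⊆ {K′ = K′} s φ ψ f≗g v w e with _IsSubgraphOf_.ends s v w e
  ... | v∈ , w∈ with Equivalence.to (IsIsomorphism.image φ v) v∈ | Equivalence.to (IsIsomorphism.image φ w) w∈
  ... | i , refl | j , refl =
    subst₂ (Adj (edges K′)) (sym (f≗g i)) (sym (f≗g j))
      (Equivalence.to (IsIsomorphism.adjacency ψ i j) (Equivalence.from (IsIsomorphism.adjacency φ i j) e))

-- The list is ordered from the latest vertex back to `ℓ`: a greedy walk grows at its head, and the
-- list itself is the set to avoid.
data Path (G : Graph n) (ℓ : Fin n) : Fin n → List (Fin n) → Set where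
  start  : Path G ℓ ℓ (ℓ ∷ [])
  extend : ∀ {h h′ p} → Path G ℓ h p → Adj G h h′ → ¬ (h′ List.∈ p) → Path G ℓ h′ (h′ ∷ p)

module _ {G : Graph n} {ℓ : Fin n} where

  private
    lookup-head : ∀ {h p} → Path G ℓ h p → ∀ i → toℕ i ≡ 0 → lookup p i ≡ h
    lookup-head start          zero _ = refl
    lookup-head (extend _ _ _) zero _ = refl

    lookup-last : ∀ {h p} → Path G ℓ h p → ∀ i → suc (toℕ i) ≡ length p → lookup p i ≡ ℓ
    lookup-last start          zero    _ = refl
    lookup-last (extend start _ _) zero ()
    lookup-last (extend (extend _ _ _) _ _) zero ()
    lookup-last (extend P _ _) (suc i) e = lookup-last P i (suc-injective e)

    lookup-adj : ∀ {h p} → Path G ℓ h p → ∀ i j → toℕ j ≡ suc (toℕ i) → Adj G (lookup p i) (lookup p j)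
    lookup-adj start (zero) (suc ()) e
    lookup-adj (extend P a _) zero (suc j) e =
      subst (Adj G _) (sym (lookup-head P j (suc-injective e))) (Adj-sym G a)
    lookup-adj (extend P a _) (suc i) (suc j) e = lookup-adj P i j (suc-injective e)

    lookup-inj : ∀ {h p} → Path G ℓ h p → ∀ i j → lookup p i ≡ lookup p j → i ≡ j
    lookup-inj start zero zero e = refl
    lookup-inj (extend P a ∉p) zero    zero    e = refl
    lookup-inj {p = _ ∷ p} (extend P a ∉p) zero    (suc j) e = contradiction (subst (List._∈ p) (sym e) (∈-lookup {xs = p} j)) ∉p
    lookup-inj {p = _ ∷ p} (extend P a ∉p) (suc i) zero    e = contradiction (subst (List._∈ p) e (∈-lookup {xs = p} i)) ∉p
    lookup-inj (extend P a ∉p) (suc i) (suc j) e = cong suc (lookup-inj P i j e)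

  closed-path⇒copy : ∀ {h p} → Path G ℓ h p → Adj G h ℓ → length p ≡ k → 2 ≤ k →
                     ∃[ K ] IsCopyOf (C k) G K × (∀ {v} → v List.∈ p → v Subset.∈ verts K)
  closed-path⇒copy {k = k} {p = p} P closing refl 2≤k =
    let (K , copy , ∈K) = image-copy (lookup p) (lookup-inj P) hom
    in K , copy , λ v∈p → subst (Subset._∈ verts K) (sym (lookup-index v∈p)) (∈K (Any.index v∈p))
    where
    next : ∀ i j → Next i j → Adj G (lookup p i) (lookup p j)
    next i j (inj₁ e)       = lookup-adj P i j e
    -- Position 0 holds the head and the last position holds `ℓ`, so the wrap-around pair is the
    -- closing edge.
    next i j (inj₂ (e , l)) = subst₂ (Adj G) (sym (lookup-last P i l)) (sym (lookup-head P j e)) (Adj-sym G closing)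

    hom : ∀ i j → Adj (C k) i j → Adj G (lookup p i) (lookup p j)
    hom i j r = [ next i j , Adj-sym G ∘ next j i ]′ (Equivalence.to (Adj-C 2≤k i j) r)

  closed-path⇒cycle : ∀ {h p} → Path G ℓ h p → Adj G h ℓ → length p ≡ k → 2 ≤ k → Contains G (C k)
  closed-path⇒cycle P closing e 2≤k = let (K , copy , _) = closed-path⇒copy P closing e 2≤k in K , copy

-- The vertices of the closed hexagon u x v y w z, in cyclic order.
Hexagon : ℕ → Set
Hexagon n = Fin n × Fin n × Fin n × Fin n × Fin n × Fin n

-- The nine inequalities concern the non-consecutive pairs; consecutive vertices differ because they
-- are adjacent.
record IsHexagon (G : Graph n) (t : Hexagon n) : Set where
  constructor hexagon
  u = proj₁ t
  x = proj₁ (proj₂ t)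
  v = proj₁ (proj₂ (proj₂ t))
  y = proj₁ (proj₂ (proj₂ (proj₂ t)))
  w = proj₁ (proj₂ (proj₂ (proj₂ (proj₂ t))))
  z = proj₂ (proj₂ (proj₂ (proj₂ (proj₂ t))))
  field
    ux : Adj G u x
    xv : Adj G x v
    vy : Adj G v y
    yw : Adj G y w
    wz : Adj G w z
    zu : Adj G z u
    u≢v : u ≢ v
    v≢w : v ≢ w
    w≢u : w ≢ u
    x≢y : x ≢ y
    y≢z : y ≢ z
    z≢x : z ≢ x
    u≢y : u ≢ y
    x≢w : x ≢ w
    v≢z : v ≢ z

rotate : Hexagon n → Hexagon n
rotate (u , x , v , y , w , z) = x , v , y , w , z , u

reflect : Hexagon n → Hexagon n
reflect (u , x , v , y , w , z) = w , y , v , x , u , z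

module _ {G : Graph n} where

  rotate-isHexagon : ∀ {t} → IsHexagon G t → IsHexagon G (rotate t)
  rotate-isHexagon h = hexagon xv vy yw wz zu ux x≢y y≢z z≢x v≢w w≢u u≢v x≢w v≢z (≢-sym u≢y)
    where open IsHexagon h

  reflect-isHexagon : ∀ {t} → IsHexagon G t → IsHexagon G (reflect t)
  reflect-isHexagon h =
    hexagon (Adj-sym G yw) (Adj-sym G vy) (Adj-sym G xv) (Adj-sym G ux) (Adj-sym G zu) (Adj-sym G wz)
            (≢-sym v≢w) (≢-sym u≢v) (≢-sym w≢u) (≢-sym x≢y) (≢-sym z≢x) (≢-sym y≢z)
            (≢-sym x≢w) (≢-sym u≢y) v≢z
    where open IsHexagon h

Within : Pred (Fin n) 0ℓ → Pred (Hexagon n) 0ℓ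
Within P (u , x , v , y , w , z) = P u × P x × P v × P y × P w × P z

hexagons-within : ∀ {b} {P : Pred (Fin n) 0ℓ} → P ≲ b → Within P ≲ b * b * b * b * b * b
hexagons-within P≲ = ≲-map (λ (((((u , x) , v) , y) , w) , z) → u , x , v , y , w , z)
  (λ (pu , px , pv , py , pw , pz) → _ , (((((pu , px) , pv) , py) , pw) , pz) , refl)
  (P≲ ⟫ (λ _ → P≲) ⟫ (λ _ → P≲) ⟫ (λ _ → P≲) ⟫ (λ _ → P≲) ⟫ (λ _ → P≲))

pattern 0F = zero
pattern 1F = suc zero
pattern 2F = suc (suc zero)
pattern 3F = suc (suc (suc zero))
pattern 4F = suc (suc (suc (suc zero)))
pattern 5F = suc (suc (suc (suc (suc zero))))

toHexagon : (Fin 6 → Fin n) → Hexagon n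
toHexagon f = f 0F , f 1F , f 2F , f 3F , f 4F , f 5F

fromHexagon : Hexagon n → Fin 6 → Fin n
fromHexagon (u , x , v , y , w , z) = λ where
  0F → u
  1F → x
  2F → v
  3F → y
  4F → w
  5F → z

fromHexagon-cong : {f g : Fin 6 → Fin n} → toHexagon f ≡ toHexagon g → ∀ i → f i ≡ g i
fromHexagon-cong {f = f} {g} e i = trans (η f i) (trans (cong (λ t → fromHexagon t i) e) (sym (η g i)))
  where
  η : ∀ f i → f i ≡ fromHexagon (toHexagon f) i
  η f 0F = refl
  η f 1F = refl
  η f 2F = refl
  η f 3F = refl
  η f 4F = refl
  η f 5F = refl

-- Each of the six places of a hexagon is taken by one of the six vertices of the copy.
labellings : ℕ
labellings = 6 * 6 * 6 * 6 * 6 * 6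

module _ {k : ℕ} (H : Graph k) (G : Graph n) where

  copyList : List (Subgraph n)
  copyList = filter (isCopyOf? H G) (subgraphs n)

  copyList-unique : Unique copyList
  copyList-unique = Unique.filter⁺ (isCopyOf? H G) (subgraphs-unique n)

  copyList-sound : ∀ {K} → K List.∈ copyList → IsCopyOf H G K
  copyList-sound K∈ = proj₂ (∈-filter⁻ (isCopyOf? H G) {xs = subgraphs n} K∈)

  copyList-complete : ∀ {K} → IsCopyOf H G K → K List.∈ copyList
  copyList-complete {K} c = ∈-filter⁺ (isCopyOf? H G) (subgraphs-complete K) c

  -- Carrying `IsCopyOf` makes the bound by `k` valid for every `K`, as `_⟫_` demands.
  VertexOfCopy : Subgraph n → Pred (Fin n) 0ℓ
  VertexOfCopy K p = IsCopyOf H G K × p Subset.∈ verts K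

  vertexOfCopy-≲ : ∀ K → VertexOfCopy K ≲ k
  vertexOfCopy-≲ K = ≲-when (isCopyOf? H G K) λ c →
    let open IsIsomorphism (proj₂ (IsCopyOf.isomorphic c)) in
    ≲-map (proj₁ (IsCopyOf.isomorphic c)) (λ p∈ → let (i , e) = Equivalence.to (image _) p∈ in i , tt , e) ≲-allFin

  Labelled : Pred (Subgraph n × Hexagon n) 0ℓ
  Labelled (K , t) = K List.∈ copyList × Within (VertexOfCopy K) t

  labelled-≲ : Labelled ≲ copies H G * (k * k * k * k * k * k)
  labelled-≲ = ≲-list copyList ⟫ λ K → hexagons-within (vertexOfCopy-≲ K)

module _ {G : Graph n} where

  private
    Adj-C6 : ∀ i j → Adj (C 6) i j ⇔ (Next i j ⊎ Next j i)
    Adj-C6 = Adj-C (s≤s (s≤s z≤n))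

  copy⇒hexagon : ∀ {K} (c : IsCopyOf (C 6) G K) → IsHexagon G (toHexagon (proj₁ (IsCopyOf.isomorphic c)))
  copy⇒hexagon c = hexagon
    (adj 0F 1F (inj₁ refl)) (adj 1F 2F (inj₁ refl)) (adj 2F 3F (inj₁ refl))
    (adj 3F 4F (inj₁ refl)) (adj 4F 5F (inj₁ refl)) (adj 5F 0F (inj₂ (refl , refl)))
    (≢f 0F 2F λ ()) (≢f 2F 4F λ ()) (≢f 4F 0F λ ()) (≢f 1F 3F λ ()) (≢f 3F 5F λ ()) (≢f 5F 1F λ ())
    (≢f 0F 3F λ ()) (≢f 1F 4F λ ()) (≢f 2F 5F λ ())
    where
    open IsCopyOf c
    open _IsSubgraphOf_ isSubgraph
    f = proj₁ isomorphic
    open IsIsomorphism (proj₂ isomorphic)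
    adj : ∀ i j → Next i j → Adj G (f i) (f j)
    adj i j r = edge _ _ (Equivalence.to (adjacency i j) (Equivalence.from (Adj-C6 i j) (inj₁ r)))
    ≢f : ∀ i j → i ≢ j → f i ≢ f j
    ≢f i j i≢j = i≢j ∘ injective i j

  hexagon-vertices : Hexagon n → List (Fin n)
  hexagon-vertices (u , x , v , y , w , z) = z ∷ w ∷ y ∷ v ∷ x ∷ u ∷ []

  hexagon⇒copy : ∀ {t} → IsHexagon G t →
                 ∃[ K ] IsCopyOf (C 6) G K × (∀ {p} → p List.∈ hexagon-vertices t → p Subset.∈ verts K)
  hexagon⇒copy h = closed-path⇒copy path zu refl (s≤s (s≤s z≤n))
    where
    open IsHexagon h
    path : Path G u z (z ∷ w ∷ y ∷ v ∷ x ∷ u ∷ [])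
    path = extend (extend (extend (extend (extend start
      ux (All¬⇒¬Any (≢-sym (Adj-irrefl G ux) ∷ [])))
      xv (All¬⇒¬Any (≢-sym (Adj-irrefl G xv) ∷ ≢-sym u≢v ∷ [])))
      vy (All¬⇒¬Any (≢-sym (Adj-irrefl G vy) ∷ ≢-sym x≢y ∷ ≢-sym u≢y ∷ [])))
      yw (All¬⇒¬Any (≢-sym (Adj-irrefl G yw) ∷ ≢-sym v≢w ∷ ≢-sym x≢w ∷ w≢u ∷ [])))
      wz (All¬⇒¬Any (≢-sym (Adj-irrefl G wz) ∷ ≢-sym y≢z ∷ ≢-sym v≢z ∷ z≢x ∷ Adj-irrefl G zu ∷ []))

  -- Each copy is sent to the hexagon of its own isomorphism, from which it can be recovered.
  hexagons-≲⇒copies-≤ : ∀ {b} → IsHexagon G ≲ b → copies (C 6) G ≤ b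
  hexagons-≲⇒copies-≤ (cover ts l covers) = ≤-trans (length-≤ {T = Along} unique (copyList-unique (C 6) G) along) l
    where
    Along : Subgraph n → Hexagon n → Set
    Along K t = ∃[ c ] toHexagon (proj₁ (IsCopyOf.isomorphic {H = C 6} {G} {K} c)) ≡ t

    unique : ∀ {K K′ t} → Along K t → Along K′ t → K ≡ K′
    unique (c , e) (c′ , e′) = isomorphism-determines
      (IsCopyOf.isSubgraph c) (IsCopyOf.isSubgraph c′)
      (proj₂ (IsCopyOf.isomorphic c)) (proj₂ (IsCopyOf.isomorphic c′))
      (fromHexagon-cong (trans e (sym e′)))

    along : ∀ {K} → K List.∈ copyList (C 6) G → ∃[ t ] t List.∈ ts × Along K t
    along K∈ = let c = copyList-sound (C 6) G K∈ in _ , covers (copy⇒hexagon c) , c , refl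

  -- A hexagon spans a copy and is a sequence of six vertices of that copy. The factor is crude, but
  -- constant.
  hexagons-≲-copies : IsHexagon G ≲ copies (C 6) G * labellings
  hexagons-≲-copies = ≲-map proj₂ labelling (labelled-≲ (C 6) G)
    where
    labelling : ∀ {t} → IsHexagon G t → ∃[ s ] Labelled (C 6) G s × proj₂ s ≡ t
    labelling {t} h =
      let (K , c , ∈K) = hexagon⇒copy h in
      (K , t) , (copyList-complete (C 6) G c ,
      (c , ∈K (there (there (there (there (there (here refl))))))) ,
      (c , ∈K (there (there (there (there (here refl)))))) ,
      (c , ∈K (there (there (there (here refl))))) ,
      (c , ∈K (there (there (here refl)))) ,
      (c , ∈K (there (here refl))) ,
      (c , ∈K (here refl))) , refl

-- Degeneracy

-- Peeling off vertices of small degree either uncovers a core, in which greedy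
-- walks never get stuck, or orients R with out-degrees at most K.
module Degeneracy {n : ℕ} {R : Rel (Fin n) 0ℓ} (R? : Decidable₂ R) (K : ℕ) where

  -- Left and right arguments of `R` are kept apart, as in the bipartite double cover: `R` need not
  -- be symmetric, and a vertex can be peeled on one side while it stays on the other.
  Sides : Set
  Sides = Bool → List (Fin n)

  -- The relation R as seen from its left (true) and right (false) argument.
  From : Bool → Rel (Fin n) 0ℓ
  From true  a b = R a b
  From false a b = R b a

  From? : ∀ s → Decidable₂ (From s)
  From? true  a b = R? a b
  From? false a b = R? b a

  record Core : Set where
    field
      side   : Sides
      unique : ∀ s → Unique (side s)
      root   : Fin n
      root∈  : root List.∈ side true
      degree : ∀ s {a} → a List.∈ side s → K ≤ length (filter (From? s a) (side (not s)))

    step : ∀ s {a} → a List.∈ side s → (S : List (Fin n)) → length S < K →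
           ∃[ b ] b List.∈ side (not s) × From s a b × ¬ (b List.∈ S)
    step s {a} a∈ S S<K =
      let (b , b∈ , b∉S) = pick-∉ _≟ᶠ_ S (Unique.filter⁺ (From? s a) (unique (not s)))
                             (<-≤-trans S<K (degree s a∈))
          (b∈side , ab) = ∈-filter⁻ (From? s a) {xs = side (not s)} b∈
      in b , b∈side , ab , b∉S

  Targets : Set
  Targets = Bool → Fin n → List (Fin n)

  OrientedOn : Sides → Set
  OrientedOn side = ∃ λ (out : Targets) → (∀ s a → length (out s a) ≤ K) ×
    (∀ {a b} → a List.∈ side true → b List.∈ side false → R a b →
      b List.∈ out true a ⊎ a List.∈ out false b)

  private
    LowDegree : Sides → Bool → Pred (Fin n) 0ℓ
    LowDegree side s a = ¬ (K ≤ length (filter (From? s a) (side (not s))))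

    lowDegree? : ∀ side s → Decidable₁ (LowDegree side s)
    lowDegree? side s a = ¬? (K ≤? length (filter (From? s a) (side (not s))))

    empty? : (xs : List (Fin n)) → xs ≡ [] ⊎ ∃[ x ] x List.∈ xs
    empty? []      = inj₁ refl
    empty? (x ∷ _) = inj₂ (x , here refl)

    length≡0⇒∉ : {xs : List (Fin n)} → length xs ≡ 0 → ∀ {x} → ¬ (x List.∈ xs)
    length≡0⇒∉ {[]} _ ()

    module Peel (side : Sides) (s : Bool) (a : Fin n) where

      peeled? : ∀ t b → Dec (t ≡ s × b ≡ a)
      peeled? t b = (t ≟ᵇ s) ×-dec (b ≟ᶠ a)

      rest : Sides
      rest t = filter (λ b → ¬? (peeled? t b)) (side t)

      rest-shorter : a List.∈ side s →
        length (rest true) + length (rest false) < length (side true) + length (side false)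
      rest-shorter a∈ = by-side s (filter-notAll (λ b → ¬? (peeled? s b)) (side s)
                                    (Any.map (λ { refl ¬peeled → ¬peeled (refl , refl) }) a∈))
        where
        by-side : ∀ t → length (rest t) < length (side t) →
          length (rest true) + length (rest false) < length (side true) + length (side false)
        by-side true  l = +-mono-<-≤ l (length-filter _ (side false))
        by-side false l = +-mono-≤-< (length-filter _ (side true)) l

      -- All pairs of the peeled vertex are directed away from it. They number fewer than `K` when
      -- it is removed, and its list is never changed by a vertex peeled earlier.
      extend-orientation : LowDegree side s a → OrientedOn rest → OrientedOn side
      extend-orientation low (out , short , oriented) = out′ , short′ , oriented′
        where
        neighbours = filter (From? s a) (side (not s))
        out′ : Targets
        out′ t b with peeled? t b
        ... | yes _ = neighbours
        ... | no  _ = out t b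
        short′ : ∀ t b → length (out′ t b) ≤ K
        short′ t b with peeled? t b
        ... | yes _ = <⇒≤ (≰⇒> low)
        ... | no  _ = short t b
        oriented′ : ∀ {b c} → b List.∈ side true → c List.∈ side false → R b c →
                    c List.∈ out′ true b ⊎ b List.∈ out′ false c
        oriented′ {b} {c} b∈ c∈ bc with peeled? true b | peeled? false c
        ... | yes (refl , refl) | _     = inj₁ (∈-filter⁺ (From? true b) c∈ bc)
        ... | no _  | yes (refl , refl) = inj₂ (∈-filter⁺ (From? false c) b∈ bc)
        ... | no ¬b | no ¬c = oriented (∈-filter⁺ _ b∈ ¬b) (∈-filter⁺ _ c∈ ¬c) bc

  -- `m` bounds the vertices that remain and serves as the recursion measure. An empty left side
  -- leaves no pair to orient; otherwise, if no degree is low, any left vertex can be the root of a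
  -- core.
  peel : ∀ m side → (∀ s → Unique (side s)) → length (side true) + length (side false) ≤ m →
         ¬ Core → OrientedOn side
  peel m side side! l ¬core with Any.any? (lowDegree? side true) (side true) | Any.any? (lowDegree? side false) (side false) | empty? (side true)
  peel m side side! l ¬core | _ | _ | inj₁ eq =
    (λ _ _ → []) , (λ _ _ → z≤n) , λ a∈ → contradiction (subst (_ List.∈_) eq a∈) λ ()
  peel zero side side! l ¬core | _ | _ | inj₂ (r , r∈) = contradiction r∈ (length≡0⇒∉ (n≤0⇒n≡0 (m+n≤o⇒m≤o (length (side true)) l)))
  peel (suc m) side side! l ¬core | yes some | _ | inj₂ _ =
    let (a , a∈ , low) = List.find some
        open Peel side true a
    in extend-orientation low (peel m rest (λ s → Unique.filter⁺ _ (side! s))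
         (s≤s⁻¹ (≤-trans (rest-shorter a∈) l)) ¬core)
  peel (suc m) side side! l ¬core | no _ | yes some | inj₂ _ =
    let (a , a∈ , low) = List.find some
        open Peel side false a
    in extend-orientation low (peel m rest (λ s → Unique.filter⁺ _ (side! s))
         (s≤s⁻¹ (≤-trans (rest-shorter a∈) l)) ¬core)
  peel (suc m) side side! l ¬core | no none | no none′ | inj₂ (r , r∈) = contradiction (record
    { side   = side
    ; unique = side!
    ; root   = r
    ; root∈  = r∈
    ; degree = λ where
        true  a∈ → decidable-stable (K ≤? _) λ low → none (List.lose a∈ low)
        false a∈ → decidable-stable (K ≤? _) λ low → none′ (List.lose a∈ low)
    }) ¬core

  record Orientation : Set where
    field
      out      : Targets
      short    : ∀ s a → length (out s a) ≤ K
      oriented : ∀ {a b} → R a b → b List.∈ out true a ⊎ a List.∈ out false b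

    out-≲ : ∀ s a → (λ b → b List.∈ out s a) ≲ K
    out-≲ s a = ≲-mono (short s a) (≲-list (out s a))

    related-≲ : uncurry R ≲ n * K + n * K
    related-≲ = ≲-⊆ split (≲-∪ (≲-allFin ⟫ out-≲ true) (≲-map (λ (b , a) → a , b) (λ p → _ , p , refl) (≲-allFin ⟫ out-≲ false)))
      where
      split : ∀ {p} → R (proj₁ p) (proj₂ p) →
              (⊤ × proj₂ p List.∈ out true (proj₁ p)) ⊎ (⊤ × proj₁ p List.∈ out false (proj₂ p))
      split ab = [ (λ b∈ → inj₁ (tt , b∈)) , (λ a∈ → inj₂ (tt , a∈)) ]′ (oriented ab)

  orient : ¬ Core → Orientation
  orient ¬core = record { out = proj₁ o ; short = proj₁ (proj₂ o) ; oriented = proj₂ (proj₂ o) (∈-allFin _) (∈-allFin _) }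
    where
    o : OrientedOn (λ _ → allFin n)
    o = peel _ (λ _ → allFin n) (λ _ → Unique.allFin⁺ n) ≤-refl ¬core

-- Upper bounds

Rotations : Pred (Hexagon n) 0ℓ → Pred (Hexagon n) 0ℓ
Rotations P t = P t ⊎ P (rotate t) ⊎ P (rotate (rotate t)) ⊎ P (rotate (rotate (rotate t)))
  ⊎ P (rotate (rotate (rotate (rotate t)))) ⊎ P (rotate (rotate (rotate (rotate (rotate t)))))

rotations-≲ : ∀ {b} {P : Pred (Hexagon n) 0ℓ} → P ≲ b → Rotations P ≲ b + (b + (b + (b + (b + b))))
rotations-≲ {P = P} P≲ =
  -- Six rotations are the identity, so `P (rotate t)` means that `t` is the fifth rotation of a
  -- member of `P`, and so on.
  ≲-∪ P≲ (≲-∪ (≲-map r⁵ (λ p → _ , p , refl) P≲) (≲-∪ (≲-map r⁴ (λ p → _ , p , refl) P≲)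
    (≲-∪ (≲-map r³ (λ p → _ , p , refl) P≲) (≲-∪ (≲-map r² (λ p → _ , p , refl) P≲)
      (≲-map r (λ p → _ , p , refl) P≲)))))
  where
  r r² r³ r⁴ r⁵ : Hexagon _ → Hexagon _
  r  = rotate
  r² = r ∘ r
  r³ = r ∘ r²
  r⁴ = r ∘ r³
  r⁵ = r ∘ r⁴

module _ (G : Graph n) where

  common : Fin n → Fin n → List (Fin n)
  common a b = filter (λ m → Adj? G a m ×-dec Adj? G m b) (allFin n)

  common-unique : ∀ a b → Unique (common a b)
  common-unique a b = Unique.filter⁺ _ (Unique.allFin⁺ n)

  ∈-common : ∀ {a b m} → Adj G a m → Adj G m b → m List.∈ common a b
  ∈-common am mb = ∈-filter⁺ _ (∈-allFin _) (am , mb)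

  common-∈ : ∀ {a b m} → m List.∈ common a b → Adj G a m × Adj G m b
  common-∈ {a} {b} m∈ = proj₂ (∈-filter⁻ (λ m → Adj? G a m ×-dec Adj? G m b) {xs = allFin n} m∈)

  module _ {k : ℕ} (1≤k : 1 ≤ k) {P : Pred (Fin n) 0ℓ} {x a₀ : Fin n}
           (P⇒Adj : ∀ {a} → P a → Adj G x a) (Pa₀ : P a₀)
           (step : ∀ {a} S → P a → length S ≤ k * 2 →
                   ∃[ m ] ∃[ a′ ] Adj G a m × Adj G m a′ × ¬ (m List.∈ S) × ¬ (a′ List.∈ S) × P a′) where

    private
      walk : ∀ i → i < k → ∃[ h ] ∃[ p ] Path G x h p × P h × length p ≡ suc i * 2
      walk zero    _   = a₀ , _ , extend start (P⇒Adj Pa₀) (λ { (here e) → Adj-irrefl G (P⇒Adj Pa₀) (sym e) }) , Pa₀ , refl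
      walk (suc i) i<k =
        let (h , p , path , Ph , l) = walk i (<⇒≤ i<k)
            (m , a , hm , ma , m∉ , a∉ , Pa) = step p Ph (≤-trans (≤-reflexive l) (*-monoˡ-≤ 2 (<⇒≤ i<k)))
        in a , _ , extend (extend path hm m∉) ma (λ { (here e) → Adj-irrefl G ma (sym e) ; (there a∈) → a∉ a∈ })
           , Pa , cong (2 +_) l

    -- Every second vertex of the greedy walk from `x` satisfies `P` and so is adjacent to `x`; the
    -- walk can be closed once it has `k * 2` vertices.
    two-step-cycle : Contains G (C (k * 2))
    two-step-cycle = let (h , p , path , Ph , l) = walk (pred k) (≤-reflexive k≡)
                     in closed-path⇒cycle path (Adj-sym G (P⇒Adj Ph)) (trans l (cong (_* 2) k≡)) (*-monoˡ-≤ 2 1≤k)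
      where
      k≡ : suc (pred k) ≡ k
      k≡ = suc-pred k {{>-nonZero 1≤k}}

-- The cubic upper bound from one forbidden even cycle

module EvenCycleFree {k : ℕ} (1≤k : 1 ≤ k) (G : Graph n) (free : ¬ Contains G (C (k * 2))) where

  private
    -- Larger than the number of vertices that a walk has to avoid, so that neither a core nor a
    -- heavy pair can block it.
    K = 2 + k * 2

  Heavy : Rel (Fin n) 0ℓ
  Heavy a b = K ≤ length (common G a b)

  Heavy? : Decidable₂ Heavy
  Heavy? a b = K ≤? length (common G a b)

  heavy-step : ∀ {a b} → Heavy a b → ∀ S → length S ≤ k * 2 →
               ∃[ m ] Adj G a m × Adj G m b × ¬ (m List.∈ S)
  heavy-step {a} {b} heavy S l =
    let (m , m∈ , m∉S) = pick-∉ _≟ᶠ_ S (common-unique G a b) (<-≤-trans (s≤s (m≤n⇒m≤1+n l)) heavy)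
        (am , mb) = common-∈ G m∈
    in m , am , mb , m∉S

  -- A core contains a cycle v a b a′ b′ … of length 2k.
  module Walks (v : Fin n) where

    Walk : Rel (Fin n) 0ℓ
    Walk a b = Adj G v a × Adj G a b × b ≢ v

    walk? : Decidable₂ Walk
    walk? a b = Adj? G v a ×-dec Adj? G a b ×-dec ¬? (b ≟ᶠ v)

    open Degeneracy walk? K

    no-core : ¬ Core
    no-core core = free (two-step-cycle G 1≤k {P = λ a → a List.∈ side true} v-adj root∈ next)
      where
      open Core core
      v-adj : ∀ {a} → a List.∈ side true → Adj G v a
      v-adj a∈ = let (_ , _ , (va , _) , _) = step true a∈ [] (s≤s z≤n) in va
      next : ∀ {a} S → a List.∈ side true → length S ≤ k * 2 →
             ∃[ m ] ∃[ a′ ] Adj G a m × Adj G m a′ × ¬ (m List.∈ S) × ¬ (a′ List.∈ S) × a′ List.∈ side true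
      next S a∈ l =
        let (b , b∈ , (_ , ab , _) , b∉) = step true a∈ S (s≤s (m≤n⇒m≤1+n l))
            (a′ , a′∈ , (_ , a′b , _) , a′∉) = step false b∈ S (s≤s (m≤n⇒m≤1+n l))
        in b , a′ , ab , Adj-sym G a′b , b∉ , a′∉ , a′∈

    abstract
      walks-≲ : uncurry Walk ≲ n * K + n * K
      walks-≲ = Orientation.related-≲ (orient no-core)

  -- A core contains a long path of heavy pairs, each of which is bridged by a
  -- fresh common neighbour; x closes the cycle.
  module Links (x : Fin n) where

    Link : Rel (Fin n) 0ℓ
    Link a b = Adj G x a × Adj G x b × Heavy a b

    link? : Decidable₂ Link
    link? a b = Adj? G x a ×-dec Adj? G x b ×-dec Heavy? a b

    open Degeneracy link? K

    no-core : ¬ Core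
    no-core core = free (two-step-cycle G 1≤k {P = λ a → ∃[ s ] a List.∈ side s} x-adj (true , root∈) next)
      where
      open Core core
      x-adj : ∀ {a} → ∃[ s ] a List.∈ side s → Adj G x a
      x-adj (true  , a∈) = let (_ , _ , (xa , _) , _) = step true a∈ [] (s≤s z≤n) in xa
      x-adj (false , a∈) = let (_ , _ , (_ , xa , _) , _) = step false a∈ [] (s≤s z≤n) in xa
      next : ∀ {a} S → ∃[ s ] a List.∈ side s → length S ≤ k * 2 →
             ∃[ m ] ∃[ a′ ] Adj G a m × Adj G m a′ × ¬ (m List.∈ S) × ¬ (a′ List.∈ S) × ∃[ s ] a′ List.∈ side s
      next S (true , a∈) l =
        let (b , b∈ , (_ , _ , heavy) , b∉) = step true a∈ S (s≤s (m≤n⇒m≤1+n l))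
            (m , am , mb , m∉) = heavy-step heavy S l
        in m , b , am , mb , m∉ , b∉ , false , b∈
      next S (false , a∈) l =
        let (b , b∈ , (_ , _ , heavy) , b∉) = step false a∈ S (s≤s (m≤n⇒m≤1+n l))
            (m , bm , ma , m∉) = heavy-step heavy S l
        in m , b , Adj-sym G ma , Adj-sym G bm , m∉ , b∉ , true , b∈

    abstract
      orientation : Orientation
      orientation = orient no-core

    open Orientation orientation

    -- A vertex has arcs as a left and as a right member of a pair; merging the two lists gives an
    -- orientation on the neighbours of `x` with out-degree at most `K + K`.
    targets : Fin n → List (Fin n)
    targets a = out true a ++ out false a

    targets-≲ : ∀ a → (λ b → b List.∈ targets a) ≲ K + K
    targets-≲ a = ≲-⊆ (∈-++⁻ (out true a)) (≲-∪ (out-≲ true a) (out-≲ false a))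

    linked : ∀ {a b} → Link a b → b List.∈ targets a ⊎ a List.∈ targets b
    linked {b = b} ab = [ inj₁ ∘ ∈-++⁺ˡ , inj₂ ∘ ∈-++⁺ʳ (out true b) ]′ (oriented ab)

  open Links using (targets; targets-≲; linked)
  open Walks using (walks-≲)

  Light : Pred (Hexagon n) 0ℓ
  Light t@(u , _ , _ , _ , w , _) = IsHexagon G t × ¬ Heavy u w

  light-common-≲ : ∀ a b → (λ m → ¬ Heavy a b × m List.∈ common G a b) ≲ K
  light-common-≲ a b = ≲-when (¬? (Heavy? a b)) λ light → ≲-mono (<⇒≤ (≰⇒> light)) (≲-list (common G a b))

  light-≲ : Light ≲ n * (n * K + n * K) * (n * K + n * K) * K
  light-≲ = ≲-map (λ (((v , x , u) , y , w) , z) → u , x , v , y , w , z)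
    (λ (h , light) → let open IsHexagon h in
      _ , (((tt , Adj-sym G xv , Adj-sym G ux , u≢v) , vy , yw , ≢-sym v≢w) , light , ∈-common G (Adj-sym G zu) (Adj-sym G wz)) , refl)
    choices-≲
    where
    Choice : Pred (((Fin n × Fin n × Fin n) × Fin n × Fin n) × Fin n) 0ℓ
    Choice (((v , x , u) , y , w) , z) =
      ((⊤ × Walks.Walk v x u) × Walks.Walk v y w) × ¬ Heavy u w × z List.∈ common G u w

    choices-≲ : Choice ≲ n * (n * K + n * K) * (n * K + n * K) * K
    choices-≲ = ≲-allFin ⟫ walks-≲ ⟫ (λ (v , _) → walks-≲ v) ⟫ λ ((v , x , u) , y , w) → light-common-≲ u w

  Linked : Fin n → Rel (Fin n) 0ℓ
  Linked c a b = b List.∈ targets c a ⊎ a List.∈ targets c b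

  -- The arcs at x, v, w of a hexagon u x v y w z: three of the vertices u, x, v, w
  -- determine the fourth up to 2K choices, then x → y → z gives y and z.
  Chain : Pred (Hexagon n) 0ℓ
  Chain (u , x , v , y , w , z) = Linked x v u × y List.∈ targets v x × z List.∈ targets w y

  chain-≲ : Chain ≲ n * n * n * (K + K) * (K + K) * (K + K) + n * n * n * (K + K) * (K + K) * (K + K)
  chain-≲ = ≲-⊆ (λ { (inj₁ u∈ , y∈ , z∈) → inj₁ (u∈ , y∈ , z∈) ; (inj₂ v∈ , y∈ , z∈) → inj₂ (v∈ , y∈ , z∈) })
    (≲-∪ {P = λ (u , x , v , y , w , z) → u List.∈ targets x v × y List.∈ targets v x × z List.∈ targets w y}
         {Q = λ (u , x , v , y , w , z) → v List.∈ targets x u × y List.∈ targets v x × z List.∈ targets w y}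
      (≲-map (λ (((((x , v) , w) , u) , y) , z) → u , x , v , y , w , z)
        (λ (u∈ , y∈ , z∈) → _ , (((((tt , tt) , tt) , u∈) , y∈) , z∈) , refl)
        (≲-allFin ⟫ (λ _ → ≲-allFin) ⟫ (λ _ → ≲-allFin) ⟫ (λ ((x , v) , _) → targets-≲ x v)
          ⟫ (λ (((x , v) , _) , _) → targets-≲ v x) ⟫ (λ ((((_ , _) , w) , _) , y) → targets-≲ w y)))
      (≲-map (λ (((((x , u) , w) , v) , y) , z) → u , x , v , y , w , z)
        (λ (v∈ , y∈ , z∈) → _ , (((((tt , tt) , tt) , v∈) , y∈) , z∈) , refl)
        (≲-allFin ⟫ (λ _ → ≲-allFin) ⟫ (λ _ → ≲-allFin) ⟫ (λ ((x , u) , _) → targets-≲ x u)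
          ⟫ (λ (((x , _) , _) , v) → targets-≲ v x) ⟫ (λ ((((_ , _) , w) , _) , y) → targets-≲ w y))))

  -- The arcs joining x, y, z form a tournament, and every tournament on three
  -- vertices has a Hamiltonian path.
  hexagon-cases : ∀ {t} → IsHexagon G t → Rotations Light t ⊎ (Rotations Chain t ⊎ Rotations Chain (reflect t))
  hexagon-cases {u , x , v , y , w , z} h
    with Heavy? u w | Heavy? x z | Heavy? v u | Heavy? y x | Heavy? w v | Heavy? z y
  ... | no l | _ | _ | _ | _ | _ = inj₁ (inj₁ (h , l))
  ... | yes _ | no l | _ | _ | _ | _ = inj₁ (inj₂ (inj₁ (rotate-isHexagon h , l)))
  ... | yes _ | yes _ | no l | _ | _ | _ = inj₁ (inj₂ (inj₂ (inj₁ (rotate-isHexagon (rotate-isHexagon h) , l))))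
  ... | yes _ | yes _ | yes _ | no l | _ | _ = inj₁ (inj₂ (inj₂ (inj₂ (inj₁
        (rotate-isHexagon (rotate-isHexagon (rotate-isHexagon h)) , l)))))
  ... | yes _ | yes _ | yes _ | yes _ | no l | _ = inj₁ (inj₂ (inj₂ (inj₂ (inj₂ (inj₁
        (rotate-isHexagon (rotate-isHexagon (rotate-isHexagon (rotate-isHexagon h))) , l))))))
  ... | yes _ | yes _ | yes _ | yes _ | yes _ | no l = inj₁ (inj₂ (inj₂ (inj₂ (inj₂ (inj₂
        (rotate-isHexagon (rotate-isHexagon (rotate-isHexagon (rotate-isHexagon (rotate-isHexagon h)))) , l))))))
  ... | yes uw | yes xz | yes vu | yes yx | yes wv | yes zy = inj₂ (tournament ⟨yx⟩ ⟨zy⟩ ⟨xz⟩)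
    where
    open IsHexagon h using (ux; xv; vy; yw; wz; zu)
    flip : ∀ {c a b} → Linked c a b → Linked c b a
    flip = [ inj₂ , inj₁ ]′
    ⟨uw⟩ : Linked z u w
    ⟨uw⟩ = linked z (zu , Adj-sym G wz , uw)
    ⟨vu⟩ : Linked x v u
    ⟨vu⟩ = linked x (xv , Adj-sym G ux , vu)
    ⟨wv⟩ : Linked y w v
    ⟨wv⟩ = linked y (yw , Adj-sym G vy , wv)
    ⟨xz⟩ : Linked u x z
    ⟨xz⟩ = linked u (ux , Adj-sym G zu , xz)
    ⟨yx⟩ : Linked v y x
    ⟨yx⟩ = linked v (vy , Adj-sym G xv , yx)
    ⟨zy⟩ : Linked w z y
    ⟨zy⟩ = linked w (wz , Adj-sym G yw , zy)
    t : Hexagon n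
    t = u , x , v , y , w , z
    tournament : Linked v y x → Linked w z y → Linked u x z → Rotations Chain t ⊎ Rotations Chain (reflect t)
    -- The symmetry chosen in each case moves the Hamiltonian path to the places of `x → y → z`; the
    -- first component is the arc between the two hexagon neighbours of its initial vertex.
    tournament (inj₂ x→y) (inj₂ y→z) _          = inj₁ (inj₁ (⟨vu⟩ , x→y , y→z))
    tournament (inj₂ x→y) (inj₁ z→y) (inj₂ z→x) = inj₁ (inj₂ (inj₂ (inj₂ (inj₂ (inj₁ (⟨uw⟩ , z→x , x→y))))))
    tournament (inj₂ x→y) (inj₁ z→y) (inj₁ x→z) = inj₂ (inj₂ (inj₂ (inj₁ (flip ⟨vu⟩ , x→z , z→y))))
    tournament (inj₁ y→x) _          (inj₁ x→z) = inj₂ (inj₁ (flip ⟨wv⟩ , y→x , x→z))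
    tournament (inj₁ y→x) (inj₂ y→z) (inj₂ z→x) = inj₁ (inj₂ (inj₂ (inj₁ (⟨wv⟩ , y→z , z→x))))
    tournament (inj₁ y→x) (inj₁ z→y) (inj₂ z→x) = inj₂ (inj₂ (inj₂ (inj₂ (inj₂ (inj₁ (flip ⟨uw⟩ , z→y , y→x))))))

  -- A light family has 4K³n³ members and occurs in 6 rotations; a chain family has 16K³n³ and
  -- occurs in 12 positions, reflections included: 24 + 192 = 216.
  hexagons-≲ : IsHexagon G ≲ 216 * (K * K * K) * n ^ 3
  hexagons-≲ = ≲-mono (≤-reflexive total) (≲-⊆ hexagon-cases
    (≲-∪ (rotations-≲ light-≲) (≲-∪ (rotations-≲ chain-≲) (≲-map reflect (λ p → _ , p , refl) (rotations-≲ chain-≲)))))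
    where
    open +-*-Solver
    light = n * (n * K + n * K) * (n * K + n * K) * K
    chain = n * n * n * (K + K) * (K + K) * (K + K) + n * n * n * (K + K) * (K + K) * (K + K)
    six : ℕ → ℕ
    six b = b + (b + (b + (b + (b + b))))
    total : six light + (six chain + six chain) ≡ 216 * (K * K * K) * n ^ 3
    total = solve 2 (λ n K →
      let light = n :* (n :* K :+ n :* K) :* (n :* K :+ n :* K) :* K
          chain = n :* n :* n :* (K :+ K) :* (K :+ K) :* (K :+ K) :+ n :* n :* n :* (K :+ K) :* (K :+ K) :* (K :+ K)
          six   = λ b → b :+ (b :+ (b :+ (b :+ (b :+ b))))
      in six light :+ (six chain :+ six chain) := con 216 :* (K :* K :* K) :* (n :* (n :* (n :* con 1)))) refl n K

  copies-≤ : copies (C 6) G ≤ 216 * (K * K * K) * n ^ 3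
  copies-≤ = hexagons-≲⇒copies-≤ hexagons-≲

-- The quadratic upper bound without C₄ and a longer even cycle

isHexagon? : (G : Graph n) → Decidable₁ (IsHexagon G)
isHexagon? G (u , x , v , y , w , z) = map′
  (λ (a , b , c , d , e , f , g , h , i , j , k , l , m , n , o) → hexagon a b c d e f g h i j k l m n o)
  (λ h → let open IsHexagon h in ux , xv , vy , yw , wz , zu , u≢v , v≢w , w≢u , x≢y , y≢z , z≢x , u≢y , x≢w , v≢z)
  (Adj? G u x ×-dec Adj? G x v ×-dec Adj? G v y ×-dec Adj? G y w ×-dec Adj? G w z ×-dec Adj? G z u
    ×-dec ¬? (u ≟ᶠ v) ×-dec ¬? (v ≟ᶠ w) ×-dec ¬? (w ≟ᶠ u) ×-dec ¬? (x ≟ᶠ y) ×-dec ¬? (y ≟ᶠ z) ×-dec ¬? (z ≟ᶠ x)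
    ×-dec ¬? (u ≟ᶠ y) ×-dec ¬? (x ≟ᶠ w) ×-dec ¬? (v ≟ᶠ z))

module C4Free (G : Graph n) (C4-free : ¬ Contains G (C 4)) where

  common-neighbour-unique : ∀ {a b m m′} → a ≢ b → Adj G a m → Adj G m b → Adj G a m′ → Adj G m′ b → m ≡ m′
  common-neighbour-unique {m = m} {m′} a≢b am mb am′ m′b with m ≟ᶠ m′
  ... | yes m≡m′ = m≡m′
  ... | no  m≢m′ = contradiction
    (closed-path⇒cycle (extend (extend (extend start
        am (All¬⇒¬Any (≢-sym (Adj-irrefl G am) ∷ [])))
        mb (All¬⇒¬Any (≢-sym (Adj-irrefl G mb) ∷ ≢-sym a≢b ∷ [])))
        (Adj-sym G m′b) (All¬⇒¬Any (Adj-irrefl G m′b ∷ ≢-sym m≢m′ ∷ ≢-sym (Adj-irrefl G am′) ∷ [])))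
      (Adj-sym G am′) refl (s≤s (s≤s z≤n)))
    C4-free

  Between : Fin n → Fin n → Pred (Fin n) 0ℓ
  Between a b m = Adj G a m × Adj G m b

  between-≲ : ∀ a b → (λ m → a ≢ b × Between a b m) ≲ 1
  between-≲ a b = ≲-when (¬? (a ≟ᶠ b)) λ a≢b →
    case any? (λ m → Adj? G a m ×-dec Adj? G m b) of λ where
      (yes (m , am , mb)) → cover (m ∷ []) (s≤s z≤n) λ (am′ , m′b) → here (common-neighbour-unique a≢b am′ m′b am mb)
      (no none)           → ≲-empty λ {m} p → none (m , p)

  -- The inequalities forbid backtracking. They are also what `between-≲` requires, once an inner
  -- vertex is fixed, to leave a single choice for the other one.
  Path₃ : Fin n → Fin n → Pred (Fin n × Fin n) 0ℓ
  Path₃ a b (m , m′) = Adj G a m × Adj G m m′ × Adj G m′ b × a ≢ m′ × m ≢ b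

  path₃? : ∀ a b → Decidable₁ (Path₃ a b)
  path₃? a b (m , m′) = Adj? G a m ×-dec Adj? G m m′ ×-dec Adj? G m′ b ×-dec ¬? (a ≟ᶠ m′) ×-dec ¬? (m ≟ᶠ b)

  private
    pairs : List (Fin n × Fin n)
    pairs = cartesianProductWith _,_ (allFin n) (allFin n)

  paths₃ : Fin n → Fin n → List (Fin n × Fin n)
  paths₃ a b = filter (path₃? a b) pairs

  paths₃-unique : ∀ a b → Unique (paths₃ a b)
  paths₃-unique a b = Unique.filter⁺ (path₃? a b) (Unique.cartesianProduct⁺ (Unique.allFin⁺ n) (Unique.allFin⁺ n))

  paths₃-sound : ∀ {a b p} → p List.∈ paths₃ a b → Path₃ a b p
  paths₃-sound {a} {b} p∈ = proj₂ (∈-filter⁻ (path₃? a b) {xs = pairs} p∈)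

  paths₃-complete : ∀ {a b p} → Path₃ a b p → p List.∈ paths₃ a b
  paths₃-complete {a} {b} = ∈-filter⁺ (path₃? a b) (∈-cartesianProductWith⁺ _,_ (∈-allFin _) (∈-allFin _))

  paths₃-sym-≤ : ∀ a b → length (paths₃ a b) ≤ length (paths₃ b a)
  paths₃-sym-≤ a b = length-≤ {T = λ (m , m′) (l , l′) → m ≡ l′ × m′ ≡ l}
    (λ { (refl , refl) (refl , refl) → refl }) (paths₃-unique a b)
    (λ p∈ → let (am , mm′ , m′b , a≢m′ , m≢b) = paths₃-sound p∈
            in _ , paths₃-complete (Adj-sym G m′b , Adj-sym G mm′ , Adj-sym G am , ≢-sym m≢b , ≢-sym a≢m′) , refl , refl)

  -- A vertex lies on at most two of the paths of length three between a and b.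
  paths₃-avoiding : ∀ {a b} S → length S * 1 + length S * 1 < length (paths₃ a b) →
                    ∃[ m ] ∃[ m′ ] Path₃ a b (m , m′) × ¬ (m List.∈ S) × ¬ (m′ List.∈ S)
  paths₃-avoiding {a} {b} S S< with Any.any? (λ (m , m′) → ¬? (Any.any? (m ≟ᶠ_) S) ×-dec ¬? (Any.any? (m′ ≟ᶠ_) S)) (paths₃ a b)
  ... | yes some = let (_ , p∈ , m∉ , m′∉) = List.find some in _ , _ , paths₃-sound p∈ , m∉ , m′∉
  ... | no none = contradiction (≲⇒length-≤ (paths₃-unique a b) meets meeting-≲) (<⇒≱ S<)
    where
    Meets : Pred (Fin n × Fin n) 0ℓ
    Meets (m , m′) = (m List.∈ S × m ≢ b × Between m b m′) ⊎ (m′ List.∈ S × a ≢ m′ × Between a m′ m)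

    meeting-≲ : Meets ≲ length S * 1 + length S * 1
    meeting-≲ = ≲-∪ (≲-list S ⟫ λ m → between-≲ m b)
                    (≲-map (λ (m′ , m) → m , m′) (λ p → _ , p , refl) (≲-list S ⟫ λ m′ → between-≲ a m′))

    meets : ∀ {p} → p List.∈ paths₃ a b → Meets p
    meets {m , m′} p∈ with paths₃-sound p∈ | Any.any? (m ≟ᶠ_) S | Any.any? (m′ ≟ᶠ_) S
    ... | am , mm′ , m′b , a≢m′ , m≢b | yes m∈ | _      = inj₁ (m∈ , m≢b , mm′ , m′b)
    ... | am , mm′ , m′b , a≢m′ , m≢b | no _   | yes m′∈ = inj₂ (m′∈ , a≢m′ , am , mm′)
    ... | _ | no m∉ | no m′∉ = contradiction (List.lose p∈ (m∉ , m′∉)) none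

-- The length `(4 + k) * 2` modulo 6 depends on `k` modulo 3, and a round trip in a core adds six
-- vertices.
mod-3-cases : ∀ k → ∃[ i ] (k ≡ i * 3 ⊎ k ≡ 1 + i * 3 ⊎ k ≡ 2 + i * 3)
mod-3-cases 0 = 0 , inj₁ refl
mod-3-cases 1 = 0 , inj₂ (inj₁ refl)
mod-3-cases 2 = 0 , inj₂ (inj₂ refl)
mod-3-cases (suc (suc (suc k))) with mod-3-cases k
... | i , inj₁ refl        = suc i , inj₁ refl
... | i , inj₂ (inj₁ refl) = suc i , inj₂ (inj₁ refl)
... | i , inj₂ (inj₂ refl) = suc i , inj₂ (inj₂ refl)

module C4EvenCycleFree {k′ : ℕ} (G : Graph n)
                       (C4-free : ¬ Contains G (C 4)) (free : ¬ Contains G (C ((4 + k′) * 2))) where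

  open C4Free G C4-free

  private
    half B D K : ℕ
    half = 4 + k′
    -- `B` bounds the vertices to be avoided: a walk of up to `half * 2` vertices and its next
    -- target, or the five vertices excluded in `start₇`. Each spoils at most two paths of length
    -- three, whence `D`.
    B = 4 + half * 2
    D = suc (B * 1 + B * 1)
    K = suc B

  Heavy : Rel (Fin n) 0ℓ
  Heavy a b = D ≤ length (paths₃ a b)

  Heavy? : Decidable₂ Heavy
  Heavy? a b = D ≤? length (paths₃ a b)

  heavy-sym : Symmetric Heavy
  heavy-sym {a} {b} h = ≤-trans h (paths₃-sym-≤ a b)

  heavy-step : ∀ {a b} → Heavy a b → ∀ S → length S ≤ B →
               ∃[ m ] ∃[ m′ ] Path₃ a b (m , m′) × ¬ (m List.∈ S) × ¬ (m′ List.∈ S)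
  heavy-step h S l = paths₃-avoiding S (≤-trans (s≤s (+-mono-≤ (*-monoˡ-≤ 1 l) (*-monoˡ-≤ 1 l))) h)

  -- Heaviness of `(v , z)` lets core edges be bridged and that of `(y , u)` provides `start₇`;
  -- asking it of all three long diagonals makes the notion invariant under rotation and reflection.
  Full : Pred (Hexagon n) 0ℓ
  Full t@(u , x , v , y , w , z) = IsHexagon G t × Heavy v z × Heavy y u × Heavy w x

  full? : Decidable₁ Full
  full? t@(u , x , v , y , w , z) = isHexagon? G t ×-dec Heavy? v z ×-dec Heavy? y u ×-dec Heavy? w x

  full-rotate : ∀ {t} → Full t → Full (rotate t)
  full-rotate (h , vz , yu , wx) = rotate-isHexagon h , yu , wx , heavy-sym vz

  full-reflect : ∀ {t} → Full t → Full (reflect t)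
  full-reflect (h , vz , yu , wx) = reflect-isHexagon h , vz , heavy-sym wx , heavy-sym yu

  -- The existential remembers a whole hexagon around the path `v x u z`, so that a core can still
  -- supply the initial segments of its cycles.
  Opposite : Fin n → Fin n → Rel (Fin n) 0ℓ
  Opposite x u v z = ∃[ y ] ∃[ w ] Full (u , x , v , y , w , z)

  opposite? : ∀ x u → Decidable₂ (Opposite x u)
  opposite? x u v z = any? λ y → any? λ w → full? (u , x , v , y , w , z)

  module Across (x u : Fin n) where

    open Degeneracy (opposite? x u) K

    module FromCore (core : Core) where

      open Core core

      at-left : ∀ {v} → v List.∈ side true → ∃[ z ] z List.∈ side false × Opposite x u v z
      at-left v∈ = let (z , z∈ , o , _) = step true v∈ [] (s≤s z≤n) in z , z∈ , o

      at-right : ∀ {z} → z List.∈ side false → ∃[ v ] Opposite x u v z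
      at-right z∈ = let (v , _ , o , _) = step false z∈ [] (s≤s z≤n) in v , o

      left-adj : ∀ {v} → v List.∈ side true → Adj G v x
      left-adj v∈ = let (_ , _ , _ , _ , h , _) = at-left v∈ in Adj-sym G (IsHexagon.xv h)

      right-adj : ∀ {z} → z List.∈ side false → Adj G z u
      right-adj z∈ = let (_ , _ , _ , h , _) = at-right z∈ in IsHexagon.zu h

      from-heavy : ∀ s {a b} → From s a b → Heavy a b
      from-heavy true  (_ , _ , _ , vz , _) = vz
      from-heavy false (_ , _ , _ , vz , _) = heavy-sym vz

      PathFrom : Fin n → Bool → ℕ → Set
      PathFrom ℓ s m = ∃[ h ] ∃[ p ] Path G ℓ h p × h List.∈ side s × length p ≡ m

      -- A core edge is a heavy pair. Replacing it by a path of length three with fresh inner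
      -- vertices adds three vertices and changes the side.
      long-step : ∀ {ℓ m} s → m ≤ half * 2 → PathFrom ℓ s m → PathFrom ℓ (not s) (3 + m)
      long-step s m≤ (a , p , path , a∈ , refl) =
        let (b , b∈ , ab , b∉) = step s a∈ p (s≤s (≤-trans m≤ (m≤n+m _ 4)))
            (m , m′ , (am , mm′ , m′b , _ , _) , m∉ , m′∉) = heavy-step (from-heavy s ab) (b ∷ p) (s≤s (≤-trans m≤ (m≤n+m _ 3)))
        in b , _ , extend (extend (extend path am (m∉ ∘ there))
             mm′ (λ { (here e) → Adj-irrefl G mm′ (sym e) ; (there m′∈) → m′∉ (there m′∈) }))
             m′b (λ { (here e) → m′∉ (here (sym e)) ; (there (here e)) → m∉ (here (sym e)) ; (there (there b∈)) → b∉ b∈ })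
           , b∈ , refl

      long-steps : ∀ {ℓ m} i s → i * 6 + m ≤ half * 2 → PathFrom ℓ s m → PathFrom ℓ s (i * 6 + m)
      long-steps zero    s _  P = P
      long-steps {ℓ} {m} (suc i) s l P = subst (λ t → PathFrom ℓ t _) (not-involutive s)
        (long-step (not s) (≤-trans (m≤n+m _ 3) l) (long-step s (≤-trans (m≤n+m _ 6) l) (long-steps i s (≤-trans (m≤n+m _ 6) l) P)))

      -- A walk from `x` is closed on the left side and a walk from `u` on the right. So `start₂`
      -- yields lengths 2 modulo 6, while `start₃` and `start₇`, which need one `long-step` to reach
      -- the closing side, yield 0 and 4.
      start₂ : PathFrom x true 2
      start₂ = root , _ , extend start (Adj-sym G (left-adj root∈)) (λ { (here e) → Adj-irrefl G (left-adj root∈) e }) , root∈ , refl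

      start₃ : PathFrom u true 3
      start₃ =
        let (_ , _ , _ , _ , h , _) = at-left root∈
            open IsHexagon h hiding (u)
        in root , _ , extend (extend start ux (All¬⇒¬Any (≢-sym (Adj-irrefl G ux) ∷ [])))
             xv (All¬⇒¬Any (≢-sym (Adj-irrefl G xv) ∷ ≢-sym u≢v ∷ [])) , root∈ , refl

      -- The walk x u ⇒ y w z, where ⇒ bridges the heavy pair (u , y).
      start₇ : PathFrom x false 7
      start₇ =
        let (z , z∈ , y , w , h , _ , yu , _) = at-left root∈
            open IsHexagon h using (ux; yw; wz; zu; w≢u; y≢z; z≢x; u≢y; x≢w; x≢y)
            (m , m′ , (um , mm′ , m′y , _) , m∉ , m′∉) =
              heavy-step (heavy-sym yu) (y ∷ w ∷ z ∷ u ∷ x ∷ []) (m≤m+n 5 _)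
        in z , z ∷ w ∷ y ∷ m′ ∷ m ∷ u ∷ x ∷ [] ,
          extend (extend (extend (extend (extend (extend start
            (Adj-sym G ux) (All¬⇒¬Any (Adj-irrefl G ux ∷ [])))
            um (λ m∈ → m∉ (there (there (there m∈)))))
            mm′ (λ { (here e) → Adj-irrefl G mm′ (sym e) ; (there m′∈) → m′∉ (there (there (there m′∈))) }))
            m′y (All¬⇒¬Any ((λ e → m′∉ (here (sym e))) ∷ (λ e → m∉ (here (sym e))) ∷ ≢-sym u≢y ∷ ≢-sym x≢y ∷ [])))
            yw (All¬⇒¬Any (≢-sym (Adj-irrefl G yw) ∷ (λ e → m′∉ (there (here (sym e)))) ∷ (λ e → m∉ (there (here (sym e)))) ∷ w≢u ∷ ≢-sym x≢w ∷ [])))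
            wz (All¬⇒¬Any (≢-sym (Adj-irrefl G wz) ∷ ≢-sym y≢z ∷ (λ e → m′∉ (there (there (here (sym e))))) ∷ (λ e → m∉ (there (there (here (sym e)))))
                 ∷ Adj-irrefl G zu ∷ z≢x ∷ []))
          , z∈ , refl

      close : ∀ {ℓ s m} → (∀ {a} → a List.∈ side s → Adj G a ℓ) → PathFrom ℓ s m → m ≡ half * 2 → Contains G (C (half * 2))
      close adj (_ , _ , path , h∈ , refl) e = closed-path⇒cycle path (adj h∈) e (s≤s (s≤s z≤n))

      cycle-2k : Contains G (C (half * 2))
      cycle-2k with mod-3-cases k′
      ... | i , inj₁ refl        = close left-adj (long-steps (suc i) true (≤-reflexive e) start₂) e
        where
        open +-*-Solver
        e : suc i * 6 + 2 ≡ (4 + i * 3) * 2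
        e = solve 1 (λ i → (con 1 :+ i) :* con 6 :+ con 2 := (con 4 :+ i :* con 3) :* con 2) refl i
      ... | i , inj₂ (inj₁ refl) = close left-adj (long-steps i true (≤-reflexive e) (long-step false (m≤m+n 7 _) start₇)) e
        where
        open +-*-Solver
        e : i * 6 + 10 ≡ (5 + i * 3) * 2
        e = solve 1 (λ i → i :* con 6 :+ con 10 := (con 5 :+ i :* con 3) :* con 2) refl i
      ... | i , inj₂ (inj₂ refl) = close right-adj (long-steps (suc i) false (≤-reflexive e) (long-step true (m≤m+n 3 _) start₃)) e
        where
        open +-*-Solver
        e : suc i * 6 + 6 ≡ (6 + i * 3) * 2
        e = solve 1 (λ i → (con 1 :+ i) :* con 6 :+ con 6 := (con 6 :+ i :* con 3) :* con 2) refl i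

    abstract
      orientation : Orientation
      orientation = orient λ core → free (FromCore.cycle-2k core)

    open Orientation orientation public

  -- Reversing the edge exchanges the sides: `a` is taken as a left vertex for `(x , u)` and as a
  -- right vertex for `(u , x)`. One function then serves arcs leaving either end of an opposite
  -- pair.
  targets : Fin n → Fin n → Fin n → List (Fin n)
  targets x u a = Across.out x u true a ++ Across.out u x false a

  targets-≲ : ∀ x u a → (λ b → b List.∈ targets x u a) ≲ K + K
  targets-≲ x u a = ≲-⊆ (∈-++⁻ (Across.out x u true a)) (≲-∪ (Across.out-≲ x u true a) (Across.out-≲ u x false a))

  Linked : Fin n → Fin n → Rel (Fin n) 0ℓ
  Linked x u v z = z List.∈ targets x u v ⊎ v List.∈ targets u x z

  opposite-linked : ∀ {x u v z} → Opposite x u v z → Linked x u v z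
  opposite-linked {x} {u} {z = z} o =
    [ inj₁ ∘ ∈-++⁺ˡ , inj₂ ∘ ∈-++⁺ʳ (Across.out u x true z) ]′ (Across.oriented x u o)

  Light : Pred (Hexagon n) 0ℓ
  Light t@(_ , _ , v , _ , _ , z) = IsHexagon G t × ¬ Heavy v z

  light-≲ : Light ≲ n * n * (D * D)
  light-≲ = ≲-map (λ ((v , z) , (x , u) , y , w) → u , x , v , y , w , z)
    (λ (h , light) → let open IsHexagon h in
      _ , ((tt , tt) , light , paths₃-complete (Adj-sym G xv , Adj-sym G ux , Adj-sym G zu , ≢-sym u≢v , ≢-sym z≢x)
                             , paths₃-complete (vy , yw , wz , v≢w , y≢z)) , refl)
    (≲-allFin ⟫ (λ _ → ≲-allFin) ⟫ λ (v , z) → ≲-when (¬? (Heavy? v z)) λ light →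
      let few = ≲-mono (<⇒≤ (≰⇒> light)) (≲-list (paths₃ v z)) in few ⟫ λ _ → few)

  -- If the arc leaves `v`, then `v` and `u` are chosen freely and fix `x`; if it leaves `z`, then
  -- `x` and `z` are chosen and fix `u`. In both cases the arc gives the last vertex.
  Spine : Pred (Fin n × Fin n × Fin n × Fin n) 0ℓ
  Spine (v , x , u , z) = (v ≢ u × Between v u x) × (x ≢ z × Between x z u) × Linked x u v z

  spine-≲ : Spine ≲ n * n * 1 * (K + K) + n * n * 1 * (K + K)
  spine-≲ = ≲-⊆ (λ { (p , q , inj₁ z∈) → inj₁ (p , z∈) ; (p , q , inj₂ v∈) → inj₂ (q , v∈) })
    (≲-∪ {P = λ (v , x , u , z) → (v ≢ u × Between v u x) × z List.∈ targets x u v}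
         {Q = λ (v , x , u , z) → (x ≢ z × Between x z u) × v List.∈ targets u x z}
      (≲-map (λ (((v , u) , x) , z) → v , x , u , z) (λ (p , z∈) → _ , (((tt , tt) , p) , z∈) , refl)
        (≲-allFin ⟫ (λ _ → ≲-allFin) ⟫ (λ (v , u) → between-≲ v u) ⟫ λ ((v , u) , x) → targets-≲ x u v))
      (≲-map (λ (((x , z) , u) , v) → v , x , u , z) (λ (q , v∈) → _ , (((tt , tt) , q) , v∈) , refl)
        (≲-allFin ⟫ (λ _ → ≲-allFin) ⟫ (λ (x , z) → between-≲ x z) ⟫ λ ((x , z) , u) → targets-≲ u x z)))

  -- The arc at the edge u z gives w, and y is the common neighbour of v and w.
  Guided : Pred (Hexagon n) 0ℓ
  Guided (u , x , v , y , w , z) = Spine (v , x , u , z) × w List.∈ targets u z x × v ≢ w × Between v w y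

  guided-≲ : Guided ≲ (n * n * 1 * (K + K) + n * n * 1 * (K + K)) * (K + K) * 1
  guided-≲ = ≲-map (λ (((v , x , u , z) , w) , y) → u , x , v , y , w , z)
    (λ (s , w∈ , p) → _ , ((s , w∈) , p) , refl)
    (spine-≲ ⟫ (λ (_ , x , u , z) → targets-≲ u z x) ⟫ λ ((v , _) , w) → between-≲ v w)

  guided : ∀ {u x v y w z} → Full (u , x , v , y , w , z) → w List.∈ targets u z x → Guided (u , x , v , y , w , z)
  guided f@(h , _) w∈ = let open IsHexagon h in
    ((≢-sym u≢v , Adj-sym G xv , Adj-sym G ux) , (≢-sym z≢x , Adj-sym G ux , Adj-sym G zu) , opposite-linked (_ , _ , f))
    , w∈ , v≢w , vy , yw

  -- The diagonal `(x , w)` is opposite across the edge `u z`. If its arc leaves `w` instead of `x`,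
  -- the reflection that exchanges `u` with `z` also exchanges `x` with `w`.
  full-cases : ∀ {t} → Full t → Rotations Guided t ⊎ Rotations Guided (reflect t)
  full-cases {u , x , v , y , w , z} f =
    [ (λ w∈ → inj₁ (inj₁ (guided f w∈)))
    , (λ x∈ → inj₂ (inj₂ (inj₂ (inj₂ (inj₂ (inj₂ (guided (full-rotate⁵ (full-reflect f)) x∈)))))))
    ]′ (opposite-linked {u} {z} {x} {w} (_ , _ , full-rotate⁵ f))
    where
    full-rotate⁵ : ∀ {t} → Full t → Full (rotate (rotate (rotate (rotate (rotate t)))))
    full-rotate⁵ {t} f = full-rotate {rotate (rotate (rotate (rotate t)))} (full-rotate {rotate (rotate (rotate t))}
      (full-rotate {rotate (rotate t)} (full-rotate {rotate t} (full-rotate {t} f))))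

  hexagon-cases : ∀ {t} → IsHexagon G t → Rotations Light t ⊎ (Rotations Guided t ⊎ Rotations Guided (reflect t))
  hexagon-cases {u , x , v , y , w , z} h = by-weight (Heavy? v z) (Heavy? y u) (Heavy? w x)
    where
    t : Hexagon n
    t = u , x , v , y , w , z
    by-weight : Dec (Heavy v z) → Dec (Heavy y u) → Dec (Heavy w x) →
                Rotations Light t ⊎ (Rotations Guided t ⊎ Rotations Guided (reflect t))
    by-weight (no vz)  _        _        = inj₁ (inj₁ (h , vz))
    by-weight (yes _)  (no yu)  _        = inj₁ (inj₂ (inj₁ (rotate-isHexagon h , yu)))
    by-weight (yes _)  (yes _)  (no wx)  = inj₁ (inj₂ (inj₂ (inj₁ (rotate-isHexagon (rotate-isHexagon h) , wx))))
    by-weight (yes vz) (yes yu) (yes wx) = inj₂ (full-cases (h , vz , yu , wx))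

  -- Six rotations of the light family, and twelve positions of the guided family with 8K²n² members
  -- each.
  hexagons-≲ : IsHexagon G ≲ (6 * (D * D) + 96 * (K * K)) * n ^ 2
  hexagons-≲ = ≲-mono (≤-reflexive total) (≲-⊆ hexagon-cases
    (≲-∪ (rotations-≲ light-≲) (≲-∪ (rotations-≲ guided-≲) (≲-map reflect (λ p → _ , p , refl) (rotations-≲ guided-≲)))))
    where
    open +-*-Solver
    light = n * n * (D * D)
    path = (n * n * 1 * (K + K) + n * n * 1 * (K + K)) * (K + K) * 1
    six : ℕ → ℕ
    six b = b + (b + (b + (b + (b + b))))
    total : six light + (six path + six path) ≡ (6 * (D * D) + 96 * (K * K)) * n ^ 2
    total = solve 3 (λ n D K →
      let light = n :* n :* (D :* D)
          path  = (n :* n :* con 1 :* (K :+ K) :+ n :* n :* con 1 :* (K :+ K)) :* (K :+ K) :* con 1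
          six   = λ b → b :+ (b :+ (b :+ (b :+ (b :+ b))))
      in six light :+ (six path :+ six path) := (con 6 :* (D :* D) :+ con 96 :* (K :* K)) :* (n :* (n :* con 1))) refl n D K

  copies-≤ : copies (C 6) G ≤ (6 * (D * D) + 96 * (K * K)) * n ^ 2
  copies-≤ = hexagons-≲⇒copies-≤ hexagons-≲

-- Lower bounds

-- A cycle unrolled along ℕ: positions need no modular arithmetic, the starting point can be
-- shifted, and the vertices may be of any type.
record CyclicWalk {S : Set} (R : Rel S 0ℓ) (a : ℕ) : Set where
  field
    at        : ℕ → S
    step      : ∀ t → R (at t) (at (suc t))
    periodic  : ∀ t → at (t + a) ≡ at t
    injective : ∀ t d → at (t + d) ≡ at t → a ∣ d

  shift : ℕ → CyclicWalk R a
  shift s = record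
    { at        = λ t → at (s + t)
    ; step      = λ t → subst (λ j → R (at (s + t)) (at j)) (sym (+-suc s t)) (step (s + t))
    ; periodic  = λ t → trans (cong at (sym (+-assoc s t a))) (periodic (s + t))
    ; injective = λ t d e → injective (s + t) d (trans (cong at (+-assoc s t d)) e)
    }

  no-backtrack : 3 ≤ a → ∀ t → at (2 + t) ≢ at t
  no-backtrack 3≤a t e = <⇒≱ 3≤a (∣⇒≤ (injective t 2 (trans (cong at (+-comm t 2)) e)))

cycle⇒walk : ∀ {n a} {G : Graph n} → 3 ≤ a → Contains G (C a) → CyclicWalk (Adj G) a
cycle⇒walk {n} {suc a-1} {G} 3≤a (_ , copy) = record
  { at        = λ t → f (t mod a)
  ; step      = λ t → edge _ _ (Equivalence.to (adjacency _ _) (Equivalence.from (Adj-C (<⇒≤ 3≤a) _ _) (inj₁ (next t))))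
  ; periodic  = λ t → cong f (toℕ-injective (trans (toℕ-mod (t + a)) (trans ([m+n]%n≡m%n t a) (sym (toℕ-mod t)))))
  ; injective = λ t d e → ∣-distance t d
      (trans (sym (toℕ-mod (t + d))) (trans (cong toℕ (f-inj _ _ e)) (toℕ-mod t)))
  }
  where
  open IsCopyOf copy
  open _IsSubgraphOf_ isSubgraph
  open IsIsomorphism (proj₂ isomorphic) renaming (injective to f-inj)
  a : ℕ
  a = suc a-1
  f : Fin a → Fin n
  f = proj₁ isomorphic
  toℕ-mod : ∀ t → toℕ (t mod a) ≡ t % a
  toℕ-mod t = toℕ-fromℕ< (m%n<n t a)
  suc-% : ∀ t → suc t % a ≡ suc (t % a) % a
  suc-% t = trans (%-distribˡ-+ 1 t a) (cong (λ s → (s + t % a) % a) (m<n⇒m%n≡m (<⇒≤ 3≤a)))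
  next : ∀ t → Next (t mod a) (suc t mod a)
  next t with suc (t % a) ≟ a
  ... | yes e = inj₂ ( trans (toℕ-mod (suc t)) (trans (suc-% t) (trans (cong (_% a) e) (n%n≡0 a)))
                     , trans (cong suc (toℕ-mod t)) e)
  ... | no ≢a = inj₁ (trans (toℕ-mod (suc t)) (trans (suc-% t)
                  (trans (m<n⇒m%n≡m (≤∧≢⇒< (m%n<n t a) ≢a)) (cong suc (sym (toℕ-mod t))))))
  ∣-distance : ∀ t d → (t + d) % a ≡ t % a → a ∣ d
  ∣-distance t d e = ∣m+n∣m⇒∣n {m = t / a * a} (divides ((t + d) / a) (+-cancelˡ-≡ (t % a) _ _ (begin
    t % a + (t / a * a + d)          ≡⟨ +-assoc (t % a) _ d ⟨
    t % a + t / a * a + d            ≡⟨ cong (_+ d) (m≡m%n+[m/n]*n t a) ⟨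
    t + d                            ≡⟨ m≡m%n+[m/n]*n (t + d) a ⟩
    (t + d) % a + (t + d) / a * a    ≡⟨ cong (_+ (t + d) / a * a) e ⟩
    t % a + (t + d) / a * a          ∎))) (n∣m*n (t / a))
    where open ≡-Reasoning

-- With the factor `labellings` it is enough to exhibit `N` distinct labelled hexagons, whether or
-- not some of them span the same copy.
ManyHexagons : (A : Pred ℕ 0ℓ) (N n : ℕ) → Set
ManyHexagons A N n = ∃ λ (G : Graph n) → Free (𝓒 A) G × N ≤ copies (C 6) G * labellings

-- The graph has r additional isolated vertices.
module Realise {S : Set} {c : ℕ} (enum : Fin c ↔ S) {R : Rel S 0ℓ} (R? : Decidable₂ R)
               (R-sym : Symmetric R) (R-irrefl : ∀ {x} → ¬ R x x) (r : ℕ) where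

  open Inverse enum using (to; from; strictlyInverseˡ; strictlyInverseʳ)

  private
    Lifted : Rel (Fin c ⊎ Fin r) 0ℓ
    Lifted (inj₁ i) (inj₁ j) = R (to i) (to j)
    Lifted _        _        = ⊥

    lifted? : Decidable₂ Lifted
    lifted? (inj₁ i) (inj₁ j) = R? (to i) (to j)
    lifted? (inj₁ _) (inj₂ _) = no λ ()
    lifted? (inj₂ _) _        = no λ ()

    lifted-sym : Symmetric Lifted
    lifted-sym {inj₁ i} {inj₁ j} = R-sym

    adj? : Decidable₂ (λ i j → Lifted (splitAt c i) (splitAt c j))
    adj? i j = lifted? (splitAt c i) (splitAt c j)

    adj-sym : Symmetric (λ i j → Lifted (splitAt c i) (splitAt c j))
    adj-sym {i} {j} = lifted-sym {splitAt c i} {splitAt c j}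

  realisation : Graph (c + r)
  realisation = fromRel adj?

  vertex : S → Fin (c + r)
  vertex x = from x ↑ˡ r

  vertex-injective : ∀ {x y} → vertex x ≡ vertex y → x ≡ y
  vertex-injective {x} {y} e = trans (sym (strictlyInverseˡ x)) (trans (cong to (↑ˡ-injective r _ _ e)) (strictlyInverseˡ y))

  Adj-vertex : ∀ {x y} → R x y → Adj realisation (vertex x) (vertex y)
  Adj-vertex {x} {y} xy = Equivalence.from (Adj-fromRel adj? adj-sym _ _)
    ( (λ e → R-irrefl (subst (R x) (sym (vertex-injective e)) xy))
    , subst₂ Lifted (sym (splitAt-↑ˡ c (from x) r)) (sym (splitAt-↑ˡ c (from y) r))
        (subst₂ R (sym (strictlyInverseˡ x)) (sym (strictlyInverseˡ y)) xy))

  Adj-realisation : ∀ {i j} → Adj realisation i j → ∃[ x ] ∃[ y ] vertex x ≡ i × vertex y ≡ j × R x y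
  Adj-realisation {i} {j} ij = back (splitAt c i) (splitAt c j) refl refl (proj₂ (Equivalence.to (Adj-fromRel adj? adj-sym i j) ij))
    where
    back : ∀ s t → splitAt c i ≡ s → splitAt c j ≡ t → Lifted s t → ∃[ x ] ∃[ y ] vertex x ≡ i × vertex y ≡ j × R x y
    back (inj₁ i′) (inj₁ j′) e e′ xy = to i′ , to j′ ,
      trans (cong (_↑ˡ r) (strictlyInverseʳ i′)) (splitAt⁻¹-↑ˡ e) ,
      trans (cong (_↑ˡ r) (strictlyInverseʳ j′)) (splitAt⁻¹-↑ˡ e′) , xy

  -- Every vertex of the walk has an edge to its successor, so none is isolated; that edge names the
  -- element of `S` behind it.
  walk-in-S : ∀ {a} → CyclicWalk (Adj realisation) a → CyclicWalk R a
  walk-in-S W = record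
    { at        = label
    ; step      = λ t → let (_ , y , p , q , xy) = Adj-realisation (W.step t)
                        in subst (R (label t)) (vertex-injective (trans q (sym (vertex-label (suc t))))) xy
    ; periodic  = λ t → vertex-injective (trans (vertex-label _) (trans (W.periodic t) (sym (vertex-label t))))
    ; injective = λ t d e → W.injective t d (trans (sym (vertex-label _)) (trans (cong vertex e) (vertex-label t)))
    }
    where
    module W = CyclicWalk W
    label : ℕ → S
    label t = proj₁ (Adj-realisation (W.step t))
    vertex-label : ∀ t → vertex (label t) ≡ W.at t
    vertex-label t = let (_ , _ , p , _) = Adj-realisation (W.step t) in p

  cycle⇒walk-in-S : ∀ {a} → 3 ≤ a → Contains realisation (C a) → CyclicWalk R a
  cycle⇒walk-in-S 3≤a = walk-in-S ∘ cycle⇒walk 3≤a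

  realisation-free : {A : Pred ℕ 0ℓ} → (∀ a → a ∈ A → 3 ≤ a) → (∀ {a} → a ∈ A → 3 ≤ a → ¬ CyclicWalk R a) →
                     Free (𝓒 A) realisation
  realisation-free 3≤A ¬walk _ _ (cycle {a} a∈A) contains =
    ¬walk a∈A (3≤A a a∈A) (cycle⇒walk-in-S (3≤A a a∈A) contains)

  record HexagonIn (t : S × S × S × S × S × S) : Set where
    s₀ = proj₁ t
    s₁ = proj₁ (proj₂ t)
    s₂ = proj₁ (proj₂ (proj₂ t))
    s₃ = proj₁ (proj₂ (proj₂ (proj₂ t)))
    s₄ = proj₁ (proj₂ (proj₂ (proj₂ (proj₂ t))))
    s₅ = proj₂ (proj₂ (proj₂ (proj₂ (proj₂ t))))
    field
      r₀₁ : R s₀ s₁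
      r₁₂ : R s₁ s₂
      r₂₃ : R s₂ s₃
      r₃₄ : R s₃ s₄
      r₄₅ : R s₄ s₅
      r₅₀ : R s₅ s₀
      s₀≢s₂ : s₀ ≢ s₂
      s₂≢s₄ : s₂ ≢ s₄
      s₄≢s₀ : s₄ ≢ s₀
      s₁≢s₃ : s₁ ≢ s₃
      s₃≢s₅ : s₃ ≢ s₅
      s₅≢s₁ : s₅ ≢ s₁
      s₀≢s₃ : s₀ ≢ s₃
      s₁≢s₄ : s₁ ≢ s₄
      s₂≢s₅ : s₂ ≢ s₅

  vertices : S × S × S × S × S × S → Hexagon (c + r)
  vertices (s₀ , s₁ , s₂ , s₃ , s₄ , s₅) = vertex s₀ , vertex s₁ , vertex s₂ , vertex s₃ , vertex s₄ , vertex s₅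

  vertices-injective : ∀ {s t} → vertices s ≡ vertices t → s ≡ t
  vertices-injective e =
    cong₂ _,_ (vertex-injective (cong proj₁ e)) (cong₂ _,_ (vertex-injective (cong (proj₁ ∘ proj₂) e))
      (cong₂ _,_ (vertex-injective (cong (proj₁ ∘ proj₂ ∘ proj₂) e)) (cong₂ _,_ (vertex-injective (cong (proj₁ ∘ proj₂ ∘ proj₂ ∘ proj₂) e))
        (cong₂ _,_ (vertex-injective (cong (proj₁ ∘ proj₂ ∘ proj₂ ∘ proj₂ ∘ proj₂) e)) (vertex-injective (cong (proj₂ ∘ proj₂ ∘ proj₂ ∘ proj₂ ∘ proj₂) e))))))

  isHexagon : ∀ {s₀ s₁ s₂ s₃ s₄ s₅} → HexagonIn (s₀ , s₁ , s₂ , s₃ , s₄ , s₅) →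
              IsHexagon realisation (vertices (s₀ , s₁ , s₂ , s₃ , s₄ , s₅))
  isHexagon h = hexagon (Adj-vertex r₀₁) (Adj-vertex r₁₂) (Adj-vertex r₂₃) (Adj-vertex r₃₄) (Adj-vertex r₄₅) (Adj-vertex r₅₀)
    (s₀≢s₂ ∘ vertex-injective) (s₂≢s₄ ∘ vertex-injective) (s₄≢s₀ ∘ vertex-injective)
    (s₁≢s₃ ∘ vertex-injective) (s₃≢s₅ ∘ vertex-injective) (s₅≢s₁ ∘ vertex-injective)
    (s₀≢s₃ ∘ vertex-injective) (s₁≢s₄ ∘ vertex-injective) (s₂≢s₅ ∘ vertex-injective)
    where open HexagonIn h

  module _ {N : ℕ} {I : Set} (indices : Fin N ↔ I) (h : I → S × S × S × S × S × S)
           (h-injective : ∀ {i j} → h i ≡ h j → i ≡ j)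
           (h-hexagon : ∀ i → HexagonIn (h i)) where

    private
      module I = Inverse indices

      member : Fin N → Hexagon (c + r)
      member i = vertices (h (I.to i))

      member-injective : ∀ {i j} → member i ≡ member j → i ≡ j
      member-injective {i} {j} e = trans (sym (I.strictlyInverseʳ i))
        (trans (cong I.from (h-injective (vertices-injective e))) (I.strictlyInverseʳ j))

      members : List (Hexagon (c + r))
      members = map member (allFin N)

      members-hexagons : ∀ {t} → t List.∈ members → IsHexagon realisation t
      members-hexagons t∈ = let (i , _ , e) = ∈-map⁻ member t∈ in subst (IsHexagon realisation) (sym e) (isHexagon (h-hexagon (I.to i)))

      members-≤ : length members ≤ copies (C 6) realisation * labellings
      members-≤ = ≲⇒length-≤ {P = IsHexagon realisation} (Unique.map⁺ member-injective (Unique.allFin⁺ N)) members-hexagons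
                    (hexagons-≲-copies {G = realisation})

      members-length : length members ≡ N
      members-length = trans (length-map member (allFin N)) (length-tabulate id)

    family-many : {A : Pred ℕ 0ℓ} → (∀ a → a ∈ A → 3 ≤ a) → (∀ {a} → a ∈ A → 3 ≤ a → ¬ CyclicWalk R a) →
                  ManyHexagons A N (c + r)
    family-many 3≤A ¬walk = realisation , realisation-free 3≤A ¬walk , ≤-trans (≤-reflexive (sym members-length)) members-≤

module _ {S : Set} {R : Rel S 0ℓ} (colour : S → Bool) (alternates : ∀ {x y} → R x y → colour y ≡ not (colour x))
         {a : ℕ} (W : CyclicWalk R a) where

  open CyclicWalk W

  colour-2+ : ∀ t → colour (at (2 + t)) ≡ colour (at t)
  colour-2+ t = trans (alternates (step (suc t))) (trans (cong not (alternates (step t))) (not-involutive _))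

  bipartite⇒even : 2 ∣ a
  bipartite⇒even = [ proj₁ , (λ (_ , odd) → contradiction odd (not-¬ (cong colour (periodic 0)))) ]′ (parity-at a)
    where
    parity-at : ∀ t → (2 ∣ t × colour (at t) ≡ colour (at 0)) ⊎ (2 ∣ suc t × colour (at t) ≡ not (colour (at 0)))
    parity-at 0       = inj₁ (2 ∣0 , refl)
    parity-at (suc t) with parity-at t
    ... | inj₁ (2∣t , e)   = inj₂ (∣m∣n⇒∣m+n ∣-refl 2∣t , trans (alternates (step t)) (cong not e))
    ... | inj₂ (2∣1+t , e) = inj₁ (2∣1+t , trans (alternates (step t)) (trans (cong not e) (not-involutive _)))

-- Bicliques and theta graphs

module Biclique (p q : ℕ) where

  -- Each side consists of three blocks. A hexagon with one vertex from every block has distinct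
  -- vertices automatically, which gives p³q³ of them; for `p` equal to 1 the left side has size
  -- three.
  Parts : Set
  Parts = (Fin 3 × Fin p) ⊎ (Fin 3 × Fin q)

  Across : Rel Parts 0ℓ
  Across (inj₁ _) (inj₂ _) = ⊤
  Across (inj₂ _) (inj₁ _) = ⊤
  Across _        _        = ⊥

  across? : Decidable₂ Across
  across? (inj₁ _) (inj₂ _) = yes tt
  across? (inj₂ _) (inj₁ _) = yes tt
  across? (inj₁ _) (inj₁ _) = no λ ()
  across? (inj₂ _) (inj₂ _) = no λ ()

  across-sym : Symmetric Across
  across-sym {inj₁ _} {inj₂ _} _ = tt
  across-sym {inj₂ _} {inj₁ _} _ = tt

  across-irrefl : ∀ {x} → ¬ Across x x
  across-irrefl {inj₁ _} ()
  across-irrefl {inj₂ _} ()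

  side : Parts → Bool
  side (inj₁ _) = true
  side (inj₂ _) = false

  across-alternates : ∀ {x y} → Across x y → side y ≡ not (side x)
  across-alternates {inj₁ _} {inj₂ _} _ = refl
  across-alternates {inj₂ _} {inj₁ _} _ = refl

  enum : Fin (3 * p + 3 * q) ↔ Parts
  enum = (*↔× ⊎-↔ *↔×) ↔-∘ +↔⊎

  biclique-many : {A : Pred ℕ 0ℓ} → (∀ a → a ∈ A → 3 ≤ a) → (∀ {a} → a ∈ A → 3 ≤ a → ¬ CyclicWalk Across a) →
                  ∀ r → ManyHexagons A (p * (q * (p * (q * (p * q))))) (3 * p + 3 * q + r)
  biclique-many 3≤A ¬walk r = family-many
      ((↔-id _ ×-↔ (↔-id _ ×-↔ (↔-id _ ×-↔ (↔-id _ ×-↔ *↔×) ↔-∘ *↔×) ↔-∘ *↔×) ↔-∘ *↔×) ↔-∘ *↔×)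
      (λ (i , a , j , b , k , d) → inj₁ (0F , i) , inj₂ (0F , a) , inj₁ (1F , j) , inj₂ (1F , b) , inj₁ (2F , k) , inj₂ (2F , d))
      (λ { refl → refl })
      (λ _ → record
        { r₀₁ = tt ; r₁₂ = tt ; r₂₃ = tt ; r₃₄ = tt ; r₄₅ = tt ; r₅₀ = tt
        ; s₀≢s₂ = λ () ; s₂≢s₄ = λ () ; s₄≢s₀ = λ () ; s₁≢s₃ = λ () ; s₃≢s₅ = λ () ; s₅≢s₁ = λ ()
        ; s₀≢s₃ = λ () ; s₁≢s₄ = λ () ; s₂≢s₅ = λ () })
      3≤A ¬walk
    where open Realise enum across? (λ {x} {y} → across-sym {x} {y}) (λ {x} → across-irrefl {x}) r

3≤even≤6 : ∀ {a} → 3 ≤ a → a ≤ 6 → 2 ∣ a → a ≡ 4 ⊎ a ≡ 6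
3≤even≤6 {3} _ _ 2∣3 = contradiction 2∣3 (toWitnessFalse {a? = 2 ∣? 3} tt)
3≤even≤6 {4} _ _ _   = inj₁ refl
3≤even≤6 {5} _ _ 2∣5 = contradiction 2∣5 (toWitnessFalse {a? = 2 ∣? 5} tt)
3≤even≤6 {6} _ _ _   = inj₂ refl
3≤even≤6 {suc (suc (suc (suc (suc (suc (suc _))))))} _ (s≤s (s≤s (s≤s (s≤s (s≤s (s≤s ())))))) _
3≤even≤6 {0} () _ _
3≤even≤6 {1} (s≤s ()) _ _
3≤even≤6 {2} (s≤s (s≤s ())) _ _

-- A cycle with 2m vertices meets the part of size three in m vertices.
biclique-walk : ∀ {q a} → 3 ≤ a → CyclicWalk (Biclique.Across 1 q) a → a ≡ 4 ⊎ a ≡ 6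
biclique-walk {q} {a} 3≤a W = 3≤even≤6 3≤a a≤6 (bipartite⇒even side (λ {x} {y} → across-alternates {x} {y}) W)
  where
  open Biclique 1 q using (Across; Parts; side; across-alternates)

  hub : ∀ x → side x ≡ true → Fin 3
  hub (inj₁ (h , _)) _ = h

  hub-injective : ∀ {x y} (ex : side x ≡ true) (ey : side y ≡ true) → hub x ex ≡ hub y ey → x ≡ y
  hub-injective {inj₁ (h , 0F)} {inj₁ (h′ , 0F)} _ _ refl = refl

  from-hub : (W : CyclicWalk Across a) → side (CyclicWalk.at W 0) ≡ true → a ≤ 6
  from-hub W e =
    -- The walk is on the side of size three at positions 0, 2, 4 and 6. Two of these coincide, and
    -- `a` divides their distance, which is positive and at most 6.
    let (i , j , i<j , same) = pigeonhole {3} {4} (s≤s (s≤s (s≤s (s≤s z≤n)))) (λ i → hub (at (toℕ i * 2)) (hub-at (toℕ i)))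
        gap = toℕ j ∸ toℕ i
    in ≤-trans (∣⇒≤ {{>-nonZero (*-mono-≤ (m<n⇒0<n∸m i<j) (s≤s (z≤n {1})))}}
         (injective (toℕ i * 2) (gap * 2) (trans
           (cong at (trans (sym (*-distribʳ-+ 2 (toℕ i) gap)) (cong (_* 2) (m+[n∸m]≡n (<⇒≤ i<j)))))
           (sym (hub-injective (hub-at (toℕ i)) (hub-at (toℕ j)) same)))))
         (*-monoˡ-≤ 2 (≤-trans (m∸n≤m (toℕ j) (toℕ i)) (s≤s⁻¹ (toℕ<n j))))
    where
    open CyclicWalk W
    hub-at : ∀ i → side (at (i * 2)) ≡ true
    hub-at zero    = e
    hub-at (suc i) = trans (colour-2+ side (λ {x} {y} → across-alternates {x} {y}) W (i * 2)) (hub-at i)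

  a≤6 : a ≤ 6
  a≤6 = by-side (side (at 0)) refl
    where
    open CyclicWalk W
    by-side : ∀ s → side (at 0) ≡ s → a ≤ 6
    by-side true  e = from-hub W e
    by-side false e = from-hub (shift 1) (trans (across-alternates {at 0} (step 0)) (cong not e))

-- Two hubs joined by 2m paths of length three.
module Theta (m : ℕ) where

  -- Two groups of arms: a hexagon uses one arm from each, so its arms differ without further
  -- hypotheses.
  Arm : Set
  Arm = Fin 2 × Fin m

  Node : Set
  Node = Bool ⊎ (Bool × Arm)

  Edge : Rel Node 0ℓ
  Edge (inj₁ _)       (inj₁ _)       = ⊥
  Edge (inj₁ h)       (inj₂ (s , _)) = h ≡ s
  Edge (inj₂ (s , _)) (inj₁ h)       = h ≡ s
  Edge (inj₂ (s , x)) (inj₂ (t , y)) = t ≡ not s × x ≡ y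

  edge? : Decidable₂ Edge
  edge? (inj₁ _)       (inj₁ _)       = no λ ()
  edge? (inj₁ h)       (inj₂ (s , _)) = h ≟ᵇ s
  edge? (inj₂ (s , _)) (inj₁ h)       = h ≟ᵇ s
  edge? (inj₂ (s , x)) (inj₂ (t , y)) = (t ≟ᵇ not s) ×-dec ≡-dec _≟ᶠ_ _≟ᶠ_ x y

  edge-sym : Symmetric Edge
  edge-sym {inj₁ _} {inj₂ _} e = e
  edge-sym {inj₂ _} {inj₁ _} e = e
  edge-sym {inj₂ _} {inj₂ _} (refl , refl) = sym (not-involutive _) , refl

  edge-irrefl : ∀ {x} → ¬ Edge x x
  edge-irrefl {inj₂ (s , _)} (e , _) = not-¬ refl e

  enum : Fin (2 + 2 * (2 * m)) ↔ Node
  enum = (2↔Bool ⊎-↔ ((2↔Bool ×-↔ *↔×) ↔-∘ *↔×)) ↔-∘ +↔⊎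

  theta-many : {A : Pred ℕ 0ℓ} → (∀ a → a ∈ A → 3 ≤ a) → (∀ {a} → a ∈ A → 3 ≤ a → ¬ CyclicWalk Edge a) →
               ∀ r → ManyHexagons A (m * m) (2 + 2 * (2 * m) + r)
  theta-many 3≤A ¬walk r = family-many *↔×
      (λ (i , j) → inj₁ false , inj₂ (false , 0F , i) , inj₂ (true , 0F , i) , inj₁ true , inj₂ (true , 1F , j) , inj₂ (false , 1F , j))
      (λ { refl → refl })
      (λ _ → record
        { r₀₁ = refl ; r₁₂ = refl , refl ; r₂₃ = refl ; r₃₄ = refl ; r₄₅ = refl , refl ; r₅₀ = refl
        ; s₀≢s₂ = λ () ; s₂≢s₄ = λ () ; s₄≢s₀ = λ () ; s₁≢s₃ = λ () ; s₃≢s₅ = λ () ; s₅≢s₁ = λ ()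
        ; s₀≢s₃ = λ () ; s₁≢s₄ = λ () ; s₂≢s₅ = λ () })
      3≤A ¬walk
    where open Realise enum edge? (λ {x} {y} → edge-sym {x} {y}) (λ {x} → edge-irrefl {x}) r

  from-hub : ∀ {h y} → Edge (inj₁ h) y → ∃[ x ] y ≡ inj₂ (h , x)
  from-hub {y = inj₂ (_ , x)} refl = x , refl

  from-arm : ∀ {s x y} → Edge (inj₂ (s , x)) y → y ≡ inj₁ s ⊎ y ≡ inj₂ (not s , x)
  from-arm {y = inj₁ _} refl          = inj₁ refl
  from-arm {y = inj₂ _} (refl , refl) = inj₂ refl

  module _ {a : ℕ} (3≤a : 3 ≤ a) where

    module FromHub (W : CyclicWalk Edge a) where

      open CyclicWalk W

      leave : ∀ t {h} → at t ≡ inj₁ h → ∃[ x ] at (suc t) ≡ inj₂ (h , x)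
      leave t e = from-hub (subst (λ n → Edge n (at (suc t))) e (step t))

      along : ∀ t {s x} → at t ≡ inj₂ (s , x) → at (suc t) ≡ inj₁ s ⊎ at (suc t) ≡ inj₂ (not s , x)
      along t e = from-arm (subst (λ n → Edge n (at (suc t))) e (step t))

      -- A walk that cannot turn back has to follow the arm it entered up to the other hub. Two
      -- crossings return to the start, so the period divides 6.
      cross : ∀ t {h} → at t ≡ inj₁ h → at (3 + t) ≡ inj₁ (not h)
      cross t {h} e with leave t e
      ... | x , e₁ with along (1 + t) e₁
      ... | inj₁ back = contradiction (trans back (sym e)) (no-backtrack 3≤a t)
      ... | inj₂ e₂ with along (2 + t) e₂
      ... | inj₁ e₃ = e₃
      ... | inj₂ back = contradiction (trans back (trans (cong (λ s → inj₂ (s , x)) (not-involutive h)) (sym e₁))) (no-backtrack 3≤a (1 + t))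

      period : ∀ {h} → at 0 ≡ inj₁ h → a ≡ 6
      period {h} e = only-6 3≤a (∣⇒≤ a∣6) a∣6 refl
        where
        a∣6 : a ∣ 6
        a∣6 = injective 0 6 (trans (cross 3 (cross 0 e)) (trans (cong inj₁ (not-involutive h)) (sym e)))
        only-6 : ∀ {b} → 3 ≤ b → b ≤ 6 → b ∣ 6 → a ≡ b → b ≡ 6
        -- Period 3 would identify the two hubs.
        only-6 {3} _ _ _ refl = contradiction (trans (sym (cross 0 e)) (trans (periodic 0) e)) λ e′ → not-¬ refl (sym (inj₁-injective e′))
        only-6 {4} _ _ 4∣6 _  = contradiction 4∣6 (toWitnessFalse {a? = 4 ∣? 6} tt)
        only-6 {5} _ _ 5∣6 _  = contradiction 5∣6 (toWitnessFalse {a? = 5 ∣? 6} tt)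
        only-6 {6} _ _ _ _    = refl
        only-6 {suc (suc (suc (suc (suc (suc (suc _))))))} _ (s≤s (s≤s (s≤s (s≤s (s≤s (s≤s ())))))) _ _
        only-6 {0} () _ _ _
        only-6 {1} (s≤s ()) _ _ _
        only-6 {2} (s≤s (s≤s ())) _ _ _

    theta-walk : CyclicWalk Edge a → a ≡ 6
    theta-walk W = from-node (at 0) refl
      where
      open CyclicWalk W
      open FromHub using (period)
      open FromHub W using (along)
      from-node : ∀ x → at 0 ≡ x → a ≡ 6
      from-node (inj₁ _) e = period W e
      from-node (inj₂ (s , x)) e with along 0 e
      ... | inj₁ e₁ = period (shift 1) e₁
      ... | inj₂ e₁ with along 1 e₁
      ... | inj₁ e₂ = period (shift 2) e₂
      ... | inj₂ e₂ = contradiction (trans e₂ (trans (cong (λ s → inj₂ (s , x)) (not-involutive s)) (sym e))) (no-backtrack 3≤a 0)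

-- A prime between 4^g and 4^(g+2)

n-choose-0 : ∀ n → n choose 0 ≡ 1
n-choose-0 n = trans (nCk≡nC[n∸k] {0} {n} z≤n) (nCn≡1 n)

absorption : ∀ n k → suc k * (suc n choose suc k) ≡ suc n * (n choose k)
absorption zero zero = refl
absorption zero (suc k) = trans (cong (suc (suc k) *_) (k>n⇒nCk≡0 {1} (s≤s (s≤s (z≤n {k})))))
  (trans (*-zeroʳ (suc (suc k))) (sym (cong (1 *_) (k>n⇒nCk≡0 {0} (s≤s (z≤n {k}))))))
absorption (suc n) zero = begin
  1 * (suc (suc n) choose 1)                          ≡⟨ cong (1 *_) (nCk+nC[k+1]≡[n+1]C[k+1] (suc n) 0) ⟨
  1 * ((suc n choose 0) + (suc n choose 1))           ≡⟨ *-distribˡ-+ 1 (suc n choose 0) _ ⟩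
  1 * (suc n choose 0) + 1 * (suc n choose 1)         ≡⟨ cong₂ _+_ (cong (1 *_) (n-choose-0 (suc n))) (absorption n 0) ⟩
  1 + suc n * (n choose 0)                            ≡⟨ cong (λ t → 1 + suc n * t) (n-choose-0 n) ⟩
  1 + suc n * 1                                       ≡⟨ cong (λ t → t + suc n * t) (n-choose-0 (suc n)) ⟨
  (suc n choose 0) + suc n * (suc n choose 0)         ∎
  where open ≡-Reasoning
absorption (suc n) (suc k) = begin
  (2 + k) * (suc (suc n) choose suc (suc k))          ≡⟨ cong ((2 + k) *_) (nCk+nC[k+1]≡[n+1]C[k+1] (suc n) (suc k)) ⟨
  (2 + k) * (a + b)
    ≡⟨ solve 3 (λ k a b → (con 2 :+ k) :* (a :+ b) := a :+ ((con 1 :+ k) :* a :+ (con 2 :+ k) :* b)) refl k a b ⟩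
  a + (suc k * a + (2 + k) * b)                       ≡⟨ cong (a +_) (cong₂ _+_ (absorption n k) (absorption n (suc k))) ⟩
  a + (suc n * (n choose k) + suc n * (n choose suc k)) ≡⟨ cong (a +_) (*-distribˡ-+ (suc n) (n choose k) _) ⟨
  a + suc n * ((n choose k) + (n choose suc k))       ≡⟨ cong (λ t → a + suc n * t) (nCk+nC[k+1]≡[n+1]C[k+1] n k) ⟩
  suc (suc n) * a                                     ∎
  where
  open ≡-Reasoning
  open +-*-Solver
  a = suc n choose suc k
  b = suc n choose suc (suc k)

choose-ratio : ∀ k d → suc k * (suc (k + d) choose suc k) ≡ suc d * (suc (k + d) choose k)
choose-ratio k d = +-cancelˡ-≡ (suc k * c) _ _ (begin
  suc k * c + suc k * b            ≡⟨ *-distribˡ-+ (suc k) c b ⟨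
  suc k * (c + b)                  ≡⟨ cong (suc k *_) (nCk+nC[k+1]≡[n+1]C[k+1] (suc (k + d)) k) ⟩
  suc k * (suc (suc (k + d)) choose suc k) ≡⟨ absorption (suc (k + d)) k ⟩
  suc (suc (k + d)) * c            ≡⟨ solve 3 (λ k d c → (con 2 :+ (k :+ d)) :* c := (con 1 :+ k) :* c :+ (con 1 :+ d) :* c) refl k d c ⟩
  suc k * c + suc d * c            ∎)
  where
  open ≡-Reasoning
  open +-*-Solver
  c = suc (k + d) choose k
  b = suc (k + d) choose suc k

choose-≤-2^ : ∀ n k → n choose k ≤ 2 ^ n
choose-≤-2^ n       zero    = ≤-trans (≤-reflexive (n-choose-0 n)) (m^n>0 2 n)
choose-≤-2^ zero    (suc k) = ≤-trans (≤-reflexive (k>n⇒nCk≡0 {0} (s≤s (z≤n {k})))) z≤n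
choose-≤-2^ (suc n) (suc k) = begin
  suc n choose suc k                ≡⟨ nCk+nC[k+1]≡[n+1]C[k+1] n k ⟨
  (n choose k) + (n choose suc k)   ≤⟨ +-mono-≤ (choose-≤-2^ n k) (choose-≤-2^ n (suc k)) ⟩
  2 ^ n + 2 ^ n                     ≡⟨ cong (2 ^ n +_) (+-identityʳ (2 ^ n)) ⟨
  2 ^ suc n                         ∎
  where open ≤-Reasoning

-- The coefficient is the product of (n + i) / i for i from 1 to k, and every factor is at least 2
-- because i ≤ n.
2^-≤-choose : ∀ n k → k ≤ n → 2 ^ k ≤ (n + k) choose k
2^-≤-choose n zero    _   = ≤-reflexive (sym (n-choose-0 (n + 0)))
2^-≤-choose n (suc k) k<n = *-cancelˡ-≤ (suc k) (begin
  suc k * (2 * 2 ^ k)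
    ≡⟨ solve 2 (λ k t → (con 1 :+ k) :* (con 2 :* t) := ((con 1 :+ k) :+ (con 1 :+ k)) :* t) refl k (2 ^ k) ⟩
  (suc k + suc k) * 2 ^ k                ≤⟨ *-mono-≤ (+-monoˡ-≤ (suc k) k<n) (2^-≤-choose n k (<⇒≤ k<n)) ⟩
  (n + suc k) * ((n + k) choose k)       ≡⟨ cong (_* ((n + k) choose k)) (+-suc n k) ⟩
  suc (n + k) * ((n + k) choose k)       ≡⟨ absorption (n + k) k ⟨
  suc k * (suc (n + k) choose suc k)     ≡⟨ cong (λ t → suc k * (t choose suc k)) (+-suc n k) ⟨
  suc k * ((n + suc k) choose suc k)     ∎)
  where
  open ≤-Reasoning
  open +-*-Solver

-- Leibniz's harmonic triangle: with L(m,k) = 1 / ((m+1) C(m,k)) one has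
-- L(m+1,k+1) = L(m,k) − L(m+1,k), so a common multiple of 1,…,M clears all
-- denominators of the first M rows.
leibniz : ∀ {D M} → (∀ m → suc m ≤ M → suc m ∣ D) →
          ∀ k d → suc (k + d) ≤ M → suc (k + d) * ((k + d) choose k) ∣ D
leibniz {D} clears zero d ≤M =
  subst (_∣ D) (sym (trans (cong (suc d *_) (n-choose-0 d)) (*-identityʳ (suc d)))) (clears d ≤M)
leibniz {D} {M} clears (suc k) d ≤M =
  ∣m+n∣m⇒∣n (subst (E ∣_) (trans Eq₂≡ (+-comm D (E * q₁))) (m∣m*n q₂)) (m∣m*n q₁)
  where
  a = (k + d) choose k
  c = suc (k + d) choose k
  B = suc (k + d) choose suc k
  E = suc (suc (k + d)) * B
  div₁ : suc (suc (k + d)) * c ∣ D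
  div₁ = subst (λ t → suc t * (t choose k) ∣ D) (+-suc k d)
           (leibniz clears k (suc d) (subst (λ t → suc t ≤ M) (sym (+-suc k d)) ≤M))
  div₂ : suc (k + d) * a ∣ D
  div₂ = leibniz clears k d (<⇒≤ ≤M)
  q₁ = quotient div₁
  q₂ = quotient div₂
  open ≡-Reasoning
  open +-*-Solver
  eq₁ : suc k * (E * q₁) ≡ suc d * D
  eq₁ = begin
    suc k * (suc (suc (k + d)) * B * q₁)
      ≡⟨ solve 4 (λ k n B q → k :* (n :* B :* q) := (k :* B) :* (n :* q)) refl (suc k) (suc (suc (k + d))) B q₁ ⟩
    suc k * B * (suc (suc (k + d)) * q₁)       ≡⟨ cong (_* (suc (suc (k + d)) * q₁)) (choose-ratio k d) ⟩
    suc d * c * (suc (suc (k + d)) * q₁)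
      ≡⟨ solve 4 (λ d n c q → d :* c :* (n :* q) := d :* (q :* (n :* c))) refl (suc d) (suc (suc (k + d))) c q₁ ⟩
    suc d * (q₁ * (suc (suc (k + d)) * c))     ≡⟨ cong (suc d *_) (_∣_.equality div₁) ⟨
    suc d * D                                  ∎
  eq₂ : suc k * (E * q₂) ≡ suc (suc (k + d)) * D
  eq₂ = begin
    suc k * (suc (suc (k + d)) * B * q₂)
      ≡⟨ solve 4 (λ k n B q → k :* (n :* B :* q) := (k :* B) :* (n :* q)) refl (suc k) (suc (suc (k + d))) B q₂ ⟩
    suc k * B * (suc (suc (k + d)) * q₂)       ≡⟨ cong (_* (suc (suc (k + d)) * q₂)) (absorption (k + d) k) ⟩
    suc (k + d) * a * (suc (suc (k + d)) * q₂)
      ≡⟨ solve 4 (λ d n c q → d :* c :* (n :* q) := n :* (q :* (d :* c))) refl (suc (k + d)) (suc (suc (k + d))) a q₂ ⟩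
    suc (suc (k + d)) * (q₂ * (suc (k + d) * a)) ≡⟨ cong (suc (suc (k + d)) *_) (_∣_.equality div₂) ⟨
    suc (suc (k + d)) * D                      ∎
  -- With m = k + d, the quotients `q₂` and `q₁` are D·L(m,k) and D·L(m+1,k), and 1/E is L(m+1,k+1).
  -- The triangle identity times D·E thus exhibits D as a difference of multiples of E.
  Eq₂≡ : E * q₂ ≡ D + E * q₁
  Eq₂≡ = *-cancelˡ-≡ _ _ (suc k) (begin
    suc k * (E * q₂)           ≡⟨ eq₂ ⟩
    suc (suc (k + d)) * D      ≡⟨ solve 3 (λ k d D → (con 2 :+ (k :+ d)) :* D := (con 1 :+ k) :* D :+ (con 1 :+ d) :* D) refl k d D ⟩
    suc k * D + suc d * D      ≡⟨ cong (suc k * D +_) eq₁ ⟨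
    suc k * D + suc k * (E * q₁) ≡⟨ *-distribˡ-+ (suc k) D (E * q₁) ⟨
    suc k * (D + E * q₁)       ∎)

-- By absorption, `suc k` times the middle coefficient is a denominator in row 2k + 1 of the
-- triangle.
middle-choose-∣ : ∀ {D M} → (∀ m → suc m ≤ M → suc m ∣ D) →
                  ∀ k → suc k + suc k ≤ M → (suc k + suc k) choose suc k ∣ D
middle-choose-∣ {D} clears k ≤M = ∣-trans (∣n⇒∣m*n (suc k) ∣-refl)
  (subst (_∣ D) (sym (absorption (k + suc k) k)) (leibniz clears k (suc k) ≤M))

primePart : ℕ → ℕ
primePart n with prime? n
... | yes _ = n
... | no  _ = 1

-- The primes are those in the half-open interval (m , m + k].
primeProduct : ℕ → ℕ → ℕ
primeProduct m zero    = 1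
primeProduct m (suc k) = primePart (m + suc k) * primeProduct m k

primeProduct-+ : ∀ m k l → primeProduct m (k + l) ≡ primeProduct (m + k) l * primeProduct m k
primeProduct-+ m k zero    = trans (cong (primeProduct m) (+-identityʳ k)) (sym (*-identityˡ _))
primeProduct-+ m k (suc l) = begin
  primeProduct m (k + suc l)                                       ≡⟨ cong (primeProduct m) (+-suc k l) ⟩
  primePart (m + suc (k + l)) * primeProduct m (k + l)
    ≡⟨ cong₂ _*_ (cong primePart (trans (cong (m +_) (sym (+-suc k l))) (sym (+-assoc m k (suc l))))) (primeProduct-+ m k l) ⟩
  primePart (m + k + suc l) * (primeProduct (m + k) l * primeProduct m k) ≡⟨ *-assoc (primePart (m + k + suc l)) _ _ ⟨
  primeProduct (m + k) (suc l) * primeProduct m k                  ∎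
  where open ≡-Reasoning

prime∤1 : Prime p → ¬ (p ∣ 1)
prime∤1 {p} pr p∣1 = <⇒≱ (nonTrivial⇒n>1 p {{prime⇒nonTrivial pr}}) (∣⇒≤ p∣1)

prime∣primeProduct⇒≤ : Prime p → ∀ m k → p ∣ primeProduct m k → p ≤ m + k
prime∣primeProduct⇒≤ pr m zero    p∣ = contradiction p∣ (prime∤1 pr)
prime∣primeProduct⇒≤ pr m (suc k) p∣ with prime? (m + suc k) | euclidsLemma (primePart (m + suc k)) _ pr p∣
... | yes q | inj₁ p∣q = ∣⇒≤ {{prime⇒nonZero q}} p∣q
... | no  _ | inj₁ p∣1 = contradiction p∣1 (prime∤1 pr)
... | _     | inj₂ p∣P = ≤-trans (prime∣primeProduct⇒≤ pr m k p∣P) (+-monoʳ-≤ m (n≤1+n k))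

prime-*-∣ : ∀ {P X} → Prime p → ¬ (p ∣ P) → P ∣ X → p ∣ X → p * P ∣ X
prime-*-∣ {p} {P} pr p∤P (divides q refl) p∣X with euclidsLemma q P pr p∣X
... | inj₁ p∣q = *-monoˡ-∣ P p∣q
... | inj₂ p∣P = contradiction p∣P p∤P

-- The primes already collected are smaller than the next one, so it does not divide their product
-- and can be multiplied on.
primeProduct-∣ : ∀ {X} m k → (∀ p → Prime p → m < p → p ≤ m + k → p ∣ X) → primeProduct m k ∣ X
primeProduct-∣ m zero    _ = 1∣ _
primeProduct-∣ {X} m (suc k) f with prime? (m + suc k)
... | yes pr = prime-*-∣ pr (λ p∣ → <⇒≱ (+-monoʳ-< m (n<1+n k)) (prime∣primeProduct⇒≤ pr m k p∣)) rest
                 (f (m + suc k) pr (m<m+n m (s≤s z≤n)) ≤-refl)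
  where rest = primeProduct-∣ m k λ p pr m<p p≤ → f p pr m<p (≤-trans p≤ (+-monoʳ-≤ m (n≤1+n k)))
... | no _   = subst (_∣ X) (sym (*-identityˡ _))
                 (primeProduct-∣ m k λ p pr m<p p≤ → f p pr m<p (≤-trans p≤ (+-monoʳ-≤ m (n≤1+n k))))

∣-primeProduct : ∀ {p} → Prime p → ∀ m k → m < p → p ≤ m + k → p ∣ primeProduct m k
∣-primeProduct pr m zero    m<p p≤ = contradiction (subst (_ ≤_) (+-identityʳ m) p≤) (<⇒≱ m<p)
∣-primeProduct {p} pr m (suc k) m<p p≤ with p ≟ m + suc k
... | yes refl = ∣m⇒∣m*n _ (self pr)
  where
  self : ∀ {p} → Prime p → p ∣ primePart p
  self {p} pr with prime? p
  ... | yes _ = ∣-refl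
  ... | no ¬p = contradiction pr ¬p
... | no  p≢   = ∣n⇒∣m*n (primePart (m + suc k))
                   (∣-primeProduct pr m k m<p (s≤s⁻¹ (subst (p <_) (+-suc m k) (≤∧≢⇒< p≤ p≢))))

prime∣!⇒≤ : Prime p → ∀ n → p ∣ n ! → p ≤ n
prime∣!⇒≤ pr zero    p∣ = contradiction p∣ (prime∤1 pr)
prime∣!⇒≤ pr (suc n) p∣ with euclidsLemma (suc n) (n !) pr p∣
... | inj₁ p∣1+n = ∣⇒≤ p∣1+n
... | inj₂ p∣n!  = m≤n⇒m≤1+n (prime∣!⇒≤ pr n p∣n!)

∣! : ∀ {m n} → 1 ≤ m → m ≤ n → m ∣ n !
∣! {suc m} _ m≤n = ∣-trans (m∣m*n (m !)) (m≤n⇒m!∣n! m≤n)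

prime∣middle-choose : ∀ m → Prime p → m < p → p ≤ m + m → p ∣ (m + m) choose m
prime∣middle-choose {p} m pr m<p p≤2m with euclidsLemma ((m + m) choose m) (m ! * (m + m ∸ m) !) pr
    (subst (p ∣_) (sym factorials) (∣! (≤-trans (s≤s z≤n) m<p) p≤2m))
  where
  m≤2m = m≤m+n m m
  instance _ = m !* (m + m ∸ m) !≢0
  factorials : ((m + m) choose m) * (m ! * (m + m ∸ m) !) ≡ (m + m) !
  factorials = trans (cong (_* (m ! * (m + m ∸ m) !)) (nCk≡n!/k![n-k]! m≤2m)) (m/n*n≡m (k![n∸k]!∣n! m≤2m))
... | inj₁ p∣c = p∣c
... | inj₂ p∣f with euclidsLemma (m !) _ pr p∣f
... | inj₁ p∣m! = contradiction (prime∣!⇒≤ pr m p∣m!) (<⇒≱ m<p)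
... | inj₂ p∣m! = contradiction (prime∣!⇒≤ pr m (subst (λ t → p ∣ t !) (m+n∸n≡m m m) p∣m!)) (<⇒≱ m<p)

-- Erdős's bound 4^n for the primorial: the primes in (N , 2N] divide the middle binomial
-- coefficient, which is at most 4^N. At powers of two the halving is exact.
primorial-≤ : ∀ j → primeProduct 0 (2 ^ j) ≤ 2 ^ (2 * 2 ^ j)
primorial-≤ zero    = s≤s z≤n
primorial-≤ (suc j) = begin
  primeProduct 0 (2 * N)                  ≡⟨ cong (primeProduct 0) 2N ⟩
  primeProduct 0 (N + N)                  ≡⟨ primeProduct-+ 0 N N ⟩
  primeProduct N N * primeProduct 0 N
    ≤⟨ *-mono-≤ (≤-trans (∣⇒≤ {{>-nonZero choose>0}} (primeProduct-∣ N N λ p → prime∣middle-choose N)) (choose-≤-2^ (N + N) N)) (primorial-≤ j) ⟩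
  2 ^ (N + N) * 2 ^ (2 * N)               ≡⟨ cong (λ t → 2 ^ t * 2 ^ (2 * N)) 2N ⟨
  2 ^ (2 * N) * 2 ^ (2 * N)               ≡⟨ ^-distribˡ-+-* 2 (2 * N) (2 * N) ⟨
  2 ^ (2 * N + 2 * N)                     ≡⟨ cong (λ t → 2 ^ (2 * N + t)) (+-identityʳ (2 * N)) ⟨
  2 ^ (2 * (2 * N))                       ∎
  where
  open ≤-Reasoning
  N = 2 ^ j
  2N : 2 * N ≡ N + N
  2N = cong (N +_) (+-identityʳ N)
  choose>0 : 0 < (N + N) choose N
  choose>0 = ≤-trans (m^n>0 2 N) (2^-≤-choose N N ≤-refl)

primeDivisor : ∀ {m} → 2 ≤ m → ∃[ p ] ∃[ q ] Prime p × m ≡ p * q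
primeDivisor {m@(suc _)} 2≤m with factorise m
... | record { factors = [] ; isFactorisation = refl } = contradiction 2≤m λ { (s≤s ()) }
... | record { factors = p ∷ ps ; isFactorisation = e ; factorsPrime = pr ∷ _ } = p , _ , pr , e

!-≤-^ : ∀ n → n ! ≤ n ^ n
!-≤-^ zero    = ≤-refl
!-≤-^ (suc n) = *-monoʳ-≤ (suc n) (≤-trans (!-≤-^ n) (^-monoˡ-≤ n (n≤1+n n)))

-- A number m ≤ s² has at most one prime factor above s, counted with
-- multiplicity, and the remaining ones, at most log₂ m of them, all divide s!.
∣-!^*primorial : ∀ s n → (∀ p → Prime p → p ≤ s * s → p ≤ n) →
                 ∀ i m → 1 ≤ m → m ≤ 2 ^ i → m ≤ s * s → m ∣ (s !) ^ i * primeProduct 0 n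
∣-!^*primorial s n primes≤n zero    m 1≤m m≤1 _ = subst (_∣ _) (≤-antisym 1≤m m≤1) (1∣ _)
∣-!^*primorial s n primes≤n (suc i) m 1≤m m≤2^ m≤s² with m ≤? s
... | yes m≤s = ∣m⇒∣m*n (primeProduct 0 n) (∣m⇒∣m*n ((s !) ^ i) (∣! 1≤m m≤s))
... | no  m≰s with m ≟ 1
... | yes refl = 1∣ _
... | no  m≢1 with primeDivisor (≤∧≢⇒< 1≤m (≢-sym m≢1))
... | p , q , pr , refl = by-size (p ≤? s)
  where
  instance _ = prime⇒nonZero pr
  Q = primeProduct 0 n
  1≤q : 1 ≤ q
  1≤q = n≢0⇒n>0 λ { refl → contradiction (subst (1 ≤_) (*-zeroʳ p) 1≤m) λ () }
  by-size : Dec (p ≤ s) → p * q ∣ (s !) ^ suc i * Q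
  by-size (yes p≤s) = subst (p * q ∣_) (sym (*-assoc (s !) ((s !) ^ i) Q))
    (*-pres-∣ (∣! (>-nonZero⁻¹ p) p≤s) (∣-!^*primorial s n primes≤n i q 1≤q
      (*-cancelˡ-≤ 2 (≤-trans (*-monoˡ-≤ q (nonTrivial⇒n>1 p {{prime⇒nonTrivial pr}})) m≤2^))
      (≤-trans (m≤n*m q p) m≤s²)))
  by-size (no p≰s) = subst (p * q ∣_) (*-comm Q ((s !) ^ suc i))
    (*-pres-∣ (∣-primeProduct pr 0 n (>-nonZero⁻¹ p) (primes≤n p pr (≤-trans (m≤m*n p q {{>-nonZero 1≤q}}) m≤s²)))
              (∣m⇒∣m*n ((s !) ^ i) (∣! 1≤q (<⇒≤ q<s))))
    where
    q<s : q < s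
    q<s = *-cancelˡ-< s q s (≤-<-trans (≤-trans (≤-reflexive (*-comm s q)) ≤-refl)
            (<-≤-trans (*-monoʳ-< q {{>-nonZero 1≤q}} (≰⇒> p≰s)) (≤-trans (≤-reflexive (*-comm q p)) m≤s²)))

-- The argument is shifted by 8, where the inequality reads 400 < 768. From there on a step at most
-- doubles the left side.
4[g+2]²<3*2^g : ∀ g → 4 * ((10 + g) * (10 + g)) < 3 * 2 ^ (8 + g)
4[g+2]²<3*2^g zero    = m≤m+n 401 367
4[g+2]²<3*2^g (suc g) = begin-strict
  4 * ((11 + g) * (11 + g))            ≤⟨ m≤m+n _ (4 * (g * g + 18 * g + 79)) ⟩
  4 * ((11 + g) * (11 + g)) + 4 * (g * g + 18 * g + 79)
    ≡⟨ solve 1 (λ g → con 4 :* ((con 11 :+ g) :* (con 11 :+ g)) :+ con 4 :* (g :* g :+ con 18 :* g :+ con 79) := con 2 :* (con 4 :* ((con 10 :+ g) :* (con 10 :+ g)))) refl g ⟩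
  2 * (4 * ((10 + g) * (10 + g)))      <⟨ *-monoʳ-< 2 (4[g+2]²<3*2^g g) ⟩
  2 * (3 * 2 ^ (8 + g))                ≡⟨ solve 1 (λ t → con 2 :* (con 3 :* t) := con 3 :* (con 2 :* t)) refl (2 ^ (8 + g)) ⟩
  3 * 2 ^ (9 + g)                      ∎
  where
  open ≤-Reasoning
  open +-*-Solver

-- Chebyshev's argument: if all primes up to 4^(g+2) were at most 4^g, then the
-- multiple (s!)^(2g+4) · primorial of the binomial coefficient (2N choose N),
-- 2N = s², would be smaller than 2^N, where s = 2^(g+2).
prime-between : ∀ g → 8 ≤ g → ∃[ p ] Prime p × 2 ^ (g + g) < p × p ≤ 2 ^ (2 + g) * 2 ^ (2 + g)
prime-between g 8≤g with anyUpTo? (λ p → prime? p ×-dec (2 ^ (g + g) <? p)) (suc (2 ^ (2 + g) * 2 ^ (2 + g)))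
... | yes (p , p<1+M , pr , n<p) = p , pr , n<p , s≤s⁻¹ p<1+M
... | no  none = contradiction N≤exponent (<⇒≱ exponent<N)
  where
  s = 2 ^ (2 + g)
  L = 2 ^ (g + g)
  N = 2 ^ (3 + (g + g))
  e = (2 + g) + (2 + g)
  D = (s !) ^ e * primeProduct 0 L
  s²≡ : s * s ≡ 2 ^ e
  s²≡ = sym (^-distribˡ-+-* 2 (2 + g) (2 + g))
  s²≡2N : s * s ≡ N + N
  s²≡2N = trans s²≡ (trans (cong (2 ^_) (solve 1 (λ g → (con 2 :+ g) :+ (con 2 :+ g) := con 1 :+ (con 3 :+ (g :+ g))) refl g))
                           (cong (N +_) (+-identityʳ N)))
    where open +-*-Solver

  -- `none` says that no prime up to s² exceeds `L`, so `primeProduct 0 L` contains all of them.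
  clears : ∀ m → suc m ≤ s * s → suc m ∣ D
  clears m m≤ = ∣-!^*primorial s L
    (λ p pr p≤ → ≮⇒≥ λ L<p → none (p , s≤s p≤ , pr , L<p))
    e (suc m) (s≤s z≤n) (≤-trans m≤ (≤-reflexive s²≡)) m≤

  middle-∣ : ∀ N → 1 ≤ N → N + N ≤ s * s → (N + N) choose N ∣ D
  middle-∣ (suc k) _ = middle-choose-∣ clears k

  D≢0 : NonZero D
  D≢0 = m*n≢0 _ _ {{m^n≢0 (s !) e {{s !≢0}}}} {{>-nonZero (primeProduct>0 0 L)}}
    where
    primePart>0 : ∀ m → 0 < primePart m
    primePart>0 m with prime? m
    ... | yes pr = >-nonZero⁻¹ m {{prime⇒nonZero pr}}
    ... | no  _  = s≤s z≤n
    primeProduct>0 : ∀ m k → 0 < primeProduct m k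
    primeProduct>0 m zero    = s≤s z≤n
    primeProduct>0 m (suc k) = *-mono-≤ (primePart>0 (m + suc k)) (primeProduct>0 m k)

  exponent = (2 + g) * s * e + 2 * L

  2^N≤2^exponent : 2 ^ N ≤ 2 ^ exponent
  2^N≤2^exponent = begin
    2 ^ N                                     ≤⟨ 2^-≤-choose N N ≤-refl ⟩
    (N + N) choose N                          ≤⟨ ∣⇒≤ {{D≢0}} (middle-∣ N (m^n>0 2 (3 + (g + g))) (≤-reflexive (sym s²≡2N))) ⟩
    (s !) ^ e * primeProduct 0 L              ≤⟨ *-mono-≤ (^-monoˡ-≤ e (!-≤-^ s)) (primorial-≤ (g + g)) ⟩
    (s ^ s) ^ e * 2 ^ (2 * L)                 ≡⟨ cong (λ t → t ^ e * 2 ^ (2 * L)) (^-*-assoc 2 (2 + g) s) ⟩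
    (2 ^ ((2 + g) * s)) ^ e * 2 ^ (2 * L)     ≡⟨ cong (_* 2 ^ (2 * L)) (^-*-assoc 2 ((2 + g) * s) e) ⟩
    2 ^ ((2 + g) * s * e) * 2 ^ (2 * L)       ≡⟨ ^-distribˡ-+-* 2 ((2 + g) * s * e) (2 * L) ⟨
    2 ^ exponent                              ∎
    where open ≤-Reasoning

  N≤exponent : N ≤ exponent
  N≤exponent = ≮⇒≥ λ exponent<N → <⇒≱ (^-monoʳ-< 2 (s≤s (s≤s z≤n)) exponent<N) 2^N≤2^exponent

  -- With T = 2^g the exponent is 8(g+2)²T + 2T², coming from s! ≤ s^s and the primorial bound,
  -- while N = 8T². What remains is 4(g+2)² < 3T, which is where `8 ≤ g` enters.
  exponent<N : exponent < N
  exponent<N = begin-strict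
    (2 + g) * (2 ^ (2 + g)) * e + 2 * L       ≡⟨ cong (λ t → (2 + g) * (2 ^ (2 + g)) * e + 2 * t) (^-distribˡ-+-* 2 g g) ⟩
    (2 + g) * (2 * (2 * T)) * e + 2 * (T * T)
      ≡⟨ solve 2 (λ g T → (con 2 :+ g) :* (con 2 :* (con 2 :* T)) :* ((con 2 :+ g) :+ (con 2 :+ g)) :+ con 2 :* (T :* T)
                                                    := con 2 :* (con 4 :* ((con 2 :+ g) :* (con 2 :+ g)) :* T) :+ con 2 :* (T :* T)) refl g T ⟩
    2 * (4 * ((2 + g) * (2 + g)) * T) + 2 * (T * T) <⟨ +-monoˡ-< (2 * (T * T)) (*-monoʳ-< 2 (*-monoˡ-< T {{m^n≢0 2 g}} square<)) ⟩
    2 * (3 * T * T) + 2 * (T * T)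
      ≡⟨ solve 1 (λ T → con 2 :* (con 3 :* T :* T) :+ con 2 :* (T :* T) := con 2 :* (con 2 :* (con 2 :* (T :* T)))) refl T ⟩
    2 * (2 * (2 * (T * T)))                   ≡⟨ cong (λ t → 2 * (2 * (2 * t))) (^-distribˡ-+-* 2 g g) ⟨
    N                                         ∎
    where
    open ≤-Reasoning
    open +-*-Solver
    T = 2 ^ g
    square< : 4 * ((2 + g) * (2 + g)) < 3 * T
    square< = subst (λ h → 4 * ((2 + h) * (2 + h)) < 3 * 2 ^ h) (m+[n∸m]≡n 8≤g) (4[g+2]²<3*2^g (g ∸ 8))

-- Incidence graphs of affine planes

open import Data.Integer using (ℤ; +_; ∣_∣)
  renaming (_+_ to _⊕_; _*_ to _⊛_; _-_ to _⊝_; -_ to neg)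
open import Data.Integer.Divisibility.Signed using (∣ᵤ⇒∣; ∣⇒∣ᵤ; ∣m∣n⇒∣m-n; ∣m⇒∣-m)
  renaming (_∣_ to _∣ℤ_; _∣?_ to _∣ℤ?_; divides to dividesℤ)
open import Data.Integer.DivMod using (_%ℕ_; _/ℕ_; n%ℕd<d; a≡a%ℕn+[a/ℕn]*n)
import Data.Integer.Properties as ℤ
import Data.Integer.Solver as ℤSolver

-- Points (x , y) and non-vertical lines y = a x + b of the affine plane over ℤ/p.
module Plane {p : ℕ} (p-prime : Prime p) where

  private instance
    p≢0 : NonZero p
    p≢0 = prime⇒nonZero p-prime

  Zero : Pred ℤ 0ℓ
  Zero z = + p ∣ℤ z

  zero-* : ∀ {i j} → Zero (i ⊛ j) → Zero i ⊎ Zero j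
  zero-* {i} {j} d = [ inj₁ ∘ ∣ᵤ⇒∣ , inj₂ ∘ ∣ᵤ⇒∣ ]′
    (euclidsLemma ∣ i ∣ ∣ j ∣ p-prime (subst (p ∣_) (ℤ.abs-* i j) (∣⇒∣ᵤ d)))

  ¬zero : ∀ {m} → 0 < m → m < p → ¬ Zero (+ m)
  ¬zero 0<m m<p d = <⇒≱ m<p (∣⇒≤ {{>-nonZero 0<m}} (∣⇒∣ᵤ d))

  residue-unique : ∀ {m n} → m < p → n < p → Zero (+ m ⊝ + n) → m ≡ n
  residue-unique {m} {n} m<p n<p d = [ (λ m≤n → sym (below m≤n n<p (∣m⇒∣-m d) swap)) , (λ n≤m → below n≤m m<p d refl) ]′ (≤-total m n)
    where
    open ℤSolver.+-*-Solver
    swap : neg (+ m ⊝ + n) ≡ + n ⊝ + m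
    swap = solve 2 (λ m n → :- (m :- n) := n :- m) refl (+ m) (+ n)
    below : ∀ {k l z} → k ≤ l → l < p → Zero z → z ≡ + l ⊝ + k → l ≡ k
    below {k} {l} k≤l l<p d e with l ∸ k in gap
    ... | zero  = ≤-antisym (m∸n≡0⇒m≤n gap) k≤l
    ... | suc g = contradiction (subst Zero (trans e distance) d) (¬zero (s≤s z≤n) (≤-<-trans (≤-trans (≤-reflexive (sym gap)) (m∸n≤m l k)) l<p))
      where
      distance : + l ⊝ + k ≡ + suc g
      distance = trans (cong (λ t → + t ⊝ + k) (trans (sym (m+[n∸m]≡n k≤l)) (cong (_+_ k) gap)))
        (trans (cong (_⊝ + k) (ℤ.pos-+ k (suc g))) (solve 2 (λ k g → k :+ g :- k := g) refl (+ k) (+ suc g)))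

  ι : Fin p → ℤ
  ι i = + toℕ i

  ι-injective : ∀ {i j} → Zero (ι i ⊝ ι j) → i ≡ j
  ι-injective d = toℕ-injective (residue-unique (toℕ<n _) (toℕ<n _) d)

  reduce : ℤ → Fin p
  reduce z = fromℕ< (n%ℕd<d z p)

  carry : ℤ → ℤ
  carry z = z /ℕ p

  -- Naming the quotient turns a congruence into an integer identity with an explicit multiple of
  -- `+ p`, which the ring solver can check.
  ι-reduce : ∀ z → ι (reduce z) ≡ z ⊝ carry z ⊛ + p
  ι-reduce z = trans (cong +_ (toℕ-fromℕ< (n%ℕd<d z p)))
    (trans (solve 2 (λ r c → r := r :+ c :- c) refl (+ (z %ℕ p)) (carry z ⊛ + p)) (cong (_⊝ carry z ⊛ + p) (sym (a≡a%ℕn+[a/ℕn]*n z p))))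
    where open ℤSolver.+-*-Solver

  reduce-≡⇒Zero : ∀ {i j} → reduce i ≡ reduce j → Zero (i ⊝ j)
  reduce-≡⇒Zero {i} {j} e = dividesℤ (carry i ⊝ carry j) (begin
    i ⊝ j
      ≡⟨ solve 4 (λ i j c d → i :- j := (i :- c) :- (j :- d) :+ (c :- d)) refl i j (carry i ⊛ + p) (carry j ⊛ + p) ⟩
    (i ⊝ carry i ⊛ + p) ⊝ (j ⊝ carry j ⊛ + p) ⊕ (carry i ⊛ + p ⊝ carry j ⊛ + p)
      ≡⟨ cong₂ (λ s t → s ⊝ t ⊕ (carry i ⊛ + p ⊝ carry j ⊛ + p)) (ι-reduce i) (ι-reduce j) ⟨
    ι (reduce i) ⊝ ι (reduce j) ⊕ (carry i ⊛ + p ⊝ carry j ⊛ + p)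
      ≡⟨ cong (λ s → ι s ⊝ ι (reduce j) ⊕ (carry i ⊛ + p ⊝ carry j ⊛ + p)) e ⟩
    ι (reduce j) ⊝ ι (reduce j) ⊕ (carry i ⊛ + p ⊝ carry j ⊛ + p)
      ≡⟨ solve 4 (λ r c d p → r :- r :+ (c :* p :- d :* p) := (c :- d) :* p) refl (ι (reduce j)) (carry i) (carry j) (+ p) ⟩
    (carry i ⊝ carry j) ⊛ + p                                 ∎)
    where
    open ≡-Reasoning
    open ℤSolver.+-*-Solver

  On : Fin p × Fin p → Fin p × Fin p → Set
  On (x , y) (a , b) = Zero (ι a ⊛ ι x ⊕ ι b ⊝ ι y)

  on-reduce : ∀ {x y a b} → a ⊛ x ⊕ b ≡ y → On (reduce x , reduce y) (reduce a , reduce b)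
  on-reduce {x} {y} {a} {b} refl = dividesℤ (c ⊕ carry a ⊛ carry x ⊛ + p ⊝ carry a ⊛ x ⊝ a ⊛ carry x ⊝ carry b)
    (trans (cong₂ _⊝_ (cong₂ _⊕_ (cong₂ _⊛_ (ι-reduce a) (ι-reduce x)) (ι-reduce b)) (ι-reduce y))
      (solve 8 (λ a x b a′ x′ b′ c p →
        (a :- a′ :* p) :* (x :- x′ :* p) :+ (b :- b′ :* p) :- (a :* x :+ b :- c :* p)
          := (c :+ a′ :* x′ :* p :- a′ :* x :- a :* x′ :- b′) :* p) refl a x b (carry a) (carry x) (carry b) c (+ p)))
    where
    open ℤSolver.+-*-Solver
    c = carry (a ⊛ x ⊕ b)

  Node : Set
  Node = (Fin p × Fin p) ⊎ (Fin p × Fin p)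

  Incident : Rel Node 0ℓ
  Incident (inj₁ P) (inj₂ L) = On P L
  Incident (inj₂ L) (inj₁ P) = On P L
  Incident _        _        = ⊥

  incident? : Decidable₂ Incident
  incident? (inj₁ (x , y)) (inj₂ (a , b)) = + p ∣ℤ? (ι a ⊛ ι x ⊕ ι b ⊝ ι y)
  incident? (inj₂ (a , b)) (inj₁ (x , y)) = + p ∣ℤ? (ι a ⊛ ι x ⊕ ι b ⊝ ι y)
  incident? (inj₁ _) (inj₁ _) = no λ ()
  incident? (inj₂ _) (inj₂ _) = no λ ()

  incident-sym : Symmetric Incident
  incident-sym {inj₁ _} {inj₂ _} i = i
  incident-sym {inj₂ _} {inj₁ _} i = i

  incident-irrefl : ∀ {x} → ¬ Incident x x
  incident-irrefl {inj₁ _} ()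
  incident-irrefl {inj₂ _} ()

  isPoint : Node → Bool
  isPoint (inj₁ _) = true
  isPoint (inj₂ _) = false

  incident-alternates : ∀ {x y} → Incident x y → isPoint y ≡ not (isPoint x)
  incident-alternates {inj₁ _} {inj₂ _} _ = refl
  incident-alternates {inj₂ _} {inj₁ _} _ = refl

  same-point : ∀ {x y y′ L} → On (x , y) L → On (x , y′) L → y ≡ y′
  same-point {x} {y} {y′} {a , b} on on′ = ι-injective (subst Zero
    (solve 3 (λ s y y′ → (s :- y′) :- (s :- y) := y :- y′) refl (ι a ⊛ ι x ⊕ ι b) (ι y) (ι y′)) (∣m∣n⇒∣m-n on′ on))
    where open ℤSolver.+-*-Solver

  same-line : ∀ {P a b b′} → On P (a , b) → On P (a , b′) → b ≡ b′
  same-line {x , y} {a} {b} {b′} on on′ = ι-injective (subst Zero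
    (solve 4 (λ s y b b′ → (s :+ b :- y) :- (s :+ b′ :- y) := b :- b′) refl (ι a ⊛ ι x) (ι y) (ι b) (ι b′)) (∣m∣n⇒∣m-n on on′))
    where open ℤSolver.+-*-Solver

  -- The alternating sum of the four incidences is (a - a′)(x - x′). Primality makes one factor
  -- vanish; equal slopes then force equal intercepts, and equal abscissas force equal ordinates.
  two-points-two-lines : ∀ {P Q L M} → On P L → On Q L → On P M → On Q M → P ≡ Q ⊎ L ≡ M
  two-points-two-lines {x , y} {x′ , y′} {a , b} {a′ , b′} PL QL PM QM = cases
    (zero-* {ι a ⊝ ι a′} {ι x ⊝ ι x′} (subst Zero
      (solve 8 (λ x y x′ y′ a b a′ b′ →
        (a :* x :+ b :- y) :- (a :* x′ :+ b :- y′) :- ((a′ :* x :+ b′ :- y) :- (a′ :* x′ :+ b′ :- y′)) := (a :- a′) :* (x :- x′))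
        refl (ι x) (ι y) (ι x′) (ι y′) (ι a) (ι b) (ι a′) (ι b′))
      (∣m∣n⇒∣m-n (∣m∣n⇒∣m-n PL QL) (∣m∣n⇒∣m-n PM QM))))
    where
    open ℤSolver.+-*-Solver
    on-same-line : a ≡ a′ → b ≡ b′
    on-same-line e = same-line {x , y} {a} PL (subst (λ a → On (x , y) (a , b′)) (sym e) PM)
    on-same-point : x ≡ x′ → y ≡ y′
    on-same-point e = same-point {x} {L = a , b} PL (subst (λ x → On (x , y′) (a , b)) (sym e) QL)
    cases : Zero (ι a ⊝ ι a′) ⊎ Zero (ι x ⊝ ι x′) → (x , y) ≡ (x′ , y′) ⊎ (a , b) ≡ (a′ , b′)
    cases (inj₁ d) = inj₂ (cong₂ _,_ (ι-injective d) (on-same-line (ι-injective d)))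
    cases (inj₂ d) = inj₁ (cong₂ _,_ (ι-injective d) (on-same-point (ι-injective d)))

  no-4-walk : ¬ CyclicWalk Incident 4
  no-4-walk W = from-node (at 0) (at 1) (at 2) (at 3) refl refl refl refl
    where
    open CyclicWalk W
    3≤4 : 3 ≤ 4
    3≤4 = s≤s (s≤s (s≤s z≤n))
    from-node : ∀ s₀ s₁ s₂ s₃ → at 0 ≡ s₀ → at 1 ≡ s₁ → at 2 ≡ s₂ → at 3 ≡ s₃ → ⊥
    from-node s₀ s₁ s₂ s₃ e₀ e₁ e₂ e₃ = square s₀ s₁ s₂ s₃
      (subst₂ Incident e₀ e₁ (step 0)) (subst₂ Incident e₁ e₂ (step 1)) (subst₂ Incident e₂ e₃ (step 2))
      (subst₂ Incident e₃ (trans (periodic 0) e₀) (step 3))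
      (λ e → no-backtrack 3≤4 0 (trans e₂ (trans (sym e) (sym e₀))))
      (λ e → no-backtrack 3≤4 1 (trans e₃ (trans (sym e) (sym e₁))))
      where
      square : ∀ s₀ s₁ s₂ s₃ → Incident s₀ s₁ → Incident s₁ s₂ → Incident s₂ s₃ → Incident s₃ s₀ → s₀ ≢ s₂ → s₁ ≢ s₃ → ⊥
      square (inj₁ P) (inj₂ L) (inj₁ Q) (inj₂ M) PL LQ QM MP P≢Q L≢M =
        [ P≢Q ∘ cong inj₁ , L≢M ∘ cong inj₂ ]′ (two-points-two-lines PL LQ MP QM)
      square (inj₂ L) (inj₁ P) (inj₂ M) (inj₁ Q) LP PM MQ QL L≢M P≢Q =
        [ P≢Q ∘ cong inj₁ , L≢M ∘ cong inj₂ ]′ (two-points-two-lines LP QL PM MQ)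

  enum : Fin (p * p + p * p) ↔ Node
  enum = (*↔× ⊎-↔ *↔×) ↔-∘ +↔⊎

  -- The triangles with vertices at x, x + s, x + s + t whose sides have slopes
  -- c + t r, c − s r, c: all incidences hold already over the integers.
  module Triangles {h : ℕ} (2h<p : h + h < p) (r : ℕ) where

    open Realise enum incident? (λ {x} {y} → incident-sym {x} {y}) (λ {x} → incident-irrefl {x}) r

    -- Coordinates of the first point, the slope of the third side, and the offsets s, t, d less
    -- one. The shift by one and `2h<p` keep the offsets and also s + t nonzero modulo `p`.
    Index : Set
    Index = Fin h × Fin h × Fin h × Fin h × Fin h × Fin h

    private
      module Triangle (i : Index) where
        x₁ y₁ a₃ s t d x₂ x₃ a₁ a₂ b₁ b₂ b₃ y₂ y₃ : ℤ
        x₁ = let (x , _) = i in + toℕ x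
        y₁ = let (_ , y , _) = i in + toℕ y
        a₃ = let (_ , _ , c , _) = i in + toℕ c
        s  = let (_ , _ , _ , s , _) = i in + suc (toℕ s)
        t  = let (_ , _ , _ , _ , t , _) = i in + suc (toℕ t)
        d  = let (_ , _ , _ , _ , _ , r) = i in + suc (toℕ r)
        x₂ = x₁ ⊕ s
        x₃ = x₂ ⊕ t
        a₁ = a₃ ⊕ t ⊛ d
        a₂ = a₃ ⊝ s ⊛ d
        b₁ = y₁ ⊝ a₁ ⊛ x₁
        y₂ = a₁ ⊛ x₂ ⊕ b₁
        b₂ = y₂ ⊝ a₂ ⊛ x₂
        b₃ = y₁ ⊝ a₃ ⊛ x₁
        y₃ = a₃ ⊛ x₃ ⊕ b₃

        cancel : ∀ k y → k ⊕ (y ⊝ k) ≡ y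
        cancel = solve 2 (λ k y → k :+ (y :- k) := y) refl
          where open ℤSolver.+-*-Solver

        third-side : a₂ ⊛ x₃ ⊕ b₂ ≡ y₃
        third-side = solve 6 (λ x y a s t d →
          let a₁ = a :+ t :* d
              a₂ = a :- s :* d
              y₂ = a₁ :* (x :+ s) :+ (y :- a₁ :* x)
          in a₂ :* (x :+ s :+ t) :+ (y₂ :- a₂ :* (x :+ s)) := a :* (x :+ s :+ t) :+ (y :- a :* x))
          refl x₁ y₁ a₃ s t d
          where open ℤSolver.+-*-Solver

        corners : Node × Node × Node × Node × Node × Node
        corners = inj₁ (reduce x₁ , reduce y₁) , inj₂ (reduce a₁ , reduce b₁)
                , inj₁ (reduce x₂ , reduce y₂) , inj₂ (reduce a₂ , reduce b₂)
                , inj₁ (reduce x₃ , reduce y₃) , inj₂ (reduce a₃ , reduce b₃)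

      h≤p : h ≤ p
      h≤p = ≤-trans (m≤m+n h h) (<⇒≤ 2h<p)

      toℕ<p : (i : Fin h) → toℕ i < p
      toℕ<p i = <-≤-trans (toℕ<n i) h≤p

      ¬zero-suc : (i : Fin h) → ¬ Zero (+ suc (toℕ i))
      ¬zero-suc i = ¬zero (s≤s z≤n) (≤-<-trans (≤-trans (toℕ<n i) (m≤m+n h h)) 2h<p)

      ¬zero-sum : (i j : Fin h) → ¬ Zero (+ (suc (toℕ i) + suc (toℕ j)))
      ¬zero-sum i j = ¬zero (s≤s z≤n) (≤-<-trans (+-mono-≤ (toℕ<n i) (toℕ<n j)) 2h<p)

      ¬zero-* : ∀ {i j} → ¬ Zero i → ¬ Zero j → ¬ Zero (i ⊛ j)
      ¬zero-* ¬i ¬j z = [ ¬i , ¬j ]′ (zero-* z)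

      distinct : ∀ {i j k} → ¬ Zero k → i ⊝ j ≡ k → reduce i ≢ reduce j
      distinct {i} {j} ¬k e i≡j = ¬k (subst Zero e (reduce-≡⇒Zero {i} {j} i≡j))

      ¬zero-neg : ∀ {i} → ¬ Zero i → ¬ Zero (neg i)
      ¬zero-neg ¬i z = ¬i (subst Zero (ℤ.neg-involutive _) (∣m⇒∣-m z))

    corners : Index → Node × Node × Node × Node × Node × Node
    corners i = Triangle.corners i

    corners-hexagon : ∀ i → HexagonIn (corners i)
    corners-hexagon i@(_ , _ , _ , s′ , t′ , d′) = record
      { r₀₁ = on-reduce {x₁} {y₁} {a₁} {b₁} (cancel (a₁ ⊛ x₁) y₁)
      ; r₁₂ = on-reduce {x₂} {y₂} {a₁} {b₁} refl
      ; r₂₃ = on-reduce {x₂} {y₂} {a₂} {b₂} (cancel (a₂ ⊛ x₂) y₂)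
      ; r₃₄ = on-reduce {x₃} {y₃} {a₂} {b₂} third-side
      ; r₄₅ = on-reduce {x₃} {y₃} {a₃} {b₃} refl
      ; r₅₀ = on-reduce {x₁} {y₁} {a₃} {b₃} (cancel (a₃ ⊛ x₁) y₁)
      ; s₀≢s₂ = λ e → distinct {x₁} {x₂} (¬zero-neg (¬zero-suc s′)) (solve 2 (λ x s → x :- (x :+ s) := :- s) refl x₁ s) (cong proj₁ (inj₁-injective e))
      ; s₂≢s₄ = λ e → distinct {x₂} {x₃} (¬zero-neg (¬zero-suc t′)) (solve 2 (λ x s → x :- (x :+ s) := :- s) refl x₂ t) (cong proj₁ (inj₁-injective e))
      ; s₄≢s₀ = λ e → distinct {x₃} {x₁} (¬zero-sum s′ t′) (solve 3 (λ x s t → x :+ s :+ t :- x := s :+ t) refl x₁ s t) (cong proj₁ (inj₁-injective e))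
      ; s₁≢s₃ = λ e → distinct {a₁} {a₂} (¬zero-* (¬zero-sum s′ t′) (¬zero-suc d′))
                  (solve 4 (λ a s t d → a :+ t :* d :- (a :- s :* d) := (s :+ t) :* d) refl a₃ s t d) (cong proj₁ (inj₂-injective e))
      ; s₃≢s₅ = λ e → distinct {a₂} {a₃} (¬zero-neg (¬zero-* (¬zero-suc s′) (¬zero-suc d′)))
                  (solve 3 (λ a s d → a :- s :* d :- a := :- (s :* d)) refl a₃ s d) (cong proj₁ (inj₂-injective e))
      ; s₅≢s₁ = λ e → distinct {a₃} {a₁} (¬zero-neg (¬zero-* (¬zero-suc t′) (¬zero-suc d′)))
                  (solve 3 (λ a t d → a :- (a :+ t :* d) := :- (t :* d)) refl a₃ t d) (cong proj₁ (inj₂-injective e))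
      ; s₀≢s₃ = λ ()
      ; s₁≢s₄ = λ ()
      ; s₂≢s₅ = λ ()
      }
      where
      open Triangle i
      open ℤSolver.+-*-Solver

    private
      small-injective : {i j : Fin h} → Zero (+ toℕ i ⊝ + toℕ j) → i ≡ j
      small-injective z = toℕ-injective (residue-unique (toℕ<p _) (toℕ<p _) z)

      suc-injective-mod : {i j : Fin h} → Zero (+ suc (toℕ i) ⊝ + suc (toℕ j)) → i ≡ j
      suc-injective-mod {i} {j} z = toℕ-injective (suc-injective (residue-unique (small i) (small j) z))
        where
        small : (i : Fin h) → suc (toℕ i) < p
        small i = ≤-<-trans (≤-trans (toℕ<n i) (m≤m+n h h)) 2h<p

    -- The parameters are read off in turn: the first point, the slope `a₃`, then s and t from the
    -- abscissas, and finally d from a₁ - a₃ = t d, where t can be cancelled.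
    corners-injective : ∀ {i j} → corners i ≡ corners j → i ≡ j
    corners-injective {x , y , c , s , t , d} {x′ , y′ , c′ , s′ , t′ , d′} e =
      match (small-injective (reduce-≡⇒Zero {T.x₁} {T′.x₁} (cong proj₁ P₁)))
            (small-injective (reduce-≡⇒Zero {T.y₁} {T′.y₁} (cong proj₂ P₁)))
            (small-injective (reduce-≡⇒Zero {T.a₃} {T′.a₃} (cong proj₁ L₃)))
      where
      open ℤSolver.+-*-Solver
      module T = Triangle (x , y , c , s , t , d)
      module T′ = Triangle (x′ , y′ , c′ , s′ , t′ , d′)
      P₁ : (reduce T.x₁ , reduce T.y₁) ≡ (reduce T′.x₁ , reduce T′.y₁)
      P₁ = inj₁-injective (cong proj₁ e)
      L₁ : reduce T.a₁ ≡ reduce T′.a₁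
      L₁ = cong proj₁ (inj₂-injective (cong (proj₁ ∘ proj₂) e))
      P₂ : reduce T.x₂ ≡ reduce T′.x₂
      P₂ = cong proj₁ (inj₁-injective (cong (proj₁ ∘ proj₂ ∘ proj₂) e))
      P₃ : reduce T.x₃ ≡ reduce T′.x₃
      P₃ = cong proj₁ (inj₁-injective (cong (proj₁ ∘ proj₂ ∘ proj₂ ∘ proj₂ ∘ proj₂) e))
      L₃ : (reduce T.a₃ , reduce T.b₃) ≡ (reduce T′.a₃ , reduce T′.b₃)
      L₃ = inj₂-injective (cong (proj₂ ∘ proj₂ ∘ proj₂ ∘ proj₂ ∘ proj₂) e)
      drop : ∀ {k k′} o → reduce (o ⊕ k) ≡ reduce (o ⊕ k′) → Zero (k ⊝ k′)
      drop {k} {k′} o e = subst Zero (solve 3 (λ o k k′ → o :+ k :- (o :+ k′) := k :- k′) refl o k k′) (reduce-≡⇒Zero {o ⊕ k} {o ⊕ k′} e)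
      match : x ≡ x′ → y ≡ y′ → c ≡ c′ → (x , y , c , s , t , d) ≡ (x′ , y′ , c′ , s′ , t′ , d′)
      match refl refl refl = cong (λ k → x , y , c , k) (match′ (suc-injective-mod (drop {T.s} {T′.s} T.x₁ P₂)))
        where
        match′ : s ≡ s′ → (s , t , d) ≡ (s′ , t′ , d′)
        match′ refl = cong (s ,_) (match″ (suc-injective-mod (drop {T.t} {T′.t} T.x₂ P₃)))
          where
          match″ : t ≡ t′ → (t , d) ≡ (t′ , d′)
          match″ refl = cong (t ,_) (suc-injective-mod
            ([ (λ z → contradiction z (¬zero-suc t)) , id ]′ (zero-* {T.t} {T.d ⊝ T′.d}
              (subst Zero (solve 3 (λ t d d′ → t :* d :- t :* d′ := t :* (d :- d′)) refl T.t T.d T′.d) (drop {T.t ⊛ T.d} {T.t ⊛ T′.d} T.a₃ L₁)))))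

    plane-many : {A : Pred ℕ 0ℓ} → (∀ a → a ∈ A → 3 ≤ a) → (∀ {a} → a ∈ A → 3 ≤ a → ¬ CyclicWalk Incident a) →
                 ManyHexagons A (h * (h * (h * (h * (h * h))))) (p * p + p * p + r)
    plane-many = family-many
      ((↔-id _ ×-↔ (↔-id _ ×-↔ (↔-id _ ×-↔ (↔-id _ ×-↔ *↔×) ↔-∘ *↔×) ↔-∘ *↔×) ↔-∘ *↔×) ↔-∘ *↔×)
      corners corners-injective corners-hexagon

-- Assembling the four cases

^-distribʳ-* : ∀ m n j → (m * n) ^ j ≡ m ^ j * n ^ j
^-distribʳ-* m n zero    = refl
^-distribʳ-* m n (suc j) = trans (cong (m * n *_) (^-distribʳ-* m n j))
  (solve 4 (λ m n s t → m :* n :* (s :* t) := m :* s :* (n :* t)) refl m n (m ^ j) (n ^ j))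
  where open +-*-Solver

n<2^n : ∀ n → n < 2 ^ n
n<2^n zero    = s≤s z≤n
n<2^n (suc n) = +-mono-≤ (m^n>0 2 n) (≤-trans (n<2^n n) (≤-reflexive (sym (+-identityʳ (2 ^ n)))))

pad : ∀ {N n} M c → M ≡ N → c ≤ n → (∀ r → ManyHexagons A M (c + r)) → ManyHexagons A N n
pad {A} {n = n} M c refl c≤n many = subst (ManyHexagons A M) (m+[n∸m]≡n c≤n) (many (n ∸ c))

-- `m` is the size parameter of a construction. It is linear in `n`, so the jth power of `e` and the
-- number of labellings make up the lower constant.
isΘ : ∀ e d N j → 0 < e → 0 < d →
      (∀ n → N ≤ n → ∃[ m ] n ≤ e * m × ManyHexagons A (m ^ j) n) →
      (∀ n (G : Graph n) → Free (𝓒 A) G → copies (C 6) G ≤ d * n ^ j) →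
      (λ n → IsEx n (C 6) (𝓒 A)) IsΘ (λ n → n ^ j)
isΘ {A} e d N j 0<e 0<d lower upper =
  e ^ j * labellings , d , N , *-mono-≤ (m^n>0 e {{>-nonZero 0<e}} j) (s≤s z≤n) , 0<d ,
  λ n N≤n m ex → lower-bound n m ex (lower n N≤n) , upper-bound n m ex
  where
  lower-bound : ∀ n m → IsEx n (C 6) (𝓒 A) m → (∃[ l ] n ≤ e * l × ManyHexagons A (l ^ j) n) → n ^ j ≤ e ^ j * labellings * m
  lower-bound n m ex (l , n≤ , G , free , many) = begin
    n ^ j                                  ≤⟨ ^-monoˡ-≤ j n≤ ⟩
    (e * l) ^ j                            ≡⟨ ^-distribʳ-* e l j ⟩
    e ^ j * l ^ j                          ≤⟨ *-monoʳ-≤ (e ^ j) (≤-trans many (*-monoˡ-≤ labellings (IsEx.bound ex G free))) ⟩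
    e ^ j * (m * labellings)               ≡⟨ cong (e ^ j *_) (*-comm m labellings) ⟩
    e ^ j * (labellings * m)               ≡⟨ *-assoc (e ^ j) labellings m ⟨
    e ^ j * labellings * m                 ∎
    where open ≤-Reasoning
  upper-bound : ∀ n m → IsEx n (C 6) (𝓒 A) m → m ≤ d * n ^ j
  upper-bound n m ex = let (G , free , e) = IsEx.attained ex in subst (_≤ d * n ^ j) e (upper n G free)

-- With parameter m the theta graph and the bicliques need 2 + 4m, 3 + 3m or 6m vertices, never more
-- than 6m once m is positive.
sixth : ∀ n → 6 ≤ n → ∃[ m ] 1 ≤ m × m * 6 ≤ n × n ≤ 12 * m
sixth n 6≤n = m , 1≤m , ≤-trans (m≤n+m (m * 6) (n % 6)) (≤-reflexive (sym n≡)) , (begin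
  n                  ≡⟨ n≡ ⟩
  n % 6 + m * 6      ≤⟨ +-monoˡ-≤ (m * 6) (<⇒≤ (m%n<n n 6)) ⟩
  6 + m * 6          ≤⟨ +-monoˡ-≤ (m * 6) (*-monoˡ-≤ 6 1≤m) ⟩
  m * 6 + m * 6      ≡⟨ solve 1 (λ m → m :* con 6 :+ m :* con 6 := con 12 :* m) refl m ⟩
  12 * m             ∎)
  where
  open ≤-Reasoning
  open +-*-Solver
  m = n / 6
  n≡ : n ≡ n % 6 + m * 6
  n≡ = m≡m%n+[m/n]*n n 6
  1≤m : 1 ≤ m
  1≤m = n≢0⇒n>0 λ m≡0 → <⇒≱ (m%n<n n 6) (≤-trans 6≤n (≤-reflexive (trans n≡ (trans (cong (λ m → n % 6 + m * 6) m≡0) (+-identityʳ (n % 6))))))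

crossing : {P : Pred ℕ 0ℓ} → Decidable₁ P → P 0 → ∀ k → ¬ P k → ∃[ i ] P i × ¬ P (suc i)
crossing P? P0 zero    ¬P = contradiction P0 ¬P
crossing P? P0 (suc k) ¬P with P? k
... | yes Pk = k , Pk , ¬P
... | no ¬Pk = crossing P? P0 k ¬Pk

-- `M` is the upper end of the interval in `prime-between g`, so this bounds the 2p² vertices of the
-- incidence graph. Consecutive values have ratio 16.
planeSize : ℕ → ℕ
planeSize g = 2 * (M * M)
  where M = 2 ^ (2 + g) * 2 ^ (2 + g)

plane-scale : ∀ n → planeSize 8 ≤ n → ∃[ i ] planeSize (i + 8) ≤ n × n ≤ planeSize (suc (i + 8))
plane-scale n N≤n =
  let (i , below , ¬above) = crossing (λ i → planeSize (i + 8) ≤? n) N≤n n (<⇒≱ n<)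
  in i , below , <⇒≤ (≰⇒> ¬above)
  where
  open ≤-Reasoning
  e = 2 + (n + 8)
  M = 2 ^ e * 2 ^ e
  instance
    _ = m^n≢0 2 e
    _ = m*n≢0 (2 ^ e) (2 ^ e)
  n< : n < planeSize (n + 8)
  n< = begin-strict
    n                <⟨ n<2^n n ⟩
    2 ^ n            ≤⟨ ^-monoʳ-≤ 2 (m≤n⇒m≤1+n (m≤n⇒m≤1+n (m≤m+n n 8))) ⟩
    2 ^ e            ≤⟨ m≤m*n (2 ^ e) (2 ^ e) ⟩
    M                ≤⟨ m≤m*n M M ⟩
    M * M            ≤⟨ m≤n*m (M * M) 2 ⟩
    2 * (M * M)      ∎

double-fourth-power : ∀ m e c → 1 + ((m + m) + (m + m)) ≡ c + (e + e) →
                      2 * (2 ^ m * 2 ^ m * (2 ^ m * 2 ^ m)) ≡ 2 ^ c * (2 ^ e * 2 ^ e)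
double-fourth-power m e c exponents = begin
  2 * (2 ^ m * 2 ^ m * (2 ^ m * 2 ^ m))    ≡⟨ cong (λ t → 2 * (t * t)) (^-distribˡ-+-* 2 m m) ⟨
  2 * (2 ^ (m + m) * 2 ^ (m + m))          ≡⟨ cong (2 *_) (^-distribˡ-+-* 2 (m + m) (m + m)) ⟨
  2 ^ (1 + ((m + m) + (m + m)))            ≡⟨ cong (2 ^_) exponents ⟩
  2 ^ (c + (e + e))                        ≡⟨ ^-distribˡ-+-* 2 c (e + e) ⟩
  2 ^ c * 2 ^ (e + e)                      ≡⟨ cong (2 ^ c *_) (^-distribˡ-+-* 2 e e) ⟩
  2 ^ c * (2 ^ e * 2 ^ e)                  ∎
  where open ≡-Reasoning

-- The square on the right is h², for the `h` of `plane-lower` at scale g + 1. Thus even the next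
-- scale exceeds h² only by the constant 2^15.
planeSize-suc : ∀ g → planeSize (suc (suc g)) ≡ 2 ^ 15 * (2 ^ (g + suc g) * 2 ^ (g + suc g))
planeSize-suc g = double-fourth-power (2 + suc (suc g)) (g + suc g) 15
  (solve 1 (λ g → let m = con 2 :+ (con 1 :+ (con 1 :+ g)) ; e = g :+ (con 1 :+ g) in
     con 1 :+ ((m :+ m) :+ (m :+ m)) := con 15 :+ (e :+ e)) refl g)
  where open +-*-Solver

cubicBound : ℕ → ℕ
cubicBound k = 216 * (K * K * K)
  where K = 2 + k * 2

quadraticBound : ℕ → ℕ
quadraticBound k = 6 * (D * D) + 96 * (K * K)
  where
  B D K : ℕ
  B = 4 + (4 + k) * 2
  D = suc (B * 1 + B * 1)
  K = suc B

module _ (A : Pred ℕ 0ℓ) (3≤A : ∀ a → a ∈ A → 3 ≤ a) where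

  theta-lower : 6 ∉ A → ∀ n → 6 ≤ n → ∃[ m ] n ≤ 12 * m × ManyHexagons A (m ^ 2) n
  theta-lower 6∉A n 6≤n =
    let (m , 1≤m , 6m≤n , n≤12m) = sixth n 6≤n in
    m , n≤12m , pad (m * m) (2 + 2 * (2 * m)) (cong (m *_) (sym (*-identityʳ m))) (≤-trans (size m 1≤m) 6m≤n)
      (Theta.theta-many m 3≤A (λ a∈A 3≤a W → 6∉A (subst (_∈ A) (Theta.theta-walk m 3≤a W) a∈A)))
    where
    size : ∀ m → 1 ≤ m → 2 + 2 * (2 * m) ≤ m * 6
    size m 1≤m = ≤-trans (+-monoˡ-≤ (2 * (2 * m)) (*-monoʳ-≤ 2 1≤m))
      (≤-reflexive (solve 1 (λ m → con 2 :* m :+ con 2 :* (con 2 :* m) := m :* con 6) refl m))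
      where open +-*-Solver

  biclique-lower : 4 ∉ A → 6 ∉ A → ∀ n → 6 ≤ n → ∃[ m ] n ≤ 12 * m × ManyHexagons A (m ^ 3) n
  biclique-lower 4∉A 6∉A n 6≤n =
    let (m , 1≤m , 6m≤n , n≤12m) = sixth n 6≤n in
    m , n≤12m , pad (1 * (m * (1 * (m * (1 * m))))) (3 * 1 + 3 * m) (cube m) (≤-trans (size m 1≤m) 6m≤n)
      (Biclique.biclique-many 1 m 3≤A (λ a∈A 3≤a W →
        [ (λ e → 4∉A (subst (_∈ A) e a∈A)) , (λ e → 6∉A (subst (_∈ A) e a∈A)) ]′ (biclique-walk 3≤a W)))
    where
    open +-*-Solver
    size : ∀ m → 1 ≤ m → 3 * 1 + 3 * m ≤ m * 6
    size m 1≤m = ≤-trans (+-monoˡ-≤ (3 * m) (*-monoʳ-≤ 3 1≤m)) (≤-reflexive (solve 1 (λ m → con 3 :* m :+ con 3 :* m := m :* con 6) refl m))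
    cube : ∀ m → 1 * (m * (1 * (m * (1 * m)))) ≡ m ^ 3
    cube = solve 1 (λ m → con 1 :* (m :* (con 1 :* (m :* (con 1 :* m)))) := m :* (m :* (m :* con 1))) refl

  balanced-lower : Empty (evens A) → ∀ n → 6 ≤ n → ∃[ m ] n ≤ 12 * m × ManyHexagons A (m ^ 6) n
  balanced-lower no-even n 6≤n =
    let (m , 1≤m , 6m≤n , n≤12m) = sixth n 6≤n in
    m , n≤12m , pad (m * (m * (m * (m * (m * m))))) (3 * m + 3 * m) (sixth-power m) (≤-trans (≤-reflexive (size m)) 6m≤n)
      (let open Biclique m m in
       biclique-many 3≤A (λ a∈A _ W → no-even _ (a∈A , bipartite⇒even side (λ {x} {y} → across-alternates {x} {y}) W)))
    where
    open +-*-Solver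
    size : ∀ m → 3 * m + 3 * m ≡ m * 6
    size = solve 1 (λ m → con 3 :* m :+ con 3 :* m := m :* con 6) refl
    sixth-power : ∀ m → m * (m * (m * (m * (m * m)))) ≡ m ^ 6
    sixth-power = solve 1 (λ m → m :* (m :* (m :* (m :* (m :* m)))) := m :* (m :* (m :* (m :* (m :* (m :* con 1)))))) refl

  plane-lower : (∀ {a} → a ∈ A → 2 ∣ a → a ≡ 4) → ∀ n → planeSize 8 ≤ n → ∃[ m ] n ≤ 2 ^ 15 * m × ManyHexagons A (m ^ 3) n
  plane-lower only-4 n N≤n =
    let (i , size≤n , n≤size) = plane-scale n N≤n
        e : i + 8 ≡ suc (i + 7)
        e = +-suc i 7
    in at-scale (i + 7) (m≤n+m 7 i) (subst (λ g → planeSize g ≤ n) e size≤n) (subst (λ g → n ≤ planeSize (suc g)) e n≤size)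
    where
    open +-*-Solver
    cube-of-square : ∀ h → h * (h * (h * (h * (h * h)))) ≡ (h * h) ^ 3
    cube-of-square = solve 1 (λ h → h :* (h :* (h :* (h :* (h :* h)))) := (h :* h) :* ((h :* h) :* ((h :* h) :* con 1))) refl
    at-scale : ∀ g → 7 ≤ g → planeSize (suc g) ≤ n → n ≤ planeSize (suc (suc g)) → ∃[ m ] n ≤ 2 ^ 15 * m × ManyHexagons A (m ^ 3) n
    at-scale g 7≤g size≤n n≤size =
      let (p , p-prime , 4^g<p , p≤M) = prime-between (suc g) (s≤s 7≤g)
          -- Half of 4^(g+1), the lower end of the interval containing `p`; writing the scale as a
          -- successor makes this an exact power of two.
          h = 2 ^ (g + suc g)
          2h<p : h + h < p
          2h<p = subst (_< p) (cong (_+_ h) (+-identityʳ h)) 4^g<p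
      in h * h , ≤-trans n≤size (≤-reflexive (planeSize-suc g)) ,
         pad (h * (h * (h * (h * (h * h))))) (p * p + p * p) (cube-of-square h)
           (≤-trans (≤-trans (≤-reflexive (cong (_+_ (p * p)) (sym (+-identityʳ (p * p))))) (*-monoʳ-≤ 2 (*-mono-≤ p≤M p≤M))) size≤n)
           (λ r → let open Plane p-prime
            in Triangles.plane-many {h} 2h<p r 3≤A (λ a∈A _ W → no-4-walk (subst (CyclicWalk Incident)
                (only-4 a∈A (bipartite⇒even isPoint (λ {x} {y} → incident-alternates {x} {y}) W)) W)))

  free-of : ∀ {n a b} {G : Graph n} → Free (𝓒 A) G → a ∈ A → a ≡ b → ¬ Contains G (C b)
  free-of free a∈A refl = free _ _ (cycle a∈A)

  cubic-upper : ∀ k → 1 ≤ k → k * 2 ∈ A → ∀ n (G : Graph n) → Free (𝓒 A) G → copies (C 6) G ≤ cubicBound k * n ^ 3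
  cubic-upper k 1≤k 2k∈A n G free = EvenCycleFree.copies-≤ 1≤k G (free-of free 2k∈A refl)

  quadratic-upper : ∀ k → 4 ∈ A → (4 + k) * 2 ∈ A →
                    ∀ n (G : Graph n) → Free (𝓒 A) G → copies (C 6) G ≤ quadraticBound k * n ^ 2
  quadratic-upper k 4∈A 2k∈A n G free = C4EvenCycleFree.copies-≤ {k′ = k} G (free-of free 4∈A refl) (free-of free 2k∈A refl)

  trivial-upper : ∀ n (G : Graph n) → copies (C 6) G ≤ 1 * n ^ 6
  trivial-upper n G = hexagons-≲⇒copies-≤ {G = G} (≲-mono (≤-reflexive (sixth-power n))
    (≲-⊆ {P = Within λ _ → ⊤} (λ _ → tt , tt , tt , tt , tt , tt) (hexagons-within (≲-allFin {n = n}))))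
    where
    open +-*-Solver
    sixth-power : ∀ n → n * n * n * n * n * n ≡ 1 * n ^ 6
    sixth-power = solve 1 (λ n → n :* n :* n :* n :* n :* n := con 1 :* (n :* (n :* (n :* (n :* (n :* (n :* con 1))))))) refl

  large-even : ∀ {a} → a ∈ A → 2 ∣ a → a ≢ 4 → a ≢ 6 → ∃[ k ] (4 + k) * 2 ∈ A
  large-even a∈A (divides 0 refl) _ _ = contradiction (3≤A _ a∈A) λ ()
  large-even a∈A (divides 1 refl) _ _ = contradiction (3≤A _ a∈A) λ { (s≤s (s≤s ())) }
  large-even a∈A (divides 2 refl) a≢4 _ = contradiction refl a≢4
  large-even a∈A (divides 3 refl) _ a≢6 = contradiction refl a≢6
  large-even a∈A (divides (suc (suc (suc (suc k)))) refl) _ _ = k , a∈A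

  no-hexagons : 6 ∈ A → ∀ n → IsEx n (C 6) (𝓒 A) 0
  no-hexagons 6∈A n = record
    { attained = edgeless n , edgeless-free 3≤A , n≤0⇒n≡0 (none (edgeless n) (edgeless-free 3≤A))
    ; bound    = none
    }
    where
    none : (G : Graph n) → Free (𝓒 A) G → copies (C 6) G ≤ 0
    none G free = hexagons-≲⇒copies-≤ {G = G} (≲-empty λ h → let (K , copy , _) = hexagon⇒copy h in free-of free 6∈A refl (K , copy))

  quadratic : 6 ∉ A × 4 ∈ A × AtLeastTwo (evens A) → (λ n → IsEx n (C 6) (𝓒 A)) IsΘ (λ n → n ^ 2)
  quadratic (6∉A , 4∈A , a , b , a≢b , (a∈A , 2∣a) , (b∈A , 2∣b)) =
    let (k , 2k∈A) = second (a ≟ 4) in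
    isΘ 12 (quadraticBound k) 6 2 (s≤s z≤n) (s≤s z≤n) (theta-lower 6∉A) (quadratic-upper k 4∈A 2k∈A)
    where
    ≢6 : ∀ {c} → c ∈ A → c ≢ 6
    ≢6 c∈A refl = 6∉A c∈A
    second : Dec (a ≡ 4) → ∃[ k ] (4 + k) * 2 ∈ A
    second (yes a≡4) = large-even b∈A 2∣b (λ b≡4 → a≢b (trans a≡4 (sym b≡4))) (≢6 b∈A)
    second (no  a≢4) = large-even a∈A 2∣a a≢4 (≢6 a∈A)

  cubic : (4 ∉ A × 6 ∉ A × Satisfiable (evens A)) ⊎ (evens A ≐ ｛ 4 ｝) → (λ n → IsEx n (C 6) (𝓒 A)) IsΘ (λ n → n ^ 3)
  cubic (inj₁ (4∉A , 6∉A , a , a∈A , 2∣a)) =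
    let (k , 2k∈A) = large-even a∈A 2∣a (λ { refl → 4∉A a∈A }) (λ { refl → 6∉A a∈A }) in
    isΘ 12 (cubicBound (4 + k)) 6 3 (s≤s z≤n) (s≤s z≤n) (biclique-lower 4∉A 6∉A) (cubic-upper (4 + k) (s≤s z≤n) 2k∈A)
  cubic (inj₂ (evens⊆4 , 4⊆evens)) =
    -- C₄ itself is the forbidden even cycle of the upper bound, hence half-length 2.
    isΘ (2 ^ 15) (cubicBound 2) (planeSize 8) 3 (m^n>0 2 15) (s≤s z≤n) (plane-lower λ a∈A 2∣a → sym (evens⊆4 (a∈A , 2∣a)))
      (cubic-upper 2 (s≤s z≤n) (proj₁ (4⊆evens refl)))

  sextic : Empty (evens A) → (λ n → IsEx n (C 6) (𝓒 A)) IsΘ (λ n → n ^ 6)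
  sextic no-even = isΘ 12 1 6 6 (s≤s z≤n) (s≤s z≤n) (balanced-lower no-even) (λ n G _ → trivial-upper n G)

theorem16 : (A : Pred ℕ 0ℓ) → (∀ a → a ∈ A → 3 ≤ a) →
    (6 ∈ A → ∀ n → IsEx n (C 6) (𝓒 A) 0) ×
    (6 ∉ A × 4 ∈ A × AtLeastTwo (evens A) →
    (λ n → IsEx n (C 6) (𝓒 A)) IsΘ (λ n → n ^ 2)) ×
    ((4 ∉ A × 6 ∉ A × Satisfiable (evens A)) ⊎ (evens A ≐ ｛ 4 ｝) →
    (λ n → IsEx n (C 6) (𝓒 A)) IsΘ (λ n → n ^ 3)) ×
    (Empty (evens A) →
    (λ n → IsEx n (C 6) (𝓒 A)) IsΘ (λ n → n ^ 6))
theorem16 A 3≤A = no-hexagons A 3≤A , quadratic A 3≤A , cubic A 3≤A , sextic A 3≤A
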